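{- Let $m$ be an even positive integer, written as $m=2^k n$ with $n$ odd and $k\ge1$, and let $M=\{a_1,\dots,a_m\}$ be a multiset of $m$ elements of $\mathbb{Z}_m$. Suppose that (i) it is not the case that all elements of $M$ have the same odd residue modulo $2^k$, and (ii) $M$ is not of the form $\{a,a,\dots,a,a+b,a-b\}$ (with $m-2$ copies of $a$) with $a$ even and $\gcd(b,m)=1$. Then, after a suitable permutation of the indices, $\sum_{i=1}^m i a_i=0$ in $\mathbb{Z}_m$. -}

module Defs where

open import Data.Nat using (ℕ; zero; suc; _+_; _*_; _^_; _%_; NonZero; _≤_)
open import Data.Nat.Properties using (m^n≢0)
open import Data.Nat.GCD using (gcd)
open import Data.Fin using (Fin; toℕ; fromℕ<; inject₁) renaming (zero to fzero; suc to fsuc)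
open import Data.Fin.Permutation using (Permutation′; _⟨$⟩ʳ_)
open import Data.Product using (Σ; ∃; _×_; _,_)
open import Relation.Binary.PropositionalEquality using (_≡_)

sumFin : (m : ℕ) → (Fin m → ℕ) → ℕ
sumFin zero    f = 0
sumFin (suc m) f = f fzero + sumFin m (λ i → f (fsuc i))

-- A multiset of m elements of Z_m is given as a sequence a : Fin m → Fin m
-- (index i : Fin m stands for a_{i+1}; elements of Z_m are the residues 0..m-1).

ZeroSumPermutable : (m : ℕ) .{{_ : NonZero m}} → (Fin m → Fin m) → Set
ZeroSumPermutable m a =
  ∃ λ (σ : Permutation′ m) →
    sumFin m (λ i → suc (toℕ i) * toℕ (a (σ ⟨$⟩ʳ i))) % m ≡ 0

Odd : ℕ → Set
Odd x = x % 2 ≡ 1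

Even : ℕ → Set
Even x = x % 2 ≡ 0

AllSameOddResidue : (m k : ℕ) → (Fin m → Fin m) → Set
AllSameOddResidue m k a =
  ∃ λ r → Odd r × (∀ i → _%_ (toℕ (a i)) (2 ^ k) {{m^n≢0 2 k}} ≡ r)

-- (ii) M = {a, ..., a, a+b, a-b} (m-2 copies of a) as multisets, a even, gcd(b,m)=1.
-- Multiset equality: some permutation σ of indices puts the sequence in this form.
-- m is written as suc (suc m') so that the last two positions exist.
SpecialForm : (m' : ℕ) → (Fin (suc (suc m')) → Fin (suc (suc m'))) → Set
SpecialForm m' a =
  ∃ λ (x : ℕ) → ∃ λ (b : ℕ) → ∃ λ (σ : Permutation′ m) →
    Even x × gcd b m ≡ 1 ×
    (∀ (j : Fin m') → toℕ (a (σ ⟨$⟩ʳ inject₁ (inject₁ j))) ≡ x % m) ×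
    toℕ (a (σ ⟨$⟩ʳ inject₁ (Data.Fin.fromℕ m'))) ≡ (x + b) % m ×
    toℕ (a (σ ⟨$⟩ʳ Data.Fin.fromℕ (suc m'))) ≡ (x + (m ∸ (b % m))) % m
  where
  m = suc (suc m')
  open import Data.Nat using (_∸_)

module Submission where

-- Two numbers x, y at weights w, w′ may be exchanged, which changes the weighted sum by (w′ - w)(x - y).
-- Exchanging further disjoint pairs enlarges the set of residues reached, unless that set is already a union
-- of cosets of the subgroup generated by the new difference.
-- With 2P - 1 consecutive weights every residue mod P is reached by 2P - 1 numbers whose differences
-- generate Z_P: either many of them lie in one coset of a proper subgroup H, and one argues by induction
-- in H and in the quotient by H, or one value z is so frequent that all other values differ from z by units,
-- and exchanges of pairs suffice.
-- For m = 2P put numbers of different parity at the weights P and 2P; exchanging them changes the sum by P,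
-- so it remains to reach 0 mod P with the other numbers, whose weights mod P are 1, ..., P - 1 twice.
-- This can fail only if all but one of them agree mod P; those lists are treated by hand and lead to the exception.
-- When all numbers agree mod 2^j but not mod 2^(j+1), the same is done with m/2^(j+1) in place of P.

open import Defs
open import Data.Fin as Fin using (Fin; toℕ; inject₁; fromℕ)
open import Data.Fin.Permutation using (Permutation′; _⟨$⟩ʳ_; _∘ₚ_; cast-id)
import Data.Fin.Properties as Finₚ
open import Data.Integer as ℤ using (ℤ; +_; _+_; _*_; _-_; -_; 0ℤ; 1ℤ)
import Data.Integer.DivMod as ℤ
import Data.Integer.Divisibility.Signed as Signed
import Data.Integer.Properties as ℤₚ
open import Data.Integer.Tactic.RingSolver using (solve-∀)
open import Data.List using (List; []; _∷_; _++_; map; length; foldr; filter; upTo; take; drop; lookup; tabulate)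
open import Data.List.Membership.Propositional using (_∈_; find; lose)
open import Data.List.Membership.Propositional.Properties using (∈-upTo⁺; ∈-filter⁻; ∈-filter⁺; ∈-∃++; ∈-++⁺ˡ; ∈-++⁺ʳ; ∈-++⁻; ∈-tabulate⁺)
import Data.List.Properties as Listₚ
import Data.List.Relation.Binary.Permutation.Homogeneous as Homogeneous
open import Data.List.Relation.Binary.Permutation.Propositional using (_↭_; ↭-refl; ↭-sym; ↭-trans; prep; swap; ↭-reflexive; ↭⇒↭ₛ)
import Data.List.Relation.Binary.Permutation.Propositional.Properties as ↭ₚ
import Data.List.Relation.Binary.Permutation.Setoid.Properties as Setoidₚ
open import Data.List.Relation.Unary.All as All using (All; []; _∷_)
import Data.List.Relation.Unary.All.Properties as Allₚ
open import Data.List.Relation.Unary.Any as Any using (here; there)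
open import Data.Nat as ℕ using (ℕ; zero; suc; _≤_; _<_; z≤n; s≤s; NonZero; _^_; _%_)
import Data.Nat.DivMod as DivMod
open import Data.Nat.Divisibility using (_∣_; divides; ∣⇒≤; ∣-refl; ∣-trans; 0∣⇒≡0; _∣?_; 1∣_; m∣m*n; n∣m*n; *-monoʳ-∣)
open import Data.Nat.GCD using (gcd; gcd[m,n]∣m; gcd[m,n]∣n; module GCD; module Bézout)
open import Data.Nat.Induction using (<-rec)
import Data.Nat.Properties as ℕₚ
import Data.Nat.Tactic.RingSolver as ℕSolver
open import Data.Product using (∃; ∃₂; _×_; _,_; proj₁; proj₂; uncurry)
open import Data.Sum using (_⊎_; inj₁; inj₂)
open import Function using (_∘_)
open import Relation.Binary.PropositionalEquality
open import Relation.Nullary using (¬_; Dec; yes; no; contradiction; _⊎-dec_; _×-dec_; ¬?)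
open import Relation.Nullary.Decidable using (toWitnessFalse)
open import Relation.Unary using (Decidable)

-- The obstacle is composite P: a difference that is not a unit may add no residue, and the count
-- behind P - 1 pairs (one new residue per exchange) survives only if every stalled set is already
-- complete. This is arranged by order. Unit differences stand last in the list of exchanges, and
-- they are numerous enough to fill Z_g for every proper divisor g of P. The units come from a
-- dichotomy over factorisations he = P. If some class modulo h has 2e members that are not all
-- congruent modulo P, the largest such h is taken: 2e - 1 members settle the subgroup of order e,
-- and the spare one keeps the quotient list from becoming constant. If there is no such class,
-- large classes are constant modulo P, which forces a frequent value and also makes all other
-- values differ from it by units. Splitting never runs out of weights, because (2e - 1) + (2h - 1)
-- ≤ 2he - 1 for h, e ≥ 2. For mixed parity, the weights P and 2P are spent on the exchange, which
-- leaves 2P - 2, one fewer than the general result asks for. The special cases and the exception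
-- come from this deficit. When the numbers agree modulo 2, there are weights to spare.

-- Congruences, and assignments of numbers to weights.

module Assignments where

  infix 4 _≡_mod_
  infix 3 _because_

  -- The quotient is kept as data because later constructions read it off: as the target for the
  -- next factor of the modulus, or for its parity.
  record _≡_mod_ (a b : ℤ) (n : ℕ) : Set where
    constructor _because_
    field
      quot : ℤ
      eq   : a ≡ b + quot * + n

  opaque

    ≡⇒mod : ∀ {n a b} → a ≡ b → a ≡ b mod n
    ≡⇒mod {n} {a} refl = 0ℤ because lem a (+ n)
      where
      lem : ∀ a n → a ≡ a + 0ℤ * n
      lem = solve-∀

    mod-refl : ∀ {n a} → a ≡ a mod n
    mod-refl = ≡⇒mod refl

    mod-sym : ∀ {n a b} → a ≡ b mod n → b ≡ a mod n
    mod-sym {n} {a} {b} (k because e) = - k because trans (lem b k (+ n)) (cong (_+ - k * + n) (sym e))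
      where
      lem : ∀ b k n → b ≡ (b + k * n) + - k * n
      lem = solve-∀

    mod-trans : ∀ {n a b c} → a ≡ b mod n → b ≡ c mod n → a ≡ c mod n
    mod-trans {n} {a} {b} {c} (k because e) (l because f) =
      l + k because trans e (trans (cong (_+ k * + n) f) (lem c k l (+ n)))
      where
      lem : ∀ c k l n → (c + l * n) + k * n ≡ c + (l + k) * n
      lem = solve-∀

    mod-+ : ∀ {n a b c d} → a ≡ b mod n → c ≡ d mod n → a + c ≡ b + d mod n
    mod-+ {n} {a} {b} {c} {d} (k because e) (l because f) =
      k + l because trans (cong₂ _+_ e f) (lem b d k l (+ n))
      where
      lem : ∀ b d k l n → (b + k * n) + (d + l * n) ≡ (b + d) + (k + l) * n
      lem = solve-∀

    mod-* : ∀ {n a b c d} → a ≡ b mod n → c ≡ d mod n → a * c ≡ b * d mod n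
    mod-* {n} {a} {b} {c} {d} (k because e) (l because f) =
      k * d + b * l + k * l * + n because trans (cong₂ _*_ e f) (lem b d k l (+ n))
      where
      lem : ∀ b d k l n → (b + k * n) * (d + l * n) ≡ b * d + (k * d + b * l + k * l * n) * n
      lem = solve-∀

    mod-+ˡ : ∀ {n a b} c → a ≡ b mod n → c + a ≡ c + b mod n
    mod-+ˡ c p = mod-+ (mod-refl {a = c}) p

    mod-+ʳ : ∀ {n a b} c → a ≡ b mod n → a + c ≡ b + c mod n
    mod-+ʳ c p = mod-+ p (mod-refl {a = c})

    mod-*ˡ : ∀ {n a b} c → a ≡ b mod n → c * a ≡ c * b mod n
    mod-*ˡ c p = mod-* (mod-refl {a = c}) p

    mod-*ʳ : ∀ {n a b} c → a ≡ b mod n → a * c ≡ b * c mod n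
    mod-*ʳ c p = mod-* p (mod-refl {a = c})

    mod-neg : ∀ {n a b} → a ≡ b mod n → - a ≡ - b mod n
    mod-neg {n} {a} {b} (k because e) = - k because trans (cong -_ e) (lem b k (+ n))
      where
      lem : ∀ b k n → - (b + k * n) ≡ - b + - k * n
      lem = solve-∀

    mod-- : ∀ {n a b c d} → a ≡ b mod n → c ≡ d mod n → a - c ≡ b - d mod n
    mod-- p q = mod-+ p (mod-neg q)

    _≡?_mod_ : ∀ a b n → Dec (a ≡ b mod n)
    a ≡? b mod n with + n Signed.∣? (a - b)
    ... | yes (Signed.divides q e) = yes (q because trans (lem a b) (cong (λ z → b + z) e))
      where
      lem : ∀ a b → a ≡ b + (a - b)
      lem = solve-∀
    ... | no n∤ = no λ where
            (k because e) → n∤ (Signed.divides k (trans (cong (_- b) e) (lem b (k * + n))))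
      where
      lem : ∀ b c → b + c - b ≡ c
      lem = solve-∀

  private variable
    n h k : ℕ
    t u : ℤ
    ws vs xs ys : List ℤ

  sum : List ℤ → ℤ
  sum = foldr _+_ 0ℤ

  sum-++ : ∀ xs ys → sum (xs ++ ys) ≡ sum xs + sum ys
  sum-++ []       ys = sym (ℤₚ.+-identityˡ (sum ys))
  sum-++ (x ∷ xs) ys = trans (cong (_+_ x) (sum-++ xs ys)) (sym (ℤₚ.+-assoc x (sum xs) (sum ys)))

  sum-↭ : xs ↭ ys → sum xs ≡ sum ys
  sum-↭ _↭_.refl = refl
  sum-↭ (prep x p) = cong (_+_ x) (sum-↭ p)
  sum-↭ (swap {xs} {ys} x y p) = trans (cong (λ s → x + (y + s)) (sum-↭ p)) (lem x y (sum ys))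
    where
    lem : ∀ a b c → a + (b + c) ≡ b + (a + c)
    lem = solve-∀
  sum-↭ (_↭_.trans p q) = trans (sum-↭ p) (sum-↭ q)

  dot : List (ℤ × ℤ) → ℤ
  dot zs = sum (map (uncurry _*_) zs)

  -- The numbers xs can be assigned bijectively to the weights ws so that the weighted sum is t mod n;
  -- for n = 0 the congruence is an equality.
  record Reach (n : ℕ) (ws xs : List ℤ) (t : ℤ) : Set where
    constructor reach
    field
      zs    : List (ℤ × ℤ)
      ws↭   : map proj₁ zs ↭ ws
      xs↭   : map proj₂ zs ↭ xs
      value : dot zs ≡ t mod n

  reach-[] : Reach n [] [] 0ℤ
  reach-[] = reach [] ↭-refl ↭-refl mod-refl

  reach-++ : Reach n ws xs t → Reach n vs ys u → Reach n (ws ++ vs) (xs ++ ys) (t + u)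
  reach-++ (reach zs p q e) (reach zs′ p′ q′ e′) = reach (zs ++ zs′)
    (subst (_↭ _) (sym (Listₚ.map-++ proj₁ zs zs′)) (↭ₚ.++⁺ p p′))
    (subst (_↭ _) (sym (Listₚ.map-++ proj₂ zs zs′)) (↭ₚ.++⁺ q q′))
    (mod-trans (≡⇒mod (trans (cong sum (Listₚ.map-++ (uncurry _*_) zs zs′))
                             (sum-++ (map (uncurry _*_) zs) _)))
               (mod-+ e e′))

  reach-∷ : ∀ w x → Reach n ws xs t → Reach n (w ∷ ws) (x ∷ xs) (w * x + t)
  reach-∷ w x (reach zs p q e) = reach ((w , x) ∷ zs) (prep w p) (prep x q) (mod-+ˡ (w * x) e)

  reach-↭ : ws ↭ vs → xs ↭ ys → Reach n ws xs t → Reach n vs ys t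
  reach-↭ p q (reach zs p′ q′ e) = reach zs (↭-trans p′ p) (↭-trans q′ q) e

  reach-mod : t ≡ u mod n → Reach n ws xs t → Reach n ws xs u
  reach-mod t≡u (reach zs p q e) = reach zs p q (mod-trans e t≡u)

  mod-zero : ∀ {a b} → a ≡ b mod 0 → a ≡ b
  mod-zero {a} {b} (k because e) = trans e (lem b k)
    where
    lem : ∀ b k → b + k * 0ℤ ≡ b
    lem = solve-∀

  reach-reduce : Reach 0 ws xs t → Reach n ws xs t
  reach-reduce (reach zs p q e) = reach zs p q (≡⇒mod (mod-zero e))

  -- An assignment knows no modulus. Naming its integer value lets a list solved modulo a divisor be
  -- joined to one that corrects the remaining error modulo the full number.
  reach-exact : Reach n ws xs t → ∃ λ s → Reach 0 ws xs s × s ≡ t mod n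
  reach-exact (reach zs p q e) = dot zs , reach zs p q mod-refl , e

  reach-any : ∀ ws xs → length ws ≡ length xs → ∃ λ s → Reach 0 ws xs s
  reach-any []       []       _ = 0ℤ , reach-[]
  reach-any (w ∷ ws) (x ∷ xs) e = _ , reach-∷ w x (proj₂ (reach-any ws xs (cong ℕ.pred e)))

  reach-constant : ∀ {z} ws xs → length ws ≡ length xs → All (λ x → x ≡ z mod n) xs →
                   Reach n ws xs (z * sum ws)
  reach-constant {z = z} []       []       _ []       = reach-mod (≡⇒mod (sym (ℤₚ.*-zeroʳ z))) reach-[]
  reach-constant {z = z} (w ∷ ws) (x ∷ xs) e (p ∷ ps) =
    reach-mod (mod-trans (mod-+ʳ (z * sum ws) (mod-*ˡ w p)) (≡⇒mod (lem w z (sum ws))))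
              (reach-∷ w x (reach-constant ws xs (cong ℕ.pred e) ps))
    where
    lem : ∀ w z s → w * z + z * s ≡ z * (w + s)
    lem = solve-∀

  opaque

    mod-scale : ∀ {a b} → a ≡ b mod k → + h * a ≡ + h * b mod (h ℕ.* k)
    mod-scale {k} {h} {a} {b} (q because e) =
      q because trans (cong (+ h *_) e)
                  (trans (lem (+ h) b q (+ k)) (cong (λ z → + h * b + q * z) (sym (ℤₚ.pos-* h k))))
      where
      lem : ∀ h b q k → h * (b + q * k) ≡ h * b + q * (h * k)
      lem = solve-∀

  -- The constant part `r` contributes `r * sum ws` under every assignment, so only the quotients
  -- `ys` matter, and only modulo `k`.
  reach-scale : ∀ r → Reach k ws ys t → xs ≡ map (λ y → r + + h * y) ys →
                Reach (h ℕ.* k) ws xs (r * sum ws + + h * t)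
  reach-scale {k = k} {ws = ws} {t = t} {h = h} r (reach zs p q e) refl =
    reach (map scale zs)
          (subst (_↭ _) (Listₚ.map-∘ zs) p)
          (subst (_↭ _) (trans (sym (Listₚ.map-∘ zs)) (Listₚ.map-∘ zs)) (↭ₚ.map⁺ _ q))
          (mod-trans (≡⇒mod (trans (dot-scale zs) (cong (λ s → r * s + + h * dot zs) (sum-↭ p))))
                     (mod-+ˡ (r * sum ws) (mod-scale {h = h} e)))
    where
    scale : ℤ × ℤ → ℤ × ℤ
    scale (w , y) = w , r + + h * y
    dot-scale : ∀ zs → dot (map scale zs) ≡ r * sum (map proj₁ zs) + + h * dot zs
    dot-scale []             = lem r (+ h)
      where
      lem : ∀ r h → 0ℤ ≡ r * 0ℤ + h * 0ℤ
      lem = solve-∀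
    dot-scale ((w , y) ∷ zs) = trans (cong (_+_ (w * (r + + h * y))) (dot-scale zs)) (lem w y r (+ h) (sum (map proj₁ zs)) (dot zs))
      where
      lem : ∀ w y r h s d → w * (r + h * y) + (r * s + h * d) ≡ r * (w + s) + h * (w * y + d)
      lem = solve-∀

  -- This completes a run of weights by a weight that is merely congruent to the missing term.
  reach-reweigh : ∀ {w w′ ws} → w ≡ w′ mod n → Reach n (w ∷ ws) xs t → Reach n (w′ ∷ ws) xs t
  reach-reweigh {w = w} {w′} w≡w′ (reach zs p q e)
    with ((_ , x) ∷ zs′) , refl , zs↭ ← ↭ₚ.↭-map-inv proj₁ p =
    reach ((w′ , x) ∷ zs′) ↭-refl (↭-trans (↭ₚ.map⁺ proj₂ (↭-sym zs↭)) q)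
          (mod-trans (mod-+ʳ (dot zs′) (mod-* (mod-sym w≡w′) (mod-refl {a = x})))
                     (mod-trans (≡⇒mod (sum-↭ (↭ₚ.map⁺ (uncurry _*_) (↭-sym zs↭)))) e))

  run : ℤ → ℕ → List ℤ
  run a zero    = []
  run a (suc l) = a ∷ run (a + 1ℤ) l

  length-run : ∀ a l → length (run a l) ≡ l
  length-run a zero    = refl
  length-run a (suc l) = cong suc (length-run _ l)

  run-++ : ∀ a l m → run a (l ℕ.+ m) ≡ run a l ++ run (a + + l) m
  run-++ a zero    m = cong (λ b → run b m) (sym (ℤₚ.+-identityʳ a))
  run-++ a (suc l) m = cong (a ∷_) (trans (run-++ (a + 1ℤ) l m)
    (cong (λ b → run (a + 1ℤ) l ++ run b m) (ℤₚ.+-assoc a 1ℤ (+ l))))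

open Assignments

-- Subset sums modulo n.

module SubsetSums where

  private variable
    n h g : ℕ
    d : ℤ
    ds us : List ℤ

  opaque

    mod-%ℕ : ∀ a n .{{_ : NonZero n}} → a ≡ + (a ℤ.%ℕ n) mod n
    mod-%ℕ a n = (a ℤ./ℕ n) because ℤ.a≡a%ℕn+[a/ℕn]*n a n

    mod-∣ : ∀ {a b} → h ∣ n → a ≡ b mod n → a ≡ b mod h
    mod-∣ {h} {a = a} {b} (divides q refl) (k because e) =
      k * + q because trans e (trans (cong (λ z → b + k * z) (ℤₚ.pos-* q h)) (cong (_+_ b) (sym (ℤₚ.*-assoc k (+ q) (+ h)))))

    mod-cancel-- : ∀ {a b} → a - b ≡ 0ℤ mod n → a ≡ b mod n
    mod-cancel-- {a = a} {b} p = mod-trans (≡⇒mod (lem a b)) (mod-trans (mod-+ˡ b p) (≡⇒mod (ℤₚ.+-identityʳ b)))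
      where
      lem : ∀ a b → a ≡ b + (a - b)
      lem = solve-∀

  -- Subset sums as nested alternatives: a proof records which differences are used, and
  -- `reach-pairs` turns each choice into an order of the corresponding pair.
  Hit : ℕ → List ℤ → ℤ → Set
  Hit n []       T = T ≡ 0ℤ mod n
  Hit n (d ∷ ds) T = Hit n ds T ⊎ Hit n ds (T - d)

  hit? : ∀ n ds T → Dec (Hit n ds T)
  hit? n []       T = T ≡? 0ℤ mod n
  hit? n (d ∷ ds) T = hit? n ds T ⊎-dec hit? n ds (T - d)

  hit-mod : ∀ {T U} ds → T ≡ U mod n → Hit n ds T → Hit n ds U
  hit-mod []       e p        = mod-trans (mod-sym e) p
  hit-mod (d ∷ ds) e (inj₁ p) = inj₁ (hit-mod ds e p)
  hit-mod (d ∷ ds) e (inj₂ p) = inj₂ (hit-mod ds (mod-- e (mod-refl {a = d})) p)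

  hit-zero : ∀ n ds → Hit n ds 0ℤ
  hit-zero n []       = mod-refl
  hit-zero n (d ∷ ds) = inj₁ (hit-zero n ds)

  hit-++ : ∀ {T} vs → Hit n us T → Hit n (vs ++ us) T
  hit-++ []       p = p
  hit-++ (v ∷ vs) p = inj₁ (hit-++ vs p)

  hit-lift : ∀ n {T} ds → Hit h ds T → ∃ λ s → T ≡ s mod h × Hit n ds s
  hit-lift n []       p = 0ℤ , p , mod-refl
  hit-lift n (d ∷ ds) (inj₁ p) with s , e , q ← hit-lift n ds p = s , e , inj₁ q
  hit-lift n {T} (d ∷ ds) (inj₂ p) with s , e , q ← hit-lift n ds p =
    s + d , mod-trans (≡⇒mod (lem₁ T d)) (mod-+ʳ d e) , inj₂ (subst (Hit n ds) (lem₂ s d) q)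
    where
    lem₁ : ∀ t d → t ≡ t - d + d
    lem₁ = solve-∀
    lem₂ : ∀ t d → t ≡ t + d - d
    lem₂ = solve-∀

  Generates : ℕ → ℤ → ℕ → Set
  Generates n d g = ∃ λ j → j * d ≡ + g mod n

  -- A set of sums closed under adding `d` is a union of cosets of the subgroup generated by `d`,
  -- which contains `g`. As the set meets every class modulo `g`, it is everything.
  closed⇒hit : ∀ n .{{_ : NonZero n}} ds → Generates n d g → (∀ T → Hit g ds T) →
               (∀ T → Hit n ds (T - d) → Hit n ds T) → ∀ T → Hit n ds T
  closed⇒hit {d} {g} n ds (j , jd≡g) cover closed T
    with s , (q because e) , hit ← hit-lift n ds (cover T) =
    hit-mod ds (mod-sym T≡) (iterate m hit)
    where
    -- Closure only allows adding `d`, so the integer multiple `q * j` is replaced by its natural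
    -- remainder.
    m = (q * j) ℤ.%ℕ n
    lem₁ : ∀ s q j d → s + q * (j * d) ≡ s + q * j * d
    lem₁ = solve-∀
    T≡ : T ≡ s + + m * d mod n
    T≡ = mod-trans (≡⇒mod e) (mod-trans (mod-+ˡ s (mod-*ˡ q (mod-sym jd≡g)))
           (mod-trans (≡⇒mod (lem₁ s q j d)) (mod-+ˡ s (mod-* (mod-%ℕ (q * j) n) (mod-refl {a = d})))))
    lem₂ : ∀ s k d → s + k * d ≡ s + (1ℤ + k) * d - d
    lem₂ = solve-∀
    lem₃ : ∀ s d → s ≡ s + 0ℤ * d
    lem₃ = solve-∀
    iterate : ∀ k {s} → Hit n ds s → Hit n ds (s + + k * d)
    iterate zero    {s} p = subst (Hit n ds) (lem₃ s d) p
    iterate (suc k) {s} p = closed _ (subst (Hit n ds) (lem₂ s (+ k) d) (iterate k p))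

  module _ {A : Set} {P Q : A → Set} (P? : Decidable P) (Q? : Decidable Q) (P⊆Q : ∀ {x} → P x → Q x) where

    filter-length-≤ : ∀ xs → length (filter P? xs) ≤ length (filter Q? xs)
    filter-length-≤ []       = z≤n
    filter-length-≤ (x ∷ xs) with P? x | Q? x
    ... | yes p | yes q = s≤s (filter-length-≤ xs)
    ... | yes p | no ¬q = contradiction (P⊆Q p) ¬q
    ... | no ¬p | yes q = ℕₚ.m≤n⇒m≤1+n (filter-length-≤ xs)
    ... | no ¬p | no ¬q = filter-length-≤ xs

    filter-⊆-or-< : ∀ xs → (∀ {x} → x ∈ xs → Q x → P x) ⊎ length (filter P? xs) < length (filter Q? xs)
    filter-⊆-or-< []       = inj₁ λ ()
    filter-⊆-or-< (x ∷ xs) with P? x | Q? x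
    ... | yes p | no ¬q = contradiction (P⊆Q p) ¬q
    ... | no ¬p | yes q = inj₂ (s≤s (filter-length-≤ xs))
    ... | yes p | yes q with filter-⊆-or-< xs
    ...   | inj₁ f = inj₁ λ { (here refl) _ → p ; (there i) → f i }
    ...   | inj₂ l = inj₂ (s≤s l)
    filter-⊆-or-< (x ∷ xs) | no ¬p | no ¬q with filter-⊆-or-< xs
    ...   | inj₁ f = inj₁ λ { (here refl) q → contradiction q ¬q ; (there i) → f i }
    ...   | inj₂ l = inj₂ l

  -- Each toggle generates a subgroup modulo which the later ones already have all subset sums.
  data Spread (n : ℕ) : List ℤ → Set where
    []  : Spread n []
    add : ∀ g → Generates n d g → (∀ T → Hit g ds T) → Spread n ds → Spread n (d ∷ ds)

  count : ℕ → List ℤ → ℕ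
  count n ds = length (filter (λ i → hit? n ds (+ i)) (upTo n))

  -- A difference that yields no new residue leaves the sums closed under it, and then `closed⇒hit`
  -- gives everything. Otherwise the count rises by at least one, starting from the residue 0 of the
  -- empty list.
  spread-grows : ∀ n .{{_ : NonZero n}} → Spread n ds → (∀ T → Hit n ds T) ⊎ length ds < count n ds
  spread-grows (suc n) [] with 0ℤ ≡? 0ℤ mod (suc n)
  ... | yes _ = inj₂ (s≤s z≤n)
  ... | no ¬p = contradiction mod-refl ¬p
  spread-grows {ds = d ∷ ds} n (add g gen cover s) with spread-grows n s
  ... | inj₁ all = inj₁ λ T → inj₁ (all T)
  ... | inj₂ len<
    with filter-⊆-or-< (λ i → hit? n ds (+ i)) (λ i → hit? n (d ∷ ds) (+ i)) inj₁ (upTo n)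
  ... | inj₂ grows = inj₂ (ℕₚ.≤-<-trans len< grows)
  ... | inj₁ stuck = inj₁ λ T → inj₁ (closed⇒hit n ds gen cover closed T)
    where
    closed : ∀ T → Hit n ds (T - d) → Hit n ds T
    closed T p = hit-mod ds (mod-sym T≡) (stuck (∈-upTo⁺ (ℤ.n%ℕd<d T n)) (hit-mod (d ∷ ds) T≡ (inj₂ p)))
      where
      T≡ : T ≡ + (T ℤ.%ℕ n) mod n
      T≡ = mod-%ℕ T n

  spread-covers : ∀ n .{{_ : NonZero n}} → Spread n ds → n ≤ suc (length ds) → ∀ T → Hit n ds T
  spread-covers {ds} n s n≤ T with spread-grows n s
  ... | inj₁ all  = all T
  ... | inj₂ len<
    with All.all? (λ i → hit? n ds (+ i)) (upTo n)
  ... | yes all = hit-mod ds (mod-sym (mod-%ℕ T n)) (All.lookup all (∈-upTo⁺ (ℤ.n%ℕd<d T n)))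
  ... | no ¬all = contradiction
    (ℕₚ.<-≤-trans (ℕₚ.≤-<-trans (ℕₚ.≤-trans n≤ len<) (Listₚ.filter-notAll (λ i → hit? n ds (+ i)) (upTo n) (¬All⇒Any¬ (λ i → hit? n ds (+ i)) _ ¬all)))
      (ℕₚ.≤-reflexive (Listₚ.length-upTo n))) (ℕₚ.<-irrefl refl)
    where
    open import Data.List.Relation.Unary.All.Properties using (¬All⇒Any¬)

  bézout-ℕ : ∀ m n → ∃ λ g → g ∣ n × + m ≡ 0ℤ mod g × Generates n (+ m) g
  bézout-ℕ m n with Bézout.lemma m n
  ... | Bézout.result g gcd identity = g , GCD.gcd∣n gcd , m≡0 (GCD.gcd∣m gcd) , gen identity
    where
    m≡0 : g ∣ m → + m ≡ 0ℤ mod g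
    m≡0 (divides q refl) = + q because trans (ℤₚ.pos-* q g) (sym (ℤₚ.+-identityˡ _))
    gen : Bézout.Identity g m n → Generates n (+ m) g
    gen (Bézout.+- x y e) = + x , (+ y because
      trans (sym (ℤₚ.pos-* x m)) (trans (cong +_ (sym e)) (cong (_+_ (+ g)) (ℤₚ.pos-* y n))))
    gen (Bézout.-+ x y e) = - + x , (- + y because
      trans (lem (+ g) (+ x) (+ m)) (trans (cong (λ z → + g - z) eℤ) (lem′ (+ g) (+ y) (+ n))))
      where
      eℤ : + g + + x * + m ≡ + y * + n
      eℤ = trans (cong (_+_ (+ g)) (sym (ℤₚ.pos-* x m))) (trans (cong +_ e) (ℤₚ.pos-* y n))
      lem : ∀ g x m → - x * m ≡ g - (g + x * m)
      lem = solve-∀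
      lem′ : ∀ g y n → g - y * n ≡ g + - y * n
      lem′ = solve-∀

  bézout : ∀ d n → ∃ λ g → g ∣ n × d ≡ 0ℤ mod g × Generates n d g
  bézout d n with bézout-ℕ ℤ.∣ d ∣ n | ℤₚ.+∣i∣≡i⊎+∣i∣≡-i d
  ... | g , g∣n , d≡0 , gen | inj₁ e =
    g , g∣n , subst (_≡ 0ℤ mod g) e d≡0 , subst (λ c → Generates n c g) e gen
  ... | g , g∣n , d≡0 , gen | inj₂ e with j , jd≡g ← subst (λ c → Generates n c g) e gen =
    g , g∣n , mod-trans (≡⇒mod (sym (ℤₚ.neg-involutive d))) (mod-neg (subst (_≡ 0ℤ mod g) e d≡0)) ,
    - j , mod-trans (≡⇒mod (lem j d)) jd≡g
    where
    lem : ∀ j d → - j * d ≡ j * - d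
    lem = solve-∀

open SubsetSums

-- Residue classes in a list, and pairings of incongruent entries.

module ResidueClasses where

  private variable
    n h : ℕ
    z : ℤ
    xs ys : List ℤ

  module _ {A : Set} {Q : A → Set} (Q? : Decidable Q) where

    filter-split : ∀ xs → xs ↭ filter Q? xs ++ filter (¬? ∘ Q?) xs
    filter-split []       = ↭-refl
    filter-split (x ∷ xs) with Q? x
    ... | yes _ = prep x (filter-split xs)
    ... | no _  = ↭-trans (prep x (filter-split xs)) (↭-sym (↭ₚ.shift x (filter Q? xs) _))

    length-filter-split : ∀ xs → length xs ≡ length (filter Q? xs) ℕ.+ length (filter (¬? ∘ Q?) xs)
    length-filter-split xs = trans (↭ₚ.↭-length (filter-split xs)) (Listₚ.length-++ (filter Q? xs))

    choose : ∀ m xs → m ≤ length (filter Q? xs) →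
             ∃₂ λ ys zs → xs ↭ ys ++ zs × All Q ys × length ys ≡ m
    choose m xs m≤ = take m fs , drop m fs ++ filter (¬? ∘ Q?) xs ,
      ↭-trans (filter-split xs) (↭-reflexive
        (trans (cong (_++ _) (sym (Listₚ.take++drop≡id m fs))) (Listₚ.++-assoc (take m fs) (drop m fs) _))) ,
      Allₚ.take⁺ m (Allₚ.all-filter Q? xs) ,
      trans (Listₚ.length-take m fs) (ℕₚ.m≤n⇒m⊓n≡m m≤)
      where
      fs = filter Q? xs

  filter-∪-≤ : {A : Set} {P Q R : A → Set} (P? : Decidable P) (Q? : Decidable Q) (R? : Decidable R) →
               (∀ x → P x → Q x ⊎ R x) → ∀ xs →
               length (filter P? xs) ≤ length (filter Q? xs) ℕ.+ length (filter R? xs)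
  filter-∪-≤ P? Q? R? f []       = z≤n
  filter-∪-≤ P? Q? R? f (x ∷ xs) with P? x | Q? x | R? x | filter-∪-≤ P? Q? R? f xs
  ... | yes p | yes _ | yes _ | ih = s≤s (ℕₚ.≤-trans ih (ℕₚ.+-monoʳ-≤ _ (ℕₚ.n≤1+n _)))
  ... | yes p | yes _ | no _  | ih = s≤s ih
  ... | yes p | no _  | yes _ | ih = ℕₚ.≤-trans (s≤s ih) (ℕₚ.≤-reflexive (sym (ℕₚ.+-suc _ _)))
  ... | yes p | no ¬q | no ¬r | ih with f x p
  ...   | inj₁ q = contradiction q ¬q
  ...   | inj₂ r = contradiction r ¬r
  filter-∪-≤ P? Q? R? f (x ∷ xs) | no _  | yes _ | yes _ | ih =
    ℕₚ.m≤n⇒m≤1+n (ℕₚ.≤-trans ih (ℕₚ.+-monoʳ-≤ _ (ℕₚ.n≤1+n _)))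
  filter-∪-≤ P? Q? R? f (x ∷ xs) | no _  | yes _ | no _  | ih = ℕₚ.m≤n⇒m≤1+n ih
  filter-∪-≤ P? Q? R? f (x ∷ xs) | no _  | no _  | yes _ | ih = ℕₚ.≤-trans ih (ℕₚ.+-monoʳ-≤ _ (ℕₚ.n≤1+n _))
  filter-∪-≤ P? Q? R? f (x ∷ xs) | no _  | no _  | no _  | ih = ih

  ∈⇒↭ : ∀ {A : Set} {x : A} {xs} → x ∈ xs → ∃ λ ys → xs ↭ x ∷ ys
  ∈⇒↭ {x = x} i with ys , zs , refl ← ∈-∃++ i = ys ++ zs , ↭ₚ.shift x ys zs

  class : ℕ → ℤ → List ℤ → List ℤ
  class n x = filter (λ y → y ≡? x mod n)

  others : ℕ → ℤ → List ℤ → List ℤ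
  others n x = filter (λ y → ¬? (y ≡? x mod n))

  #class : ℕ → ℤ → List ℤ → ℕ
  #class n x xs = length (class n x xs)

  class-split : ∀ n x xs → xs ↭ class n x xs ++ others n x xs
  class-split n x = filter-split (λ y → y ≡? x mod n)

  length-class-split : ∀ n x xs → length xs ≡ #class n x xs ℕ.+ length (others n x xs)
  length-class-split n x = length-filter-split (λ y → y ≡? x mod n)

  all-class : ∀ n x xs → All (λ y → y ≡ x mod n) (class n x xs)
  all-class n x = Allₚ.all-filter (λ y → y ≡? x mod n)

  all-others : ∀ n x xs → All (λ y → ¬ y ≡ x mod n) (others n x xs)
  all-others n x = Allₚ.all-filter (λ y → ¬? (y ≡? x mod n))

  #class-↭ : ∀ n x → xs ↭ ys → #class n x xs ≡ #class n x ys
  #class-↭ n x p = ↭ₚ.↭-length (↭ₚ.filter-↭ (λ y → y ≡? x mod n) p)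

  #class-++ : ∀ n x xs ys → #class n x (xs ++ ys) ≡ #class n x xs ℕ.+ #class n x ys
  #class-++ n x xs ys = trans (cong length (Listₚ.filter-++ (λ y → y ≡? x mod n) xs ys))
                              (Listₚ.length-++ (class n x xs))

  #class-∷-≤ : ∀ n x y xs → #class n x xs ≤ #class n x (y ∷ xs)
  #class-∷-≤ n x y xs = ℕₚ.≤-trans (ℕₚ.m≤n+m _ _) (ℕₚ.≤-reflexive (sym (#class-++ n x (y ∷ []) xs)))

  #class-yes : ∀ n {x y} xs → y ≡ x mod n → #class n x (y ∷ xs) ≡ suc (#class n x xs)
  #class-yes n {x} {y} xs e = cong length (Listₚ.filter-accept (λ y → y ≡? x mod n) {xs = xs} e)

  #class-no : ∀ n {x y} xs → ¬ y ≡ x mod n → #class n x (y ∷ xs) ≡ #class n x xs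
  #class-no n {x} {y} xs e = cong length (Listₚ.filter-reject (λ y → y ≡? x mod n) {xs = xs} e)

  #class-all : ∀ n {x} xs → All (λ y → y ≡ x mod n) xs → #class n x xs ≡ length xs
  #class-all n {x} xs ps = cong length (Listₚ.filter-all (λ y → y ≡? x mod n) ps)

  #class-coarser : ∀ x xs → h ∣ n → #class n x xs ≤ #class h x xs
  #class-coarser {h} {n} x xs h∣n = filter-length-≤ (λ y → y ≡? x mod n) (λ y → y ≡? x mod h) (mod-∣ h∣n) xs

  most-frequent : ∀ n x xs → ∃ λ z → z ∈ x ∷ xs × ∀ {y} → y ∈ x ∷ xs → #class n y (x ∷ xs) ≤ #class n z (x ∷ xs)
  most-frequent n x xs = go (x ∷ xs) x xs
    where
    go : ∀ ws x xs → ∃ λ z → z ∈ x ∷ xs × ∀ {y} → y ∈ x ∷ xs → #class n y ws ≤ #class n z ws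
    go ws x []       = x , here refl , λ { (here refl) → ℕₚ.≤-refl }
    go ws x (y ∷ xs) with z , z∈ , max ← go ws y xs with ℕₚ.≤-total (#class n x ws) (#class n z ws)
    ... | inj₁ le = z , there z∈ , λ { (here refl) → le ; (there i) → max i }
    ... | inj₂ ge = x , here refl , λ { (here refl) → ℕₚ.≤-refl ; (there i) → ℕₚ.≤-trans (max i) ge }

  pigeonhole : ∀ k .{{_ : NonZero k}} c xs → (∀ {x} → x ∈ xs → #class k x xs ≤ c) → length xs ≤ k ℕ.* c
  pigeonhole k c xs ≤c = ℕₚ.≤-trans (ℕₚ.≤-reflexive (sym (cong length (Listₚ.filter-all (below? k)
    (All.universal (λ x → ℤ.n%ℕd<d x k) xs))))) (bound k)
    where
    below? : ∀ j x → Dec (x ℤ.%ℕ k < j)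
    below? j x = x ℤ.%ℕ k ℕ.<? j
    at? : ∀ j x → Dec (x ℤ.%ℕ k ≡ j)
    at? j x = x ℤ.%ℕ k ℕ.≟ j
    same : ∀ x y → x ℤ.%ℕ k ≡ y ℤ.%ℕ k → x ≡ y mod k
    same x y e = mod-trans (mod-%ℕ x k) (mod-trans (≡⇒mod (cong +_ e)) (mod-sym (mod-%ℕ y k)))
    split : ∀ j x → x ℤ.%ℕ k < suc j → x ℤ.%ℕ k ≡ j ⊎ x ℤ.%ℕ k < j
    split j x (s≤s ≤j) with x ℤ.%ℕ k ℕ.≟ j
    ... | yes e = inj₁ e
    ... | no ≢  = inj₂ (ℕₚ.≤∧≢⇒< ≤j ≢)
    at≤ : ∀ j → length (filter (at? j) xs) ≤ c
    at≤ j with Any.any? (at? j) xs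
    ... | no none = ℕₚ.≤-trans (ℕₚ.≤-reflexive (cong length (Listₚ.filter-none (at? j) (Allₚ.¬Any⇒All¬ xs none)))) z≤n
    ... | yes some with x , x∈ , refl ← find some =
      ℕₚ.≤-trans (filter-length-≤ (at? j) (λ y → y ≡? x mod k) (λ {y} e → same y x e) xs) (≤c x∈)
    bound : ∀ j → length (filter (below? j) xs) ≤ j ℕ.* c
    bound zero    = ℕₚ.≤-reflexive (cong length (Listₚ.filter-none (below? 0) (All.universal (λ _ ()) xs)))
    bound (suc j) = ℕₚ.≤-trans (filter-∪-≤ (below? (suc j)) (at? j) (below? j) (split j) xs) (ℕₚ.+-mono-≤ (at≤ j) (bound j))

  unpair : List (ℤ × ℤ) → List ℤ
  unpair []             = []
  unpair ((x , y) ∷ ps) = x ∷ y ∷ unpair ps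

  Distinct : ℕ → ℤ × ℤ → Set
  Distinct n (x , y) = ¬ x ≡ y mod n

  zip-pairs : ∀ xs ys → length xs ≡ length ys → All (λ x → x ≡ z mod n) xs → All (λ y → ¬ y ≡ z mod n) ys →
              ∃ λ ps → unpair ps ↭ xs ++ ys × All (Distinct n) ps × length ps ≡ length xs
  zip-pairs []       []       _ _ _ = [] , ↭-refl , [] , refl
  zip-pairs (x ∷ xs) (y ∷ ys) e (p ∷ ps) (q ∷ qs) with zs , zs↭ , dist , len ← zip-pairs xs ys (cong ℕ.pred e) ps qs =
    (x , y) ∷ zs ,
    prep x (↭-trans (prep y zs↭) (↭-sym (↭ₚ.shift y xs ys))) ,
    (λ x≡y → q (mod-trans (mod-sym x≡y) p)) ∷ dist , cong suc len

  -- A class that holds exactly half of the entries must be matched with all the others. If there is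
  -- none, any incongruent pair can be removed, since every class then stays within the smaller
  -- half.
  pairing : ∀ n k xs → length xs ≡ k ℕ.+ k → (∀ {x} → x ∈ xs → #class n x xs ≤ k) →
            ∃ λ ps → unpair ps ↭ xs × All (Distinct n) ps × length ps ≡ k
  pairing n zero    []       _ _ = [] , ↭-refl , [] , refl
  pairing n (suc k) (x ∷ xs) e ≤k with Any.any? (λ y → #class n y (x ∷ xs) ℕ.≟ suc k) (x ∷ xs)
  ... | yes half with z , z∈ , eq ← find half =
    let ps , ps↭ , dist , len = zip-pairs (class n z (x ∷ xs)) (others n z (x ∷ xs)) lengths
          (all-class n z (x ∷ xs)) (all-others n z (x ∷ xs))
    in ps , ↭-trans ps↭ (↭-sym (class-split n z (x ∷ xs))) , dist , trans len eq
    where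
    lengths : #class n z (x ∷ xs) ≡ length (others n z (x ∷ xs))
    lengths = ℕₚ.+-cancelˡ-≡ (suc k) _ _ (trans (cong (ℕ._+_ (suc k)) eq) (trans (sym e)
      (trans (length-class-split n z (x ∷ xs)) (cong (ℕ._+ length (others n z (x ∷ xs))) eq))))
  ... | no ¬half with Any.any? (λ y → ¬? (x ≡? y mod n)) xs
  ...   | no same = contradiction (≤k (here refl)) (ℕₚ.<⇒≱ (ℕₚ.<-≤-trans (ℕₚ.m<m+n (suc k) (s≤s z≤n))
            (ℕₚ.≤-reflexive (trans (sym e) (sym (#class-all n (x ∷ xs) (mod-refl ∷ All.map (λ {y} ¬¬p → equal y ¬¬p) (Allₚ.¬Any⇒All¬ xs same))))))))
    where
    equal : ∀ y → ¬ ¬ x ≡ y mod n → y ≡ x mod n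
    equal y ¬¬p with x ≡? y mod n
    ... | yes p = mod-sym p
    ... | no ¬p = contradiction ¬p ¬¬p
  ...   | yes diff with y , y∈ , x≢y ← find diff with zs , xs↭ ← ∈⇒↭ y∈ =
    let ps , ps↭ , dist , len = pairing n k zs len-zs ≤k′
    in (x , y) ∷ ps , prep x (↭-trans (prep y ps↭) (↭-sym xs↭)) , x≢y ∷ dist , cong suc len
    where
    len-zs : length zs ≡ k ℕ.+ k
    len-zs = ℕₚ.suc-injective (trans (sym (↭ₚ.↭-length xs↭)) (trans (ℕₚ.suc-injective e) (ℕₚ.+-suc k k)))
    ≤k′ : ∀ {z} → z ∈ zs → #class n z zs ≤ k
    ≤k′ {z} z∈ = ℕₚ.≤-trans
      (ℕₚ.≤-trans (#class-∷-≤ n z y zs) (ℕₚ.≤-trans (ℕₚ.≤-reflexive (sym (#class-↭ n z xs↭))) (#class-∷-≤ n z x xs)))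
      (ℕₚ.≤-pred (ℕₚ.≤∧≢⇒< (≤k z∈′) (λ eq → ¬half (lose z∈′ eq))))
      where
      z∈′ : z ∈ x ∷ xs
      z∈′ = there (↭ₚ.∈-resp-↭ (↭-sym xs↭) (there z∈))

open ResidueClasses

-- Exchanges at consecutive weights.

module Toggles where

  private variable
    n h g : ℕ
    d x y : ℤ
    us : List ℤ

  steps : List ℤ → List ℤ
  steps []       = []
  steps (a ∷ as) = a ∷ a + 1ℤ ∷ steps as

  difference : ℤ × ℤ → ℤ
  difference (x , y) = x - y

  -- Swapping x and y at the weights a, a + 1 changes the weighted sum by x - y.
  reach-pairs : ∀ n as ps → length as ≡ length ps →
                ∃ λ c → ∀ T → Hit n (map difference ps) T → Reach n (steps as) (unpair ps) (c + T)
  reach-pairs n []       []             _ =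
    0ℤ , λ T p → reach-mod (mod-sym (mod-trans (≡⇒mod (ℤₚ.+-identityˡ T)) p)) reach-[]
  reach-pairs n (a ∷ as) ((x , y) ∷ ps) e with c , r ← reach-pairs n as ps (cong ℕ.pred e) =
    a * x + (a + 1ℤ) * y + c , λ where
      T (inj₁ p) → reach-mod (≡⇒mod (lem₁ (a * x) ((a + 1ℤ) * y) c T)) (reach-∷ a x (reach-∷ (a + 1ℤ) y (r T p)))
      T (inj₂ p) → reach-↭ ↭-refl (swap y x ↭-refl) (reach-mod (≡⇒mod (lem₂ a x y c T))
                     (reach-∷ a y (reach-∷ (a + 1ℤ) x (r (T - (x - y)) p))))
    where
    lem₁ : ∀ u v c t → u + (v + (c + t)) ≡ u + v + c + t
    lem₁ = solve-∀
    lem₂ : ∀ a x y c t → a * y + ((a + 1ℤ) * x + (c + (t - (x - y)))) ≡ a * x + (a + 1ℤ) * y + c + t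
    lem₂ = solve-∀

  -- Coprimality to `n`, phrased by divisors because it is always established by refuting a common
  -- one.
  Unit : ℕ → ℤ → Set
  Unit n d = ∀ {h} → h ∣ n → 1 < h → ¬ d ≡ 0ℤ mod h

  unit-generates : ∀ n .{{_ : NonZero n}} → Unit n d → Generates n d 1
  unit-generates {d} n unit with bézout d n
  ... | zero , 0∣n , _ = contradiction (0∣⇒≡0 0∣n) (ℕ.≢-nonZero⁻¹ n)
  ... | suc zero , _ , _ , gen = gen
  ... | suc (suc g) , g∣n , d≡0 , _ = contradiction d≡0 (unit g∣n (s≤s (s≤s z≤n)))

  hit-one : ∀ ds T → Hit 1 ds T
  hit-one ds T = hit-mod ds (mod-sym (T because lem T)) (hit-zero 1 ds)
    where
    lem : ∀ T → T ≡ 0ℤ + T * 1ℤ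
    lem = solve-∀

  generates-∣ : h ∣ n → Generates n d g → Generates h d g
  generates-∣ h∣n (j , e) = j , mod-∣ h∣n e

  spread-units : ∀ n .{{_ : NonZero n}} → h ∣ n → All (Unit n) us → Spread h us
  spread-units n h∣n []       = []
  spread-units n h∣n (u ∷ us) =
    add 1 (generates-∣ h∣n (unit-generates n u)) (hit-one _) (spread-units n h∣n us)

  -- A nonzero difference generates the multiples of a proper divisor `g` of `n`. The units standing
  -- behind it number at least `g - 1` and fill Z_g on their own, which is what `Spread` asks for.
  toggles-cover : ∀ n .{{_ : NonZero n}} vs → All (λ v → ¬ v ≡ 0ℤ mod n) vs → All (Unit n) us →
                  (∀ {h} → h ∣ n → h < n → h ≤ suc (length us)) → n ≤ suc (length (vs ++ us)) →
                  ∀ T → Hit n (vs ++ us) T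
  toggles-cover {us} n vs vs≢0 units small = spread-covers n (spread vs vs≢0)
    where
    spread : ∀ vs → All (λ v → ¬ v ≡ 0ℤ mod n) vs → Spread n (vs ++ us)
    spread []       []           = spread-units n ∣-refl units
    spread (v ∷ vs) (v≢0 ∷ vs≢0) with g , g∣n , v≡0 , gen ← bézout v n =
      add g gen (λ T → hit-++ vs (spread-covers g (spread-units n g∣n units) (small g∣n g<n) T)) (spread vs vs≢0)
      where
      instance
        g≢0 : NonZero g
        g≢0 = ℕ.≢-nonZero λ { refl → ℕ.≢-nonZero⁻¹ n (0∣⇒≡0 g∣n) }
      g<n : g < n
      g<n = ℕₚ.≤∧≢⇒< (∣⇒≤ g∣n) λ { refl → v≢0 v≡0 }

  unpair-++ : ∀ ps qs → unpair (ps ++ qs) ≡ unpair ps ++ unpair qs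
  unpair-++ []             qs = refl
  unpair-++ ((x , y) ∷ ps) qs = cong (λ zs → x ∷ y ∷ zs) (unpair-++ ps qs)

  unpair-↭ : ∀ {ps qs} → ps ↭ qs → unpair ps ↭ unpair qs
  unpair-↭ _↭_.refl                     = ↭-refl
  unpair-↭ (prep (x , y) p)             = prep x (prep y (unpair-↭ p))
  unpair-↭ (swap {ps} {qs} (x , y) (z , w) p) = ↭-trans (↭ₚ.shifts (x ∷ y ∷ []) (z ∷ w ∷ []))
    (prep z (prep w (prep x (prep y (unpair-↭ p)))))
  unpair-↭ (_↭_.trans p q)              = ↭-trans (unpair-↭ p) (unpair-↭ q)

  ∈-unpair : ∀ {ps} → (x , y) ∈ ps → x ∈ unpair ps × y ∈ unpair ps
  ∈-unpair (here refl) = here refl , there (here refl)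
  ∈-unpair (there i) with x∈ , y∈ ← ∈-unpair i = there (there x∈) , there (there y∈)

  Involves : ℕ → ℤ → ℤ × ℤ → Set
  Involves n z (x , y) = x ≡ z mod n ⊎ y ≡ z mod n

  involves? : ∀ n z p → Dec (Involves n z p)
  involves? n z (x , y) = (x ≡? z mod n) ⊎-dec (y ≡? z mod n)

  -- The entries of a pair are incongruent, so a pair uses up at most one member of the class of
  -- `z`.
  #class-≤-involved : ∀ n z ps → All (Distinct n) ps →
                      #class n z (unpair ps) ≤ length (filter (involves? n z) ps)
  #class-≤-involved n z []             []           = z≤n
  #class-≤-involved n z ((x , y) ∷ ps) (x≢y ∷ dist) = by-cases (x ≡? z mod n) (y ≡? z mod n)
    where
    ih = #class-≤-involved n z ps dist
    accept : Involves n z (x , y) → suc (length (filter (involves? n z) ps)) ≡ length (filter (involves? n z) ((x , y) ∷ ps))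
    accept i = sym (cong length (Listₚ.filter-accept (involves? n z) {xs = ps} i))
    by-cases : Dec (x ≡ z mod n) → Dec (y ≡ z mod n) →
               #class n z (x ∷ y ∷ unpair ps) ≤ length (filter (involves? n z) ((x , y) ∷ ps))
    by-cases (yes p) (yes q) = contradiction (mod-trans p (mod-sym q)) x≢y
    by-cases (yes p) (no ¬q) = subst₂ _≤_ (sym (trans (#class-yes n (y ∷ unpair ps) p) (cong suc (#class-no n (unpair ps) ¬q))))
                                 (accept (inj₁ p)) (s≤s ih)
    by-cases (no ¬p) (yes q) = subst₂ _≤_ (sym (trans (#class-no n (y ∷ unpair ps) ¬p) (#class-yes n (unpair ps) q)))
                                 (accept (inj₂ q)) (s≤s ih)
    by-cases (no ¬p) (no ¬q) = subst₂ _≤_ (sym (trans (#class-no n (y ∷ unpair ps) ¬p) (#class-no n (unpair ps) ¬q)))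
                                 (cong length (sym (Listₚ.filter-reject (involves? n z) {xs = ps} λ { (inj₁ p) → ¬p p ; (inj₂ q) → ¬q q })))
                                 ih

  unit-neg : Unit n (- d) → Unit n d
  unit-neg u h∣n 1<h e = u h∣n 1<h (mod-neg e)

  unit-sub : Unit n (x - y) → Unit n (y - x)
  unit-sub {n} {x} {y} u = unit-neg (subst (Unit n) (lem x y) u)
    where
    lem : ∀ x y → x - y ≡ - (y - x)
    lem = solve-∀

  unit-mod : x ≡ y mod n → Unit n x → Unit n y
  unit-mod e u h∣n 1<h y≡0 = u h∣n 1<h (mod-trans (mod-∣ h∣n e) y≡0)

  -- Pairs that involve `z` have unit differences, and there are at least as many of them as copies
  -- of `z`. They are moved to the end of the list to serve as the units of `toggles-cover`.
  reach-toggles : ∀ k z xs as → length xs ≡ k ℕ.+ k → length as ≡ k →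
                  (∀ {x} → x ∈ xs → #class (suc k) x xs ≤ k) →
                  (∀ {x} → x ∈ xs → ¬ x ≡ z mod suc k → Unit (suc k) (x - z)) →
                  (∀ {h} → h ∣ suc k → h < suc k → h ≤ suc (#class (suc k) z xs)) →
                  ∀ T → Reach (suc k) (steps as) xs T
  reach-toggles k z xs as len-xs len-as ≤k units small T
    with ps , ps↭ , dist , len-ps ← pairing (suc k) k xs len-xs ≤k = result
    where
    P = suc k
    with-z    = filter (involves? P z) ps
    without-z = filter (¬? ∘ involves? P z) ps
    qs = without-z ++ with-z
    qs↭ : qs ↭ ps
    qs↭ = ↭-trans (↭ₚ.++-comm without-z with-z) (↭-sym (filter-split (involves? P z) ps))
    len-qs : length qs ≡ k
    len-qs = trans (↭ₚ.↭-length qs↭) len-ps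
    nonzero : ∀ {p} → Distinct P p → ¬ difference p ≡ 0ℤ mod P
    nonzero x≢y e = x≢y (mod-cancel-- e)
    unit : ∀ {p} → p ∈ with-z → Unit P (difference p)
    unit {x , y} p∈ with p∈ps , i ← ∈-filter⁻ (involves? P z) p∈
      with x≢y ← All.lookup dist p∈ps with x∈ , y∈ ← ∈-unpair p∈ps | i
    ... | inj₁ x≡z = unit-sub {x = y} (unit-mod (mod-- (mod-refl {a = y}) (mod-sym x≡z)) (units (↭ₚ.∈-resp-↭ ps↭ y∈) λ y≡z → x≢y (mod-trans x≡z (mod-sym y≡z))))
    ... | inj₂ y≡z = unit-mod (mod-- (mod-refl {a = x}) (mod-sym y≡z)) (units (↭ₚ.∈-resp-↭ ps↭ x∈) λ x≡z → x≢y (mod-trans x≡z (mod-sym y≡z)))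
    #z≤ : #class P z xs ≤ length (map difference with-z)
    #z≤ = subst₂ _≤_ (#class-↭ P z ps↭) (sym (Listₚ.length-map difference with-z)) (#class-≤-involved P z ps dist)
    len-toggles : length (map difference without-z ++ map difference with-z) ≡ k
    len-toggles = trans (cong length (sym (Listₚ.map-++ difference without-z with-z)))
                        (trans (Listₚ.length-map difference qs) len-qs)
    cover : ∀ T → Hit P (map difference qs) T
    cover T = subst (λ ds → Hit P ds T) (sym (Listₚ.map-++ difference without-z with-z))
      (toggles-cover P (map difference without-z)
        (Allₚ.map⁺ (All.map nonzero (Allₚ.filter⁺ _ dist)))
        (Allₚ.map⁺ (All.tabulate unit))
        (λ h∣n h<n → ℕₚ.≤-trans (small h∣n h<n) (s≤s #z≤))
        (ℕₚ.≤-reflexive (cong suc (sym len-toggles))) T)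
    lem : ∀ c t → c + (t - c) ≡ t
    lem = solve-∀
    result : Reach P (steps as) xs T
    result with c , r ← reach-pairs P as qs (trans len-as (sym len-qs)) =
      reach-↭ ↭-refl (↭-trans (unpair-↭ qs↭) ps↭) (reach-mod (≡⇒mod (lem c T)) (r (T - c) (cover (T - c))))

open Toggles

-- Lists whose differences generate Z_P, and splitting along a divisor.

module FullLists where

  private variable
    n h k P : ℕ

  filter-length-∈ : {A : Set} {P Q : A → Set} (P? : Decidable P) (Q? : Decidable Q) → ∀ xs →
                    (∀ {x} → x ∈ xs → P x → Q x) → length (filter P? xs) ≤ length (filter Q? xs)
  filter-length-∈ P? Q? []       f = z≤n
  filter-length-∈ P? Q? (x ∷ xs) f with P? x | Q? x | filter-length-∈ P? Q? xs (f ∘ there)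
  ... | yes p | yes q | ih = s≤s ih
  ... | yes p | no ¬q | ih = contradiction (f (here refl) p) ¬q
  ... | no ¬p | yes q | ih = ℕₚ.m≤n⇒m≤1+n ih
  ... | no ¬p | no ¬q | ih = ih

  -- Equivalently, the differences of the entries generate Z_P.
  Full : ℕ → List ℤ → Set
  Full P xs = ∀ {d} → d ∣ P → 1 < d → ¬ ∃ λ r → All (λ x → x ≡ r mod d) xs

  -- The threshold is `2k`, not `2k - 1`: a class of that size can give `odd k` members to the
  -- subgroup of order `k` and still keep one for the quotient.
  Sparse : ℕ → List ℤ → ℕ → Set
  Sparse P xs h = ∀ k {x y} → h ℕ.* k ≡ P → x ∈ xs → y ∈ xs → k ℕ.+ k ≤ #class h x xs → y ≡ x mod h → y ≡ x mod P

  record Crowded (P : ℕ) (xs : List ℤ) (h : ℕ) : Set where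
    field
      {e}   : ℕ
      {u v} : ℤ
      he≡P  : h ℕ.* e ≡ P
      u∈    : u ∈ xs
      v∈    : v ∈ xs
      big   : e ℕ.+ e ≤ #class h u xs
      v≡u   : v ≡ u mod h
      v≢u   : ¬ v ≡ u mod P

  sparse? : ∀ P xs h .{{_ : NonZero h}} → Sparse P xs h ⊎ Crowded P xs h
  sparse? P xs h with h ∣? P
  ... | no h∤P = inj₁ λ { k refl → contradiction (divides k (ℕₚ.*-comm h k)) h∤P }
  ... | yes (divides k P≡kh)
    with Any.any? (λ x → Any.any? (λ y → (k ℕ.+ k ℕ.≤? #class h x xs) ×-dec ((y ≡? x mod h) ×-dec ¬? (y ≡? x mod P))) xs) xs
  ... | yes some with x , x∈ , some′ ← find some with y , y∈ , big , y≡x , y≢x ← find some′ = inj₂ record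
    { he≡P = trans (ℕₚ.*-comm h k) (sym P≡kh) ; u∈ = x∈ ; v∈ = y∈ ; big = big ; v≡u = y≡x ; v≢u = y≢x }
  ... | no none = inj₁ sparse
    where
    sparse : Sparse P xs h
    sparse k′ {x} {y} hk′≡P x∈ y∈ big y≡x with y ≡? x mod P
    ... | yes e = e
    ... | no ¬e = contradiction (lose x∈ (lose y∈ (subst (λ k → k ℕ.+ k ≤ #class h x xs) k′≡k big , y≡x , ¬e))) none
      where
      k′≡k : k′ ≡ k
      k′≡k = ℕₚ.*-cancelˡ-≡ k′ k h (trans hk′≡P (trans P≡kh (ℕₚ.*-comm k h)))

  unscale : ∀ h r xs → All (λ x → x ≡ r mod h) xs → ∃ λ ys → xs ≡ map (λ y → r + + h * y) ys
  unscale h r []       []                   = [] , refl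
  unscale h r (x ∷ xs) ((q because e) ∷ ps) with ys , refl ← unscale h r xs ps =
    q ∷ ys , cong (_∷ _) (trans e (cong (_+_ r) (ℤₚ.*-comm q (+ h))))

  -- This is `2k - 1` for `k ≥ 1`.
  odd : ℕ → ℕ
  odd k = k ℕ.+ ℕ.pred k

  -- Only `odd P` weights have to be consecutive. The surplus `os` is arbitrary, so the property
  -- applies to whatever remains after a class and its weights are set aside.
  Universal : ℕ → Set
  Universal P = ∀ a os xs → length xs ≡ odd P ℕ.+ length os → Full P xs → ∀ T → Reach P (run a (odd P) ++ os) xs T

  1≤⇒nonZero : 1 ≤ n → NonZero n
  1≤⇒nonZero (s≤s _) = _

  -- The crowded class mod h reaches a whole coset of the multiples of h; the other numbers reach all classes mod h.
  crowded-reach : ∀ a b os xs → 2 ≤ h → length xs ≡ odd k ℕ.+ (odd h ℕ.+ length os) →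
                  Universal h → Universal k → Full P xs →
                  (∀ h′ → h < h′ → Sparse P xs h′) → ∀ {x y} →
                  h ℕ.* k ≡ P → 2 ≤ k → x ∈ xs → y ∈ xs → k ℕ.+ k ≤ #class h x xs → y ≡ x mod h → ¬ y ≡ x mod P →
                  ∀ T → Reach P (run a (odd k) ++ (run b (odd h) ++ os)) xs T
  crowded-reach {h} {k@(suc (suc k′))} a b os xs 2≤h len univ-h univ-k full sparse {x} {y} refl (s≤s (s≤s z≤n)) x∈ y∈ big y≡x y≢x T
    with xs₁ , xs↭₁ ← ∈⇒↭ x∈
    with ↭ₚ.∈-resp-↭ xs↭₁ y∈
  ... | here refl = contradiction mod-refl y≢x
  ... | there y∈₁ with xs₂ , xs↭₂ ← ∈⇒↭ y∈₁
    with choose (λ w → w ≡? x mod h) (suc (k′ ℕ.+ suc k′)) xs₂ enough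
    where
    enough : suc (k′ ℕ.+ suc k′) ≤ #class h x xs₂
    enough = ℕₚ.≤-trans (ℕₚ.≤-reflexive (sym (ℕₚ.+-suc k′ (suc k′)))) (ℕₚ.≤-pred (ℕₚ.≤-pred (ℕₚ.≤-trans big (ℕₚ.≤-reflexive
      (trans (#class-↭ h x (↭-trans xs↭₁ (prep x xs↭₂))) (trans (#class-yes h (y ∷ xs₂) mod-refl) (cong suc (#class-yes h xs₂ y≡x))))))))
  ... | c ∷ ys , zs , xs₂↭ , c≡x ∷ ys≡x , len-ys = result
    where
    bs = x ∷ y ∷ ys
    -- `c` is the spare member of the class: through it, a residue common to `rest` modulo a divisor
    -- of `h` would be common to `bs` as well.
    rest = c ∷ zs
    xs↭ : xs ↭ bs ++ rest
    xs↭ = ↭-trans xs↭₁ (prep x (↭-trans xs↭₂ (prep y (↭-trans xs₂↭ (↭-sym (↭ₚ.shift c ys zs))))))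
    bs≡x : All (λ w → w ≡ x mod h) bs
    bs≡x = mod-refl ∷ y≡x ∷ ys≡x
    len-bs : length bs ≡ odd k
    len-bs = cong (suc ∘ suc) (ℕₚ.suc-injective len-ys)
    len-rest : length rest ≡ odd h ℕ.+ length os
    len-rest = ℕₚ.+-cancelˡ-≡ (odd k) _ _ (trans (cong (ℕ._+ length rest) (sym len-bs))
      (trans (sym (Listₚ.length-++ bs)) (trans (sym (↭ₚ.↭-length xs↭)) len)))
    full-rest : Full h rest
    full-rest {d} d∣h 1<d (r , c≡r ∷ zs≡r) = full (∣-trans d∣h (m∣m*n k)) 1<d
      (r , ↭ₚ.All-resp-↭ (↭-sym xs↭) (Allₚ.++⁺ (All.map (λ w≡x → mod-trans (mod-trans (mod-∣ d∣h w≡x) (mod-sym (mod-∣ d∣h c≡x))) c≡r) bs≡x) (c≡r ∷ zs≡r)))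
    -- If the quotients agreed modulo `d`, the members of `bs` would agree modulo `h * d > h`, where
    -- sparsity is known. Its threshold is met because `2e ≤ d * e = k`.
    full-bs : ∀ {us} → bs ≡ map (λ u → x + + h * u) us → Full k us
    full-bs {us} bs≡ {d} (divides e k≡ed) 1<d (r , us≡r) = y≢x (sparse (h ℕ.* d) h<hd e hde≡hk x∈ y∈ many y≡x′)
      where
      1≤h : 1 ≤ h
      1≤h = ℕₚ.<⇒≤ 2≤h
      h<hd : h < h ℕ.* d
      h<hd = ℕₚ.m<m*n h d {{1≤⇒nonZero 1≤h}} 1<d
      hde≡hk : h ℕ.* d ℕ.* e ≡ h ℕ.* k
      hde≡hk = trans (ℕₚ.*-assoc h d e) (cong (h ℕ.*_) (trans (ℕₚ.*-comm d e) (sym k≡ed)))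
      bs≡r : All (λ w → w ≡ x + + h * r mod (h ℕ.* d)) bs
      bs≡r = subst (All _) (sym bs≡) (Allₚ.map⁺ (All.map (λ {u} u≡r → mod-+ˡ x (mod-scale {h = h} u≡r)) us≡r))
      y≡x′ : y ≡ x mod (h ℕ.* d)
      y≡x′ = mod-trans (All.lookup bs≡r (there (here refl))) (mod-sym (All.lookup bs≡r (here refl)))
      many : e ℕ.+ e ≤ #class (h ℕ.* d) x xs
      many = begin
        e ℕ.+ e                              ≡⟨ cong (e ℕ.+_) (ℕₚ.+-identityʳ e) ⟨
        2 ℕ.* e                              ≤⟨ ℕₚ.*-monoˡ-≤ e 1<d ⟩
        d ℕ.* e                              ≡⟨ ℕₚ.*-comm d e ⟩
        e ℕ.* d                              ≡⟨ k≡ed ⟨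
        k                                    ≤⟨ ℕₚ.m≤m+n k (suc k′) ⟩
        odd k                                ≡⟨ len-bs ⟨
        length bs                            ≡⟨ #class-all (h ℕ.* d) bs (All.map (λ e → mod-trans e (mod-sym (All.lookup bs≡r (here refl)))) bs≡r) ⟨
        #class (h ℕ.* d) x bs                ≤⟨ ℕₚ.m≤m+n _ _ ⟩
        #class (h ℕ.* d) x bs ℕ.+ #class (h ℕ.* d) x rest ≡⟨ #class-++ (h ℕ.* d) x bs rest ⟨
        #class (h ℕ.* d) x (bs ++ rest)      ≡⟨ #class-↭ (h ℕ.* d) x xs↭ ⟨
        #class (h ℕ.* d) x xs                ∎
        where open ℕₚ.≤-Reasoning
    result : Reach (h ℕ.* k) (run a (odd k) ++ (run b (odd h) ++ os)) xs T
    result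
      with us , bs≡ ← unscale h x bs bs≡x
      with s , reach-rest , s≡ ← reach-exact (univ-h b os rest len-rest full-rest (T - x * sum (run a (odd k))))
      -- `rest` makes the value correct modulo `h`. The remaining error is `q * h`, and `q` becomes
      -- the target for the quotients of `bs`.
      with q because e ← mod-sym s≡ =
      reach-↭ ↭-refl (↭-sym xs↭) (reach-mod (≡⇒mod (trans (lem₁ (x * sum (run a (odd k))) (+ h) q s)
          (trans (cong (λ t → x * sum (run a (odd k)) + t) (sym e)) (lem₂ (x * sum (run a (odd k))) T))))
        (reach-++ (reach-scale {h = h} x (reach-↭ (↭ₚ.++-identityʳ (run a (odd k))) ↭-refl
                     (univ-k a [] us (trans len-us (sym (ℕₚ.+-identityʳ (odd k)))) (full-bs bs≡) q)) bs≡)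
                  (reach-reduce reach-rest)))
      where
      len-us : length us ≡ odd k
      len-us = trans (sym (Listₚ.length-map _ us)) (trans (cong length (sym bs≡)) len-bs)
      lem₁ : ∀ c h q s → c + h * q + s ≡ c + (s + q * h)
      lem₁ = solve-∀
      lem₂ : ∀ c t → c + (t - c) ≡ t
      lem₂ = solve-∀

open FullLists

-- Frequent values and unit differences.

module Multiplicities where

  private variable
    h P : ℕ
    x z : ℤ
    xs : List ℤ

  -- If all classes modulo `h` had at most `2e - 1` members, the list would have at most
  -- `h (2e - 1) = 2P - h` entries. A class with `2e` members is constant modulo `P` by sparsity,
  -- and `z` is at least as frequent.
  large-class : ∀ xs → Sparse P xs h → (∀ {y} → y ∈ xs → #class P y xs ≤ #class P z xs) →
                P ℕ.+ P < length xs ℕ.+ h → 2 ≤ h → ∀ {e} → h ℕ.* e ≡ P → e ℕ.+ e ≤ #class P z xs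
  large-class xs sparse max many 2≤h {zero} he≡P = z≤n
  large-class {P} {h} {z} xs sparse max many 2≤h {e@(suc e′)} he≡P
    with Any.any? (λ y → e ℕ.+ e ℕ.≤? #class h y xs) xs
  ... | yes some with y , y∈ , big ← find some = ℕₚ.≤-trans big (ℕₚ.≤-trans
    (filter-length-∈ (λ w → w ≡? y mod h) (λ w → w ≡? y mod P) xs (λ w∈ → sparse e he≡P y∈ w∈ big)) (max y∈))
  ... | no none = contradiction many (ℕₚ.≤⇒≯ (begin
    length xs ℕ.+ h               ≤⟨ ℕₚ.+-monoˡ-≤ h (pigeonhole h {{1≤⇒nonZero (ℕₚ.<⇒≤ 2≤h)}} (e′ ℕ.+ e) xs few) ⟩
    h ℕ.* (e′ ℕ.+ e) ℕ.+ h        ≡⟨ lem h e′ ⟩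
    h ℕ.* e ℕ.+ h ℕ.* e           ≡⟨ cong₂ ℕ._+_ he≡P he≡P ⟩
    P ℕ.+ P                       ∎))
    where
    open ℕₚ.≤-Reasoning
    few : ∀ {y} → y ∈ xs → #class h y xs ≤ e′ ℕ.+ e
    few y∈ = ℕₚ.<⇒≤pred (ℕₚ.≰⇒> λ big → none (lose y∈ big))
    lem : ∀ h e → h ℕ.* (e ℕ.+ suc e) ℕ.+ h ≡ h ℕ.* suc e ℕ.+ h ℕ.* suc e
    lem = ℕSolver.solve-∀

  -- If `x` agreed with `z` modulo some `d > 1`, the class of `z` modulo `d` would contain every
  -- copy of `z` and also `x`, enough for sparsity to make `x` congruent to `z` modulo `P`. Counting
  -- `x` is what gains the `suc` in the bound.
  outlier-unit : ∀ xs → (∀ h → 2 ≤ h → Sparse P xs h) → z ∈ xs →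
                 (∀ {h e} → h ℕ.* e ≡ P → 2 ≤ h → e ℕ.+ e ≤ suc (#class P z xs)) →
                 ∀ {x} → x ∈ xs → ¬ x ≡ z mod P → Unit P (x - z)
  outlier-unit {P} {z} xs sparse z∈ large {x} x∈ x≢z {d} d∣P@(divides e P≡ed) 1<d x-z≡0 =
    x≢z (sparse d 1<d e de≡P z∈ x∈ (ℕₚ.≤-trans (large de≡P 1<d) (more (∈⇒↭ x∈))) x≡z)
    where
    x≡z : x ≡ z mod d
    x≡z = mod-cancel-- x-z≡0
    de≡P : d ℕ.* e ≡ P
    de≡P = trans (ℕₚ.*-comm d e) (sym P≡ed)
    more : (∃ λ ys → xs ↭ x ∷ ys) → suc (#class P z xs) ≤ #class d z xs
    more (ys , xs↭) = begin
      suc (#class P z xs)        ≡⟨ cong suc (trans (#class-↭ P z xs↭) (#class-no P ys x≢z)) ⟩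
      suc (#class P z ys)        ≤⟨ s≤s (#class-coarser z ys d∣P) ⟩
      suc (#class d z ys)        ≡⟨ trans (#class-↭ d z xs↭) (#class-yes d ys x≡z) ⟨
      #class d z xs              ∎
      where open ℕₚ.≤-Reasoning

  place : ∀ {w} ws zs → length ws ≡ length zs → All (λ y → y ≡ z mod P) zs →
          Reach P (w ∷ ws) (x ∷ zs) (w * (x - z) + z * sum (w ∷ ws))
  place {z = z} {x = x} {w = w} ws zs len zs≡z =
    reach-mod (≡⇒mod (lem w x z (sum ws))) (reach-∷ w x (reach-constant ws zs len zs≡z))
    where
    lem : ∀ w x z s → w * x + z * s ≡ w * (x - z) + z * (w + s)
    lem = solve-∀

  run-pick : ∀ a l i → i < l → ∃ λ ws → run a l ↭ a + + i ∷ ws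
  run-pick a (suc l) zero    _       = run (a + 1ℤ) l , ↭-reflexive (cong (_∷ run (a + 1ℤ) l) (sym (ℤₚ.+-identityʳ a)))
  run-pick a (suc l) (suc i) (s≤s i<l) with ws , p ← run-pick (a + 1ℤ) l i i<l =
    a ∷ ws , ↭-trans (prep a p) (↭-trans (swap a _ ↭-refl) (↭-reflexive (cong (_∷ a ∷ ws) (ℤₚ.+-assoc a 1ℤ (+ i)))))

  -- Apart from a constant the sum is `w * (x - z)`, where `w` is the weight of `x`. For a unit
  -- difference it takes every value as `w` runs through `P` consecutive weights.
  mover : ∀ P .{{_ : NonZero P}} a x zs → suc (length zs) ≡ P → All (λ y → y ≡ z mod P) zs → Unit P (x - z) →
          ∀ T → Reach P (run a P) (x ∷ zs) T
  mover {z = z} P a x zs len zs≡z unit T with j , jd≡1 ← unit-generates P unit = result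
    where
    d = x - z
    c = z * sum (run a P)
    i = (j * (T - c) - a) ℤ.%ℕ P
    weight≡ : (a + + i) * d + c ≡ T mod P
    weight≡ = mod-trans (mod-+ʳ c (mod-* (mod-+ˡ a (mod-sym (mod-%ℕ (j * (T - c) - a) P))) (mod-refl {a = d})))
      (mod-trans (≡⇒mod (lem₁ a j T c d)) (mod-trans (mod-+ʳ c (mod-* jd≡1 (mod-refl {a = T - c}))) (≡⇒mod (lem₂ T c))))
      where
      lem₁ : ∀ a j t c d → (a + (j * (t - c) - a)) * d + c ≡ j * d * (t - c) + c
      lem₁ = solve-∀
      lem₂ : ∀ t c → 1ℤ * (t - c) + c ≡ t
      lem₂ = solve-∀
    result : Reach P (run a P) (x ∷ zs) T
    result with ws , p ← run-pick a P i (ℤ.n%ℕd<d (j * (T - c) - a) P) =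
      reach-↭ (↭-sym p) ↭-refl (reach-mod (mod-trans (≡⇒mod (cong (λ s → (a + + i) * d + z * s) (sym (sum-↭ p)))) weight≡)
        (place ws zs len-ws zs≡z))
      where
      len-ws : length ws ≡ length zs
      len-ws = ℕₚ.suc-injective (trans (sym (↭ₚ.↭-length p)) (trans (length-run a P) (sym len)))

  run-steps : ∀ a k → ∃ λ as → length as ≡ k × run a (k ℕ.+ k) ≡ steps as
  run-steps a zero    = [] , refl , refl
  run-steps a (suc k) with as , len , eq ← run-steps (a + 1ℤ + 1ℤ) k =
    a ∷ as , cong suc len , trans (cong (run a) (cong suc (ℕₚ.+-suc k k))) (cong (λ ws → a ∷ a + 1ℤ ∷ ws) eq)

  -- The search descends from `P`, so the first crowded divisor it meets is the largest, and
  -- sparsity is known above it, as `crowded-reach` requires.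
  all-sparse-or-reach : ∀ P ws xs T → 1 ≤ P →
    (∀ h → 2 ≤ h → h < P → (∀ h′ → h < h′ → Sparse P xs h′) → Crowded P xs h → Reach P ws xs T) →
    (∀ h → 2 ≤ h → Sparse P xs h) ⊎ Reach P ws xs T
  all-sparse-or-reach P ws xs T 1≤P crowded = search P beyond
    where
    beyond : ∀ h → P ≤ h → Sparse P xs h
    beyond h P≤h zero    he≡P = contradiction (trans (sym (ℕₚ.*-zeroʳ h)) he≡P) (ℕₚ.<⇒≢ 1≤P)
    beyond h P≤h (suc e) refl _ _ _ y≡x =
      mod-∣ (divides 1 (trans (ℕₚ.≤-antisym (ℕₚ.m≤m*n h (suc e)) P≤h) (sym (ℕₚ.*-identityˡ _)))) y≡x
    search : ∀ n → (∀ h → n ≤ h → Sparse P xs h) → (∀ h → 2 ≤ h → Sparse P xs h) ⊎ Reach P ws xs T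
    search zero    above = inj₁ λ h 2≤h → above h z≤n
    search (suc n) above with 2 ℕ.≤? n
    ... | no 2≰n = inj₁ λ h 2≤h → above h (ℕₚ.≤-trans (ℕₚ.≰⇒> 2≰n) 2≤h)
    ... | yes 2≤n with sparse? P xs n {{1≤⇒nonZero (ℕₚ.<⇒≤ 2≤n)}}
    ...   | inj₁ sparse = search n λ h n≤h → extend h (ℕₚ.m≤n⇒m<n∨m≡n n≤h)
      where
      extend : ∀ h → n < h ⊎ n ≡ h → Sparse P xs h
      extend h (inj₁ n<h)  = above h n<h
      extend h (inj₂ refl) = sparse
    ...   | inj₂ c with n ℕ.<? P
    ...     | yes n<P = inj₂ (crowded n 2≤n n<P above c)
    ...     | no n≮P  = contradiction (beyond n (ℕₚ.≮⇒≥ n≮P) e he≡P u∈ v∈ big v≡u) v≢u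
      where
      open Crowded c

open Multiplicities

-- Reaching every value with 2P - 1 consecutive weights

most-frequent′ : ∀ n xs → 1 ≤ length xs → ∃ λ z → z ∈ xs × ∀ {y} → y ∈ xs → #class n y xs ≤ #class n z xs
most-frequent′ n (x ∷ xs) _ = most-frequent n x xs

factor-≥2 : ∀ {P h e} → h ℕ.* e ≡ P → h < P → 2 ≤ e
factor-≥2 {h = h} {zero}        refl h<P = contradiction h<P (ℕₚ.≤⇒≯ (ℕₚ.≤-trans (ℕₚ.≤-reflexive (ℕₚ.*-zeroʳ h)) z≤n))
factor-≥2 {h = h} {suc zero}    refl h<P = contradiction h<P (ℕₚ.≤⇒≯ (ℕₚ.≤-reflexive (ℕₚ.*-identityʳ h)))
factor-≥2 {e = suc (suc e)} refl h<P = s≤s (s≤s z≤n)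

-- The surplus is `2 (h - 1) (e - 1) - 1`, which is positive for `h` and `e` at least 2.
odd-+-odd : ∀ {h e} → 2 ≤ h → 2 ≤ e → ∃ λ r → odd (h ℕ.* e) ≡ odd e ℕ.+ (odd h ℕ.+ r)
odd-+-odd {suc (suc h)} {suc (suc e)} (s≤s (s≤s z≤n)) (s≤s (s≤s z≤n)) =
  1 ℕ.+ (h ℕ.+ h) ℕ.+ (e ℕ.+ e) ℕ.+ (h ℕ.* e ℕ.+ h ℕ.* e) , lem h e
  where
  lem : ∀ h e → (2 ℕ.+ h) ℕ.* (2 ℕ.+ e) ℕ.+ (1 ℕ.+ e ℕ.+ (1 ℕ.+ h) ℕ.* (2 ℕ.+ e)) ≡
        (2 ℕ.+ e) ℕ.+ (1 ℕ.+ e) ℕ.+ ((2 ℕ.+ h) ℕ.+ (1 ℕ.+ h) ℕ.+ (1 ℕ.+ (h ℕ.+ h) ℕ.+ (e ℕ.+ e) ℕ.+ (h ℕ.* e ℕ.+ h ℕ.* e)))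
  lem = ℕSolver.solve-∀

outlier : ∀ {P xs} → 1 < P → Full P xs → ∀ z → ∃ λ x → x ∈ xs × ¬ x ≡ z mod P
outlier {P} {xs} 1<P full z with All.all? (λ x → x ≡? z mod P) xs
... | yes all = contradiction (z , all) (full ∣-refl 1<P)
... | no ¬all = find (Allₚ.¬All⇒Any¬ (λ x → x ≡? z mod P) xs ¬all)

reach-one : ∀ ws xs → length ws ≡ length xs → ∀ T → Reach 1 ws xs T
reach-one ws xs len T with s , r ← reach-any ws xs len = reach-mod (s - T because lem s T) (reach-reduce r)
  where
  lem : ∀ s t → s ≡ t + (s - t) * 1ℤ
  lem = solve-∀

universal-step : ∀ k → (∀ {h} → h < suc (suc k) → 1 ≤ h → Universal h) → Universal (suc (suc k))
universal-step k′ ih a os xs len full T = result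
  where
  k = suc k′
  P = suc k
  ws = run a (odd P) ++ os
  len-ws : length ws ≡ odd P ℕ.+ length os
  len-ws = trans (Listₚ.length-++ (run a (odd P))) (cong (ℕ._+ length os) (length-run a (odd P)))
  crowded : ∀ h → 2 ≤ h → h < P → (∀ h′ → h < h′ → Sparse P xs h′) → Crowded P xs h → Reach P ws xs T
  crowded h 2≤h h<P sparse c = by-splitting (odd-+-odd 2≤h 2≤e)
    where
    open Crowded c
    2≤e : 2 ≤ e
    2≤e = factor-≥2 he≡P h<P
    e<P : e < P
    e<P = subst (e <_) (trans (ℕₚ.*-comm e h) he≡P) (ℕₚ.m<m*n e h {{1≤⇒nonZero (ℕₚ.<⇒≤ 2≤e)}} 2≤h)
    by-splitting : (∃ λ r → odd (h ℕ.* e) ≡ odd e ℕ.+ (odd h ℕ.+ r)) → Reach P ws xs T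
    by-splitting (r , split) = subst (λ vs → Reach P vs xs T) (sym ws≡)
      (crowded-reach a b (run c′ r ++ os) xs 2≤h (trans len len-os) (ih h<P (ℕₚ.<⇒≤ 2≤h)) (ih e<P (ℕₚ.<⇒≤ 2≤e))
        full sparse he≡P 2≤e u∈ v∈ big v≡u v≢u T)
      where
      b = a + + odd e
      c′ = b + + odd h
      splitP : odd P ≡ odd e ℕ.+ (odd h ℕ.+ r)
      splitP = trans (cong odd (sym he≡P)) split
      ws≡ : ws ≡ run a (odd e) ++ (run b (odd h) ++ (run c′ r ++ os))
      ws≡ = trans (cong (λ n → run a n ++ os) splitP) (trans (cong (_++ os) (trans (run-++ a (odd e) _)
        (cong (run a (odd e) ++_) (run-++ b (odd h) r)))) (trans (Listₚ.++-assoc (run a (odd e)) _ os)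
        (cong (run a (odd e) ++_) (Listₚ.++-assoc (run b (odd h)) _ os))))
      len-os : odd P ℕ.+ length os ≡ odd e ℕ.+ (odd h ℕ.+ length (run c′ r ++ os))
      len-os = trans (cong (ℕ._+ length os) splitP) (trans (lem (odd e) (odd h) r (length os))
        (cong (λ l → odd e ℕ.+ (odd h ℕ.+ l)) (sym (trans (Listₚ.length-++ (run c′ r)) (cong (ℕ._+ length os) (length-run c′ r))))))
        where
        lem : ∀ a b c d → a ℕ.+ (b ℕ.+ c) ℕ.+ d ≡ a ℕ.+ (b ℕ.+ (c ℕ.+ d))
        lem = ℕSolver.solve-∀
  -- `P - 1` copies of `z` and one outlier `x` occupy `P` consecutive weights. Everything else is
  -- placed anyhow, and `x` compensates for it.
  moving : ∀ z → z ∈ xs → (∀ {x} → x ∈ xs → ¬ x ≡ z mod P → Unit P (x - z)) → k ≤ #class P z xs → Reach P ws xs T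
  moving z z∈ units k≤
    with zs , rest , xs↭ , zs≡z , len-zs ← choose (λ y → y ≡? z mod P) k xs k≤
    with x , x∈ , x≢z ← outlier (s≤s (s≤s z≤n)) full z
    with ∈-++⁻ zs (↭ₚ.∈-resp-↭ xs↭ x∈)
  ... | inj₁ x∈zs = contradiction (All.lookup zs≡z x∈zs) x≢z
  ... | inj₂ x∈rest with rest′ , rest↭ ← ∈⇒↭ x∈rest = by-rest (reach-any vs rest′ len-vs)
    where
    vs = run (a + + P) k ++ os
    xs↭′ : (x ∷ zs) ++ rest′ ↭ xs
    xs↭′ = ↭-sym (↭-trans xs↭ (↭-trans (↭ₚ.++⁺ˡ zs rest↭) (↭ₚ.shift x zs rest′)))
    ws≡ : ws ≡ run a P ++ vs
    ws≡ = trans (cong (_++ os) (run-++ a P k)) (Listₚ.++-assoc (run a P) _ os)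
    len-vs : length vs ≡ length rest′
    len-vs = ℕₚ.+-cancelˡ-≡ P _ _ (trans (sym (trans (cong length ws≡) (trans (Listₚ.length-++ (run a P)) (cong (ℕ._+ length vs) (length-run a P)))))
      (trans len-ws (trans (sym len) (trans (sym (↭ₚ.↭-length xs↭′)) (trans (Listₚ.length-++ (x ∷ zs)) (cong (λ n → suc n ℕ.+ length rest′) len-zs))))))
    lem : ∀ t s → (t - s) + s ≡ t
    lem = solve-∀
    by-rest : (∃ λ s → Reach 0 vs rest′ s) → Reach P ws xs T
    by-rest (s , r) = subst (λ us → Reach P us xs T) (sym ws≡) (reach-↭ ↭-refl xs↭′ (reach-mod (≡⇒mod (lem T s))
      (reach-++ (mover P a x zs (cong suc len-zs) zs≡z (units x∈ x≢z) (T - s)) (reach-reduce r))))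
  -- All copies of `z` are kept and filled up to `2P - 2` numbers. No residue occurs more than
  -- `P - 1` times, so these can be paired.
  toggling : ∀ z → (∀ {y} → y ∈ xs → #class P y xs ≤ #class P z xs) →
             (∀ {x} → x ∈ xs → ¬ x ≡ z mod P → Unit P (x - z)) →
             (∀ {h e} → h ℕ.* e ≡ P → 2 ≤ h → e ℕ.+ e ≤ #class P z xs) → #class P z xs ≤ k → Reach P ws xs T
  toggling z max units large ≤k with as , len-as , run≡ ← run-steps a k = by-rest (reach-any vs rest len-vs)
    where
    μ = #class P z xs
    m = k ℕ.+ k ℕ.∸ μ
    zs = class P z xs ++ take m (others P z xs)
    rest = drop m (others P z xs)
    vs = run (a + + (k ℕ.+ k)) 1 ++ os
    xs↭ : zs ++ rest ↭ xs
    xs↭ = ↭-trans (↭-reflexive (trans (Listₚ.++-assoc (class P z xs) _ rest)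
      (cong (class P z xs ++_) (Listₚ.take++drop≡id m (others P z xs))))) (↭-sym (class-split P z xs))
    len-xs : length xs ≡ k ℕ.+ k ℕ.+ (1 ℕ.+ length os)
    len-xs = trans len (lem k (length os))
      where
      lem : ∀ k o → suc k ℕ.+ k ℕ.+ o ≡ k ℕ.+ k ℕ.+ (1 ℕ.+ o)
      lem = ℕSolver.solve-∀
    len-zs : length zs ≡ k ℕ.+ k
    len-zs = trans (Listₚ.length-++ (class P z xs)) (trans (cong (μ ℕ.+_) (trans (Listₚ.length-take m _) (ℕₚ.m≤n⇒m⊓n≡m m≤)))
      (ℕₚ.m+[n∸m]≡n (ℕₚ.≤-trans ≤k (ℕₚ.m≤m+n k k))))
      where
      m≤ : m ≤ length (others P z xs)
      m≤ = ℕₚ.m≤n+o⇒m∸n≤o (k ℕ.+ k) μ (ℕₚ.≤-trans (ℕₚ.m≤m+n _ _) (ℕₚ.≤-reflexive (trans (sym len-xs) (length-class-split P z xs))))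
    len-vs : length vs ≡ length rest
    len-vs = ℕₚ.+-cancelˡ-≡ (k ℕ.+ k) _ _ (trans (sym len-xs) (trans (sym (↭ₚ.↭-length xs↭)) (trans (Listₚ.length-++ zs) (cong (ℕ._+ length rest) len-zs))))
    zs⊆ : ∀ {x} → x ∈ zs → x ∈ xs
    zs⊆ x∈ = ↭ₚ.∈-resp-↭ xs↭ (∈-++⁺ˡ x∈)
    #zs≤ : ∀ {x} → x ∈ zs → #class P x zs ≤ k
    #zs≤ {x} x∈ = ℕₚ.≤-trans (ℕₚ.m≤m+n _ _) (ℕₚ.≤-trans (ℕₚ.≤-reflexive (trans (sym (#class-++ P x zs rest)) (#class-↭ P x xs↭)))
      (ℕₚ.≤-trans (max (zs⊆ x∈)) ≤k))
    μ≤ : μ ≤ #class P z zs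
    μ≤ = ℕₚ.≤-trans (ℕₚ.≤-reflexive (sym (#class-all P _ (all-class P z xs)))) (ℕₚ.≤-trans (ℕₚ.m≤m+n _ _)
      (ℕₚ.≤-reflexive (sym (#class-++ P z (class P z xs) _))))
    small : ∀ {h} → h ∣ P → h < P → h ≤ suc (#class P z zs)
    small {h} (divides e P≡eh) h<P = ℕₚ.m≤n⇒m≤1+n (ℕₚ.≤-trans (ℕₚ.m≤m+n h h) (ℕₚ.≤-trans
      (large (sym P≡eh) (factor-≥2 (trans (ℕₚ.*-comm h e) (sym P≡eh)) h<P)) μ≤))
    ws≡ : ws ≡ run a (k ℕ.+ k) ++ vs
    ws≡ = trans (cong (λ n → run a n ++ os) (ℕₚ.+-comm 1 (k ℕ.+ k))) (trans (cong (_++ os) (run-++ a (k ℕ.+ k) 1)) (Listₚ.++-assoc (run a (k ℕ.+ k)) _ os))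
    lem : ∀ t s → (t - s) + s ≡ t
    lem = solve-∀
    by-rest : (∃ λ s → Reach 0 vs rest s) → Reach P ws xs T
    by-rest (s , r) = subst (λ us → Reach P us xs T) (sym (trans ws≡ (cong (_++ vs) run≡))) (reach-↭ ↭-refl xs↭ (reach-mod (≡⇒mod (lem T s))
      (reach-++ (reach-toggles k z zs as len-zs len-as #zs≤ (λ x∈ → units (zs⊆ x∈)) small (T - s)) (reach-reduce r))))
  result : Reach P ws xs T
  result with all-sparse-or-reach P ws xs T (s≤s z≤n) crowded
  ... | inj₂ r = r
  ... | inj₁ sparse with z , z∈ , max ← most-frequent′ P xs (subst (1 ≤_) (sym len) (s≤s z≤n)) = by-multiplicity
    where
    large : ∀ {h e} → h ℕ.* e ≡ P → 2 ≤ h → e ℕ.+ e ≤ #class P z xs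
    large {h} {e} he≡P 2≤h = large-class xs (sparse h 2≤h) max (begin-strict
      P ℕ.+ P                     ≡⟨ ℕₚ.+-suc P k ⟩
      suc (odd P)                 <⟨ ℕₚ.n<1+n _ ⟩
      2 ℕ.+ odd P                 ≡⟨ ℕₚ.+-comm 2 (odd P) ⟩
      odd P ℕ.+ 2                 ≤⟨ ℕₚ.+-mono-≤ (ℕₚ.m≤m+n (odd P) (length os)) 2≤h ⟩
      odd P ℕ.+ length os ℕ.+ h   ≡⟨ cong (ℕ._+ h) len ⟨
      length xs ℕ.+ h             ∎) 2≤h he≡P
      where open ℕₚ.≤-Reasoning
    units : ∀ {x} → x ∈ xs → ¬ x ≡ z mod P → Unit P (x - z)
    units = outlier-unit xs sparse z∈ λ he≡P 2≤h → ℕₚ.m≤n⇒m≤1+n (large he≡P 2≤h)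
    by-multiplicity : Reach P ws xs T
    by-multiplicity with ℕₚ.≤-total k (#class P z xs)
    ... | inj₁ k≤ = moving z z∈ units k≤
    ... | inj₂ ≤k = toggling z max units large ≤k

universal : ∀ P → 1 ≤ P → Universal P
universal = <-rec _ λ where
  1 ih _ a os xs len full T → reach-one (run a 1 ++ os) xs (sym len) T
  (suc (suc k)) ih _ → universal-step k λ h<P 1≤h → ih h<P 1≤h

-- Lists that are constant modulo a divisor

constant? : ∀ n xs → Dec (∃ λ r → All (λ x → x ≡ r mod n) xs)
constant? n []       = yes (0ℤ , [])
constant? n (x ∷ xs) with All.all? (λ y → y ≡? x mod n) xs
... | yes all = yes (x , mod-refl ∷ all)
... | no ¬all = no λ { (r , x≡r ∷ all) → ¬all (All.map (λ y≡r → mod-trans y≡r (mod-sym x≡r)) all) }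

mod-one : ∀ x → x ≡ 0ℤ mod 1
mod-one x = x because lem x
  where
  lem : ∀ x → x ≡ 0ℤ + x * 1ℤ
  lem = solve-∀

largest-constant : ∀ P xs → 1 ≤ P → ∃₂ λ h r → h ∣ P × 1 ≤ h × All (λ x → x ≡ r mod h) xs ×
                   (∀ {h′ r′} → h < h′ → h′ ∣ P → ¬ All (λ x → x ≡ r′ mod h′) xs)
largest-constant P xs 1≤P = search P λ P<h h∣P _ → ℕₚ.<⇒≱ P<h (∣⇒≤ {{1≤⇒nonZero 1≤P}} h∣P)
  where
  search : ∀ n → (∀ {h′ r′} → n < h′ → h′ ∣ P → ¬ All (λ x → x ≡ r′ mod h′) xs) →
           ∃₂ λ h r → h ∣ P × 1 ≤ h × All (λ x → x ≡ r mod h) xs ×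
           (∀ {h′ r′} → h < h′ → h′ ∣ P → ¬ All (λ x → x ≡ r′ mod h′) xs)
  search zero    above = contradiction (All.universal mod-one xs) (above {r′ = 0ℤ} (s≤s z≤n) (1∣ P))
  search (suc n) above with suc n ∣? P | constant? (suc n) xs
  ... | yes d  | yes (r , all) = suc n , r , d , s≤s z≤n , all , above
  ... | no ¬d  | _      = search n λ n<h h∣P all → none h∣P all (ℕₚ.m≤n⇒m<n∨m≡n n<h)
    where
    none : ∀ {h′ r′} → h′ ∣ P → All (λ x → x ≡ r′ mod h′) xs → ¬ (suc n < h′ ⊎ suc n ≡ h′)
    none h∣P all (inj₁ lt)   = above lt h∣P all
    none h∣P all (inj₂ refl) = ¬d h∣P
  ... | yes _  | no ¬c  = search n λ n<h h∣P all → none h∣P all (ℕₚ.m≤n⇒m<n∨m≡n n<h)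
    where
    none : ∀ {h′ r′} → h′ ∣ P → All (λ x → x ≡ r′ mod h′) xs → ¬ (suc n < h′ ⊎ suc n ≡ h′)
    none h∣P all (inj₁ lt)   = above lt h∣P all
    none h∣P all (inj₂ refl) = ¬c (_ , all)

-- With `h` the largest divisor modulo which `xs` is constant, the quotients are full modulo `P / h`
-- and can be sent to 0. The common residue contributes a multiple of `sum ws`, which vanishes.
full-or-balanced : ∀ P ws xs → 1 ≤ P → length ws ≡ length xs → sum ws ≡ 0ℤ mod P →
                   (∀ {h e} → h ℕ.* e ≡ P → 2 ≤ h → 1 ≤ e → ∃₂ λ a os → ws ↭ run a (odd e) ++ os) →
                   Full P xs ⊎ Reach P ws xs 0ℤ
full-or-balanced P ws xs 1≤P len sum≡0 runs with largest-constant P xs 1≤P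
... | 1 , r , _ , _ , _ , max = inj₁ λ d∣P 1<d (r′ , all) → max 1<d d∣P all
... | h@(suc (suc _)) , r , divides e P≡eh , _ , xs≡r , max =
  inj₂ (by-scaling (runs {h} {e} he≡P (s≤s (s≤s z≤n)) 1≤e) (unscale h r xs xs≡r))
  where
  he≡P : h ℕ.* e ≡ P
  he≡P = trans (ℕₚ.*-comm h e) (sym P≡eh)
  1≤e : 1 ≤ e
  1≤e = ℕₚ.n≢0⇒n>0 λ e≡0 → ℕₚ.>⇒≢ 1≤P (trans P≡eh (cong (ℕ._* h) e≡0))
  full : ∀ {us} → xs ≡ map (λ u → r + + h * u) us → Full e us
  full xs≡ {d} d∣e 1<d (r′ , us≡r′) = max (ℕₚ.m<m*n h d 1<d) hd∣P
    (subst (All _) (sym xs≡) (Allₚ.map⁺ (All.map (λ {u} u≡r′ → mod-+ˡ r (mod-scale {h = h} u≡r′)) us≡r′)))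
    where
    hd∣P : h ℕ.* d ∣ P
    hd∣P = subst (h ℕ.* d ∣_) he≡P (*-monoʳ-∣ h d∣e)
  total≡0 : r * sum ws + + h * 0ℤ ≡ 0ℤ mod P
  total≡0 = mod-trans (mod-+ʳ (+ h * 0ℤ) (mod-*ˡ r sum≡0)) (≡⇒mod (lem r (+ h)))
    where
    lem : ∀ r h → r * 0ℤ + h * 0ℤ ≡ 0ℤ
    lem = solve-∀
  by-scaling : (∃₂ λ a os → ws ↭ run a (odd e) ++ os) → (∃ λ us → xs ≡ map (λ u → r + + h * u) us) → Reach P ws xs 0ℤ
  by-scaling (a , os , ws↭) (us , xs≡) = reach-mod total≡0
    (subst (λ n → Reach n ws xs (r * sum ws + + h * 0ℤ)) he≡P (reach-scale {h = h} r
      (reach-↭ (↭-sym ws↭) ↭-refl (universal e 1≤e a os us len-us (full xs≡) 0ℤ)) xs≡))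
    where
    len-us : length us ≡ odd e ℕ.+ length os
    len-us = trans (sym (Listₚ.length-map _ us)) (trans (cong length (sym xs≡)) (trans (sym len)
      (trans (↭ₚ.↭-length ws↭) (trans (Listₚ.length-++ (run a (odd e))) (cong (ℕ._+ length os) (length-run a (odd e)))))))

sum-run-shift : ∀ a c l → sum (run (a + c) l) ≡ sum (run a l) + + l * c
sum-run-shift a c zero    = lem c
  where
  lem : ∀ c → 0ℤ ≡ 0ℤ + 0ℤ * c
  lem = solve-∀
sum-run-shift a c (suc l) = trans (cong (λ b → a + c + sum (run b l)) (lem₁ a c))
  (trans (cong (_+_ (a + c)) (sum-run-shift (a + 1ℤ) c l)) (lem₂ a c (sum (run (a + 1ℤ) l)) (+ l)))
  where
  lem₁ : ∀ a c → a + c + 1ℤ ≡ a + 1ℤ + c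
  lem₁ = solve-∀
  lem₂ : ∀ a c s l → a + c + (s + l * c) ≡ a + s + (1ℤ + l) * c
  lem₂ = solve-∀

sum-run : ∀ l → + 2 * sum (run 1ℤ l) ≡ + l * + suc l
sum-run zero    = refl
sum-run (suc l) = trans (cong (λ s → + 2 * (1ℤ + s)) (sum-run-shift 1ℤ 1ℤ l))
  (trans (lem₁ (sum (run 1ℤ l)) (+ l)) (trans (cong (λ s → s + + 2 * (1ℤ + + l)) (sum-run l)) (lem₂ (+ l))))
  where
  lem₁ : ∀ s l → + 2 * (1ℤ + (s + l * 1ℤ)) ≡ + 2 * s + + 2 * (1ℤ + l)
  lem₁ = solve-∀
  lem₂ : ∀ l → l * (1ℤ + l) + + 2 * (1ℤ + l) ≡ (1ℤ + l) * (1ℤ + (1ℤ + l))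
  lem₂ = solve-∀

-- The numbers 1, ..., 2P - 1 without P, where P = p + 1.
twice : ℕ → List ℤ
twice p = run 1ℤ p ++ run (1ℤ + + suc p) p

length-twice : ∀ p → length (twice p) ≡ p ℕ.+ p
length-twice p = trans (Listₚ.length-++ (run 1ℤ p)) (cong₂ ℕ._+_ (length-run 1ℤ p) (length-run _ p))

sum-twice : ∀ p → sum (twice p) ≡ (+ p + + p) * + suc p
sum-twice p = trans (sum-++ (run 1ℤ p) _) (trans (cong (_+_ S) (sum-run-shift 1ℤ (+ suc p) p))
  (trans (lem₁ S (+ p * + suc p)) (trans (cong (_+ + p * + suc p) (sum-run p)) (lem₂ (+ p) (+ suc p)))))
  where
  S = sum (run 1ℤ p)
  lem₁ : ∀ s c → s + (s + c) ≡ + 2 * s + c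
  lem₁ = solve-∀
  lem₂ : ∀ p P → p * P + p * P ≡ (p + p) * P
  lem₂ = solve-∀

sum-twice≡0 : ∀ p → sum (twice p) ≡ 0ℤ mod suc p
sum-twice≡0 p = + p + + p because trans (sum-twice p) (sym (ℤₚ.+-identityˡ _))

-- `P - 1` consecutive weights starting at 1 modulo `P` omit only the residue 0.
residue-pick : ∀ p b x → ¬ x ≡ 0ℤ mod suc p → b ≡ 1ℤ mod suc p → ∃₂ λ w ws → run b p ↭ w ∷ ws × w ≡ x mod suc p
residue-pick p b x x≢0 b≡1 with x ℤ.%ℕ suc p in eq
... | zero  = contradiction (mod-trans (mod-%ℕ x (suc p)) (≡⇒mod (cong +_ eq))) x≢0
... | suc i with ws , p↭ ← run-pick b p i (ℕₚ.≤-pred (subst (_< suc p) eq (ℤ.n%ℕd<d x (suc p)))) =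
  b + + i , ws , p↭ , mod-trans (mod-+ʳ (+ i) b≡1) (mod-sym (mod-trans (mod-%ℕ x (suc p)) (≡⇒mod (cong +_ eq))))

one-more-period : ∀ p → 1ℤ + + suc p ≡ 1ℤ mod suc p
one-more-period p = 1ℤ because lem (+ suc p)
  where
  lem : ∀ n → 1ℤ + n ≡ 1ℤ + 1ℤ * n
  lem = solve-∀

-- With `x` at a weight congruent to `y - z` and `y` at one congruent to `z - x`, the deviations
-- `(y - z)(x - z)` and `(z - x)(y - z)` cancel. Taking the weights from different blocks avoids a
-- clash when their residues coincide.
two-outliers : ∀ p {x y z} zs → length (x ∷ y ∷ zs) ≡ p ℕ.+ p → All (λ w → w ≡ z mod suc p) zs →
               ¬ x ≡ z mod suc p → ¬ y ≡ z mod suc p → Reach (suc p) (twice p) (x ∷ y ∷ zs) 0ℤ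
two-outliers p {x} {y} {z} zs len zs≡z x≢z y≢z
  with u , us , us↭ , u≡ ← residue-pick p 1ℤ (y - z) (λ e → y≢z (mod-cancel-- {a = y} {b = z} e)) (mod-refl {a = 1ℤ})
  with v , vs , vs↭ , v≡ ← residue-pick p (1ℤ + + suc p) (z - x) (λ e → x≢z (mod-sym (mod-cancel-- {a = z} {b = x} e))) (one-more-period p) =
  reach-↭ (↭-sym ws↭) ↭-refl (reach-mod value≡0
    (reach-∷ u x (reach-∷ v y (reach-constant (us ++ vs) zs (ℕₚ.suc-injective (ℕₚ.suc-injective lengths)) zs≡z))))
  where
  P = suc p
  ws↭ : twice p ↭ u ∷ v ∷ us ++ vs
  ws↭ = ↭-trans (↭ₚ.++⁺ us↭ vs↭) (prep u (↭ₚ.shift v us vs))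
  lengths : length (u ∷ v ∷ us ++ vs) ≡ length (x ∷ y ∷ zs)
  lengths = trans (sym (↭ₚ.↭-length ws↭)) (trans (length-twice p) (sym len))
  S = sum (us ++ vs)
  value≡0 : u * x + (v * y + z * S) ≡ 0ℤ mod P
  value≡0 = mod-trans (≡⇒mod (lem₁ u v x y z S))
    (mod-trans (mod-+ (mod-+ (mod-* u≡ (mod-refl {a = x - z})) (mod-* v≡ (mod-refl {a = y - z})))
                      (mod-*ˡ z (mod-trans (≡⇒mod (sym (sum-↭ ws↭))) (sum-twice≡0 p))))
               (≡⇒mod (lem₂ x y z)))
    where
    lem₁ : ∀ u v x y z s → u * x + (v * y + z * s) ≡ u * (x - z) + v * (y - z) + z * (u + (v + s))
    lem₁ = solve-∀
    lem₂ : ∀ x y z → (y - z) * (x - z) + (z - x) * (y - z) + z * 0ℤ ≡ 0ℤ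
    lem₂ = solve-∀

-- The weights 1, ..., P - 1 taken twice

-- Since `he - 1 = (2e - 1) + (h - 2) e`, a block of `P - 1` weights holds a run of length `2e - 1`;
-- by symmetry the other block holds one of length `2h - 1`.
twice-split : ∀ p {h e} → h ℕ.* e ≡ suc p → 2 ≤ h → 2 ≤ e → ∃ λ os →
              twice p ↭ run 1ℤ (odd e) ++ (run (1ℤ + + suc p) (odd h) ++ os)
twice-split p {suc (suc h)} {suc (suc e)} he≡P (s≤s (s≤s z≤n)) (s≤s (s≤s z≤n)) = os , ↭-trans
  (↭-reflexive (cong₂ _++_ (trans (cong (run 1ℤ) p≡₁) (run-++ 1ℤ (odd (2 ℕ.+ e)) r₁))
                           (trans (cong (run b) p≡₂) (run-++ b (odd (2 ℕ.+ h)) r₂))))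
  (↭-trans (↭-reflexive (Listₚ.++-assoc (run 1ℤ (odd (2 ℕ.+ e))) _ _)) (↭ₚ.++⁺ˡ (run 1ℤ (odd (2 ℕ.+ e)))
    (↭-trans (↭ₚ.++-comm (run (1ℤ + + odd (2 ℕ.+ e)) r₁) _) (↭-reflexive (Listₚ.++-assoc (run b (odd (2 ℕ.+ h))) _ _)))))
  where
  b = 1ℤ + + suc p
  r₁ = h ℕ.* (2 ℕ.+ e)
  r₂ = e ℕ.* (2 ℕ.+ h)
  os = run (b + + odd (2 ℕ.+ h)) r₂ ++ run (1ℤ + + odd (2 ℕ.+ e)) r₁
  p≡₁ : p ≡ odd (2 ℕ.+ e) ℕ.+ r₁
  p≡₁ = ℕₚ.suc-injective (trans (sym he≡P) (lem h e))
    where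
    lem : ∀ h e → (2 ℕ.+ h) ℕ.* (2 ℕ.+ e) ≡ 1 ℕ.+ ((2 ℕ.+ e) ℕ.+ (1 ℕ.+ e) ℕ.+ h ℕ.* (2 ℕ.+ e))
    lem = ℕSolver.solve-∀
  p≡₂ : p ≡ odd (2 ℕ.+ h) ℕ.+ r₂
  p≡₂ = ℕₚ.suc-injective (trans (sym he≡P) (lem h e))
    where
    lem : ∀ h e → (2 ℕ.+ h) ℕ.* (2 ℕ.+ e) ≡ 1 ℕ.+ ((2 ℕ.+ h) ℕ.+ (1 ℕ.+ h) ℕ.+ e ℕ.* (2 ℕ.+ h))
    lem = ℕSolver.solve-∀

twice-run : ∀ p {h e} → h ℕ.* e ≡ suc p → 2 ≤ h → 1 ≤ e → ∃₂ λ a os → twice p ↭ run a (odd e) ++ os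
twice-run p {suc (suc h)} {suc e} he≡P (s≤s (s≤s z≤n)) (s≤s z≤n) = 1ℤ , _ , ↭-reflexive
  (trans (cong (_++ run (1ℤ + + suc p) p) (trans (cong (run 1ℤ) p≡) (run-++ 1ℤ (odd (suc e)) (h ℕ.* suc e))))
         (Listₚ.++-assoc (run 1ℤ (odd (suc e))) _ _))
  where
  p≡ : p ≡ odd (suc e) ℕ.+ h ℕ.* suc e
  p≡ = ℕₚ.suc-injective (trans (sym he≡P) (lem h e))
    where
    lem : ∀ h e → (2 ℕ.+ h) ℕ.* (1 ℕ.+ e) ≡ 1 ℕ.+ ((1 ℕ.+ e) ℕ.+ e ℕ.+ h ℕ.* (1 ℕ.+ e))
    lem = ℕSolver.solve-∀

-- x moves through the first block of weights; if it would need the missing weight 0,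
-- exchanging y and z′ in the second block shifts its target.
two-movers : ∀ q {x y z z′} zs os → length zs ≡ suc q → length os ≡ q → All (λ w → w ≡ z mod 3 ℕ.+ q) zs →
             z′ ≡ z mod 3 ℕ.+ q → Unit (3 ℕ.+ q) (x - z) → ¬ y ≡ z mod 3 ℕ.+ q →
             Reach (3 ℕ.+ q) (twice (2 ℕ.+ q)) ((x ∷ zs) ++ (y ∷ z′ ∷ os)) 0ℤ
two-movers q {x} {y} {z} {z′} zs os len-zs len-os zs≡z z′≡z unit y≢z = result
  where
  p = 2 ℕ.+ q
  P = suc p
  d = x - z
  b = 1ℤ + + P
  rest = run (b + 1ℤ + 1ℤ) q
  moving : ∀ {c} vs → Reach P (run b p) vs c → ¬ z * sum (run 1ℤ p) + c ≡ 0ℤ mod P →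
           Reach P (twice p) ((x ∷ zs) ++ vs) 0ℤ
  moving {c} vs r c′≢0 with j , jd≡1 ← unit-generates P unit = by-pick (residue-pick p 1ℤ (- (j * c′)) jc≢0 (mod-refl {a = 1ℤ}))
    where
    c′ = z * sum (run 1ℤ p) + c
    jc≢0 : ¬ - (j * c′) ≡ 0ℤ mod P
    jc≢0 e = c′≢0 (mod-trans (≡⇒mod (lem₁ c′)) (mod-trans (mod-*ʳ c′ (mod-sym jd≡1)) (mod-trans (≡⇒mod (lem₂ j d c′)) (mod-trans (mod-*ˡ (- d) e) (≡⇒mod (lem₃ d))))))
      where
      lem₁ : ∀ c → c ≡ 1ℤ * c
      lem₁ = solve-∀
      lem₂ : ∀ j d c → j * d * c ≡ - d * - (j * c)
      lem₂ = solve-∀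
      lem₃ : ∀ d → - d * 0ℤ ≡ 0ℤ
      lem₃ = solve-∀
    by-pick : (∃₂ λ w ws → run 1ℤ p ↭ w ∷ ws × w ≡ - (j * c′) mod P) → Reach P (twice p) ((x ∷ zs) ++ vs) 0ℤ
    by-pick (w , ws , p↭ , w≡) = reach-mod value≡0 (reach-++ (reach-↭ (↭-sym p↭) ↭-refl (place ws zs len zs≡z)) r)
      where
      len : length ws ≡ length zs
      len = ℕₚ.suc-injective (trans (sym (↭ₚ.↭-length p↭)) (trans (length-run 1ℤ p) (cong suc (sym len-zs))))
      value≡0 : w * d + z * sum (w ∷ ws) + c ≡ 0ℤ mod P
      value≡0 = mod-trans (≡⇒mod (cong (λ s → w * d + z * s + c) (sym (sum-↭ p↭)))) (mod-trans (≡⇒mod (ℤₚ.+-assoc (w * d) _ c))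
        (mod-trans (mod-+ʳ c′ (mod-*ʳ d w≡)) (mod-trans (≡⇒mod (lem₁ j d c′)) (mod-trans (mod-+ʳ c′ (mod-neg (mod-*ʳ c′ jd≡1))) (≡⇒mod (lem₂ c′))))))
        where
        lem₁ : ∀ j d c → - (j * c) * d + c ≡ - (j * d * c) + c
        lem₁ = solve-∀
        lem₂ : ∀ c → - (1ℤ * c) + c ≡ 0ℤ
        lem₂ = solve-∀
  result : Reach P (twice p) ((x ∷ zs) ++ (y ∷ z′ ∷ os)) 0ℤ
  result = by-rest (reach-any rest os (trans (length-run _ q) (sym len-os)))
    where
    by-rest : (∃ λ s → Reach 0 rest os s) → Reach P (twice p) ((x ∷ zs) ++ (y ∷ z′ ∷ os)) 0ℤ
    by-rest (s , r) = by-cases ((z * S + c₁) ≡? 0ℤ mod P)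
      where
      S = sum (run 1ℤ p)
      c₁ = b * y + ((b + 1ℤ) * z′ + s)
      c₂ = b * z′ + ((b + 1ℤ) * y + s)
      by-cases : Dec (z * S + c₁ ≡ 0ℤ mod P) → Reach P (twice p) ((x ∷ zs) ++ (y ∷ z′ ∷ os)) 0ℤ
      by-cases (no c₁≢0)  = moving (y ∷ z′ ∷ os) (reach-∷ b y (reach-∷ (b + 1ℤ) z′ (reach-reduce r))) c₁≢0
      by-cases (yes c₁≡0) = moving (y ∷ z′ ∷ os) (reach-↭ ↭-refl (swap z′ y ↭-refl) (reach-∷ b z′ (reach-∷ (b + 1ℤ) y (reach-reduce r))))
        λ c₂≡0 → y≢z (mod-trans (mod-trans (≡⇒mod (lem b y z z′ S s)) (mod-trans (mod-+ʳ z′ (mod-- c₂≡0 c₁≡0)) (≡⇒mod (ℤₚ.+-identityˡ z′)))) z′≡z)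
        where
        lem : ∀ b y z z′ S s → y ≡ (z * S + (b * z′ + ((b + 1ℤ) * y + s))) - (z * S + (b * y + ((b + 1ℤ) * z′ + s))) + z′
        lem = solve-∀

mod-two : ∀ x → x ≡ 0ℤ mod 2 ⊎ x ≡ 1ℤ mod 2
mod-two x with x ℤ.%ℕ 2 in eq | ℤ.n%ℕd<d x 2
... | 0 | _ = inj₁ (mod-trans (mod-%ℕ x 2) (≡⇒mod (cong +_ eq)))
... | 1 | _ = inj₂ (mod-trans (mod-%ℕ x 2) (≡⇒mod (cong +_ eq)))
... | suc (suc _) | s≤s (s≤s ())

mod-two-≢ : ∀ {x y} → ¬ y ≡ x mod 2 → y ≡ x + 1ℤ mod 2
mod-two-≢ {x} {y} y≢x with mod-two (y - x)
... | inj₁ e = contradiction (mod-cancel-- e) y≢x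
... | inj₂ e = mod-trans (≡⇒mod (lem x y)) (mod-+ˡ x e)
  where
  lem : ∀ x y → y ≡ x + (y - x)
  lem = solve-∀

-- There are `P - 1` numbers of each parity. Those with the parity of `x` receive weights that form
-- a run of length `2e - 1` modulo `e`, so their halves reach any target modulo `e`. The others only
-- need to contribute the right parity, which an even sum of their weights ensures.
even-halves : ∀ p xs {e x} → 2 ℕ.* e ≡ suc p → 2 ≤ e → length xs ≡ p ℕ.+ p → (∀ h → 2 ≤ h → Sparse (suc p) xs h) →
              x ∈ xs → #class 2 x xs ≡ p → #class (suc p) x xs < p → Reach (suc p) (twice p) xs 0ℤ
even-halves zero        xs 2e≡P 2≤e len sparse x∈ #x≡p ()
even-halves p@(suc p′) xs {e} {x} 2e≡P 2≤e len sparse x∈ #x≡p #x<p =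
  by-halves (unscale 2 x (class 2 x xs) (all-class 2 x xs)) (run-pick b p e e<p)
  where
  P = suc p
  b = 1ℤ + + P
  xs↭ : class 2 x xs ++ others 2 x xs ↭ xs
  xs↭ = ↭-sym (class-split 2 x xs)
  e+e≡P : e ℕ.+ e ≡ P
  e+e≡P = trans (cong (e ℕ.+_) (sym (ℕₚ.+-identityʳ e))) 2e≡P
  e<p : e < p
  e<p = ℕₚ.≤-pred (ℕₚ.≤-trans (ℕₚ.+-monoˡ-≤ e 2≤e) (ℕₚ.≤-reflexive e+e≡P))
  odd-e : odd e ≡ p
  odd-e = ℕₚ.suc-injective (trans (lem e (ℕₚ.<⇒≤ 2≤e)) e+e≡P)
    where
    lem : ∀ e → 1 ≤ e → suc (odd e) ≡ e ℕ.+ e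
    lem (suc e) _ = sym (ℕₚ.+-suc (suc e) e)
  eℤ : + 2 * + e ≡ + P
  eℤ = trans (sym (ℤₚ.pos-* 2 e)) (cong +_ 2e≡P)
  -- If the halves agreed modulo `d`, sparsity at `2 * d` would make the whole parity class constant
  -- modulo `P`, against `#x<p`.
  full : ∀ {us} → class 2 x xs ≡ map (λ u → x + + 2 * u) us → Full e us
  full {us} class≡ {d} (divides f e≡fd) 1<d (r , us≡r) = ℕₚ.<⇒≱ #x<p (ℕₚ.≤-trans (ℕₚ.≤-reflexive (sym #x≡p))
    (filter-length-∈ (λ y → y ≡? x mod 2) (λ y → y ≡? x mod P) xs λ y∈ y≡x →
      sparse (2 ℕ.* d) (ℕₚ.≤-trans 1<d (ℕₚ.m≤m+n d _)) f 2df≡P x∈ y∈ many (same (∈-filter⁺ (λ y → y ≡? x mod 2) y∈ y≡x))))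
    where
    2df≡P : 2 ℕ.* d ℕ.* f ≡ P
    2df≡P = trans (ℕₚ.*-assoc 2 d f) (trans (cong (2 ℕ.*_) (trans (ℕₚ.*-comm d f) (sym e≡fd))) 2e≡P)
    class≡r : All (λ y → y ≡ x + + 2 * r mod (2 ℕ.* d)) (class 2 x xs)
    class≡r = subst (All _) (sym class≡) (Allₚ.map⁺ (All.map (λ {u} u≡r → mod-+ˡ x (mod-scale {h = 2} u≡r)) us≡r))
    same : ∀ {y} → y ∈ class 2 x xs → y ≡ x mod (2 ℕ.* d)
    same y∈ = mod-trans (All.lookup class≡r y∈) (mod-sym (All.lookup class≡r (∈-filter⁺ (λ y → y ≡? x mod 2) x∈ mod-refl)))
    many : f ℕ.+ f ≤ #class (2 ℕ.* d) x xs
    many = begin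
      f ℕ.+ f                           ≡⟨ cong (f ℕ.+_) (ℕₚ.+-identityʳ f) ⟨
      2 ℕ.* f                           ≤⟨ ℕₚ.*-monoˡ-≤ f 1<d ⟩
      d ℕ.* f                           ≡⟨ ℕₚ.*-comm d f ⟩
      f ℕ.* d                           ≡⟨ e≡fd ⟨
      e                                 ≤⟨ ℕₚ.<⇒≤ e<p ⟩
      p                                 ≡⟨ #x≡p ⟨
      #class 2 x xs                     ≡⟨ #class-all (2 ℕ.* d) (class 2 x xs) (All.tabulate same) ⟨
      #class (2 ℕ.* d) x (class 2 x xs) ≤⟨ ℕₚ.m≤m+n _ _ ⟩
      #class (2 ℕ.* d) x (class 2 x xs) ℕ.+ #class (2 ℕ.* d) x (others 2 x xs) ≡⟨ #class-++ (2 ℕ.* d) x (class 2 x xs) _ ⟨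
      #class (2 ℕ.* d) x (class 2 x xs ++ others 2 x xs) ≡⟨ #class-↭ (2 ℕ.* d) x xs↭ ⟩
      #class (2 ℕ.* d) x xs             ∎
      where open ℕₚ.≤-Reasoning
  by-halves : (∃ λ us → class 2 x xs ≡ map (λ u → x + + 2 * u) us) → (∃ λ vs → run b p ↭ b + + e ∷ vs) →
              Reach P (twice p) xs 0ℤ
  by-halves (us , class≡) (vs , run↭) = by-odd (reach-exact (reach-constant W₂ (others 2 x xs) len-W₂ (All.map mod-two-≢ (all-others 2 x xs))))
    where
    -- The weight 1 is traded for `1 + P + e`, which is congruent to it modulo `e`. The second block
    -- sums to `3e (2e - 1)`, of the parity of `e`, and the trade lowers this by `P + e`; so the
    -- result is even whatever the parity of `e`.
    W₁ = b + + e ∷ run (1ℤ + 1ℤ) p′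
    W₂ = 1ℤ ∷ vs
    ws↭ : twice p ↭ W₁ ++ W₂
    ws↭ = ↭-trans (↭ₚ.++⁺ˡ (run 1ℤ p) run↭) (↭-trans (↭ₚ.shift (b + + e) (run 1ℤ p) vs)
      (prep (b + + e) (↭-sym (↭ₚ.shift 1ℤ (run (1ℤ + 1ℤ) p′) vs))))
    len-W₂ : length W₂ ≡ length (others 2 x xs)
    len-W₂ = trans (sym (↭ₚ.↭-length run↭)) (trans (length-run b p) (ℕₚ.+-cancelˡ-≡ p _ _
      (trans (sym len) (trans (length-class-split 2 x xs) (cong (ℕ._+ length (others 2 x xs)) #x≡p)))))
    W₂-even : sum W₂ ≡ 0ℤ mod 2
    -- The sum is `6e (e - 1)`. It is verified after doubling, since the closed form of a run is
    -- available only doubled.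
    W₂-even = (+ e - 1ℤ) * (+ e + + P) because ℤₚ.*-cancelˡ-≡ (+ 2) _ _ double
      where
      S = sum (run 1ℤ p)
      p′ℤ : + p′ ≡ + 2 * + e - + 2
      p′ℤ = trans (lem (+ p′)) (cong (_- + 2) (sym eℤ))
        where
        lem : ∀ p → p ≡ 1ℤ + (1ℤ + p) - + 2
        lem = solve-∀
      double : + 2 * sum W₂ ≡ + 2 * (0ℤ + (+ e - 1ℤ) * (+ e + + P) * + 2)
      double = trans (lem₁ (+ P) (+ e) (sum vs)) (trans (cong (λ s → + 2 * (s - + P - + e)) (trans (sym (sum-↭ run↭)) (sum-run-shift 1ℤ (+ P) p)))
        (trans (lem₂ S (+ p * + P) (+ P) (+ e)) (trans (cong (λ s → s + + 2 * (+ p * + P - + P - + e)) (sum-run p))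
        (trans (cong (λ q → (1ℤ + q) * + P + + 2 * ((1ℤ + q) * + P - + P - + e)) p′ℤ) (trans (cong (λ q → (1ℤ + (+ 2 * + e - + 2)) * q + + 2 * ((1ℤ + (+ 2 * + e - + 2)) * q - q - + e)) (sym eℤ))
        (trans (lem₃ (+ e)) (cong (λ q → + 2 * (0ℤ + (+ e - 1ℤ) * (+ e + q) * + 2)) eℤ)))))))
        where
        lem₁ : ∀ P e v → + 2 * (1ℤ + v) ≡ + 2 * (1ℤ + P + e + v - P - e)
        lem₁ = solve-∀
        lem₂ : ∀ S c P e → + 2 * (S + c - P - e) ≡ + 2 * S + + 2 * (c - P - e)
        lem₂ = solve-∀
        lem₃ : ∀ e → (1ℤ + (+ 2 * e - + 2)) * (+ 2 * e) + + 2 * ((1ℤ + (+ 2 * e - + 2)) * (+ 2 * e) - + 2 * e - e) ≡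
                     + 2 * (0ℤ + (e - 1ℤ) * (e + + 2 * e) * + 2)
        lem₃ = solve-∀
    W₁-even : sum W₁ ≡ 0ℤ mod 2
    W₁-even = mod-trans (≡⇒mod (lem (sum W₁) (sum W₂))) (mod-trans (mod-- (mod-trans (≡⇒mod (trans (sym (sum-++ W₁ W₂)) (sym (sum-↭ ws↭))))
      (mod-∣ (divides e (trans (sym 2e≡P) (ℕₚ.*-comm 2 e))) (sum-twice≡0 p))) W₂-even) mod-refl)
      where
      lem : ∀ a b → a ≡ a + b - b
      lem = solve-∀
    by-odd : (∃ λ s → Reach 0 W₂ (others 2 x xs) s × s ≡ (x + 1ℤ) * sum W₂ mod 2) → Reach P (twice p) xs 0ℤ
    by-odd (s , r , s≡) = by-parity (mod-+ (mod-*ˡ x W₁-even) (mod-trans s≡ (mod-*ˡ (x + 1ℤ) W₂-even)))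
      where
      by-parity : x * sum W₁ + s ≡ x * 0ℤ + (x + 1ℤ) * 0ℤ mod 2 → Reach P (twice p) xs 0ℤ
      by-parity (q because eq) = reach-↭ (↭-sym ws↭) xs↭ (reach-mod (≡⇒mod (trans (lem₁ (x * sum W₁) s q) (trans (cong (_- q * + 2) eq) (lem₂ x q))))
        (reach-++ (subst (λ n → Reach n W₁ (class 2 x xs) (x * sum W₁ + + 2 * - q)) 2e≡P (reach-scale {h = 2} x
          (reach-reweigh 1≡ (reach-↭ (↭-trans (↭ₚ.++-identityʳ (run 1ℤ (odd e))) (↭-reflexive (cong (run 1ℤ) odd-e))) ↭-refl
            (universal e (ℕₚ.<⇒≤ 2≤e) 1ℤ [] us len-us (full class≡) (- q)))) class≡)) (reach-reduce r)))
        where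
        lem₁ : ∀ c s q → c + + 2 * - q + s ≡ c + s - q * + 2
        lem₁ = solve-∀
        lem₂ : ∀ x q → x * 0ℤ + (x + 1ℤ) * 0ℤ + q * + 2 - q * + 2 ≡ 0ℤ
        lem₂ = solve-∀
        len-us : length us ≡ odd e ℕ.+ 0
        len-us = trans (sym (Listₚ.length-map _ us)) (trans (cong length (sym class≡)) (trans #x≡p (trans (sym odd-e) (sym (ℕₚ.+-identityʳ _)))))
        1≡ : 1ℤ ≡ b + + e mod e
        1≡ = - + 3 because trans (lem (+ e)) (cong (λ P → 1ℤ + P + + e + - + 3 * + e) eℤ)
          where
          lem : ∀ e → 1ℤ ≡ 1ℤ + + 2 * e + e + - + 3 * e
          lem = solve-∀

record SingleOutlier (n : ℕ) (xs : List ℤ) : Set where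
  constructor single
  field
    {z w} : ℤ
    {zs}  : List ℤ
    xs↭   : xs ↭ w ∷ zs
    zs≡z  : All (λ y → y ≡ z mod n) zs
    w≢z   : ¬ w ≡ z mod n

even-or-odd : ∀ n → (∃ λ k → n ≡ k ℕ.+ k) ⊎ (∃ λ k → n ≡ suc (k ℕ.+ k))
even-or-odd zero = inj₁ (0 , refl)
even-or-odd (suc n) with even-or-odd n
... | inj₁ (k , refl) = inj₂ (k , refl)
... | inj₂ (k , refl) = inj₁ (suc k , cong suc (sym (ℕₚ.+-suc k k)))

steps-++ : ∀ as bs → steps (as ++ bs) ≡ steps as ++ steps bs
steps-++ []       bs = refl
steps-++ (a ∷ as) bs = cong (λ ws → a ∷ a + 1ℤ ∷ ws) (steps-++ as bs)

module _ (p′ : ℕ) (xs : List ℤ) (len : length xs ≡ suc p′ ℕ.+ suc p′) (full : Full (suc (suc p′)) xs)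
         (sparse : ∀ h → 2 ≤ h → Sparse (suc (suc p′)) xs h) {z : ℤ} (z∈ : z ∈ xs)
         (max : ∀ {y} → y ∈ xs → #class (suc (suc p′)) y xs ≤ #class (suc (suc p′)) z xs) where

  private
    p = suc p′
    P = suc p
    μ = #class P z xs

  -- No outlier would contradict fullness, and two or more permit `two-movers`; exactly one is what
  -- remains.
  concentrated : p ≤ μ → Reach P (twice p) xs 0ℤ ⊎ SingleOutlier P xs
  concentrated p≤μ = by-others (others P z xs) (class-split P z xs) (all-others P z xs)
    where
    large : ∀ {h e} → h ℕ.* e ≡ P → 2 ≤ h → e ℕ.+ e ≤ suc μ
    large {h} {e} he≡P 2≤h = begin
      e ℕ.+ e   ≡⟨ cong (e ℕ.+_) (ℕₚ.+-identityʳ e) ⟨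
      2 ℕ.* e   ≤⟨ ℕₚ.*-monoˡ-≤ e 2≤h ⟩
      h ℕ.* e   ≡⟨ he≡P ⟩
      suc p     ≤⟨ s≤s p≤μ ⟩
      suc μ     ∎
      where open ℕₚ.≤-Reasoning
    by-others : ∀ os → xs ↭ class P z xs ++ os → All (λ y → ¬ y ≡ z mod P) os → Reach P (twice p) xs 0ℤ ⊎ SingleOutlier P xs
    by-others [] xs↭ _ = contradiction
      (z , ↭ₚ.All-resp-↭ (↭-sym (↭-trans xs↭ (↭ₚ.++-identityʳ (class P z xs)))) (all-class P z xs)) (full ∣-refl (s≤s (s≤s z≤n)))
    by-others (w ∷ []) xs↭ (w≢z ∷ []) = inj₂ (single (↭-trans xs↭ (↭ₚ.++-comm (class P z xs) (w ∷ []))) (all-class P z xs) w≢z)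
    by-others (x ∷ y ∷ os) xs↭ (x≢z ∷ y≢z ∷ _) =
      inj₁ (moving (class P z xs) xs↭ (all-class P z xs) (ℕₚ.m≤n⇒∃[o]m+o≡n 2≤p) p≤μ)
      where
      len-parts : p ℕ.+ p ≡ μ ℕ.+ (2 ℕ.+ length os)
      len-parts = trans (sym len) (trans (↭ₚ.↭-length xs↭) (Listₚ.length-++ (class P z xs)))
      2≤p : 2 ≤ p
      2≤p = ℕₚ.≤-trans (ℕₚ.m≤m+n 2 (length os)) (ℕₚ.+-cancelˡ-≤ p _ _ (ℕₚ.≤-trans (ℕₚ.+-monoˡ-≤ _ p≤μ) (ℕₚ.≤-reflexive (sym len-parts))))
      moving : ∀ cs → xs ↭ cs ++ x ∷ y ∷ os → All (λ y → y ≡ z mod P) cs → (∃ λ q → 2 ℕ.+ q ≡ p) → p ≤ length cs →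
               Reach P (twice p) xs 0ℤ
      moving (z′ ∷ cs) xs↭ (z′≡z ∷ cs≡z) (q , refl) (s≤s p′≤) = reach-↭ ↭-refl (↭-sym (↭-trans xs↭ shuffle))
        (two-movers q zs (restz ++ os) len-zs len-rest (Allₚ.take⁺ (suc q) cs≡z) z′≡z
          (outlier-unit xs sparse z∈ large (↭ₚ.∈-resp-↭ (↭-sym xs↭) (∈-++⁺ʳ (z′ ∷ cs) (here refl))) x≢z) y≢z)
        where
        zs = take (suc q) cs
        restz = drop (suc q) cs
        len-zs : length zs ≡ suc q
        len-zs = trans (Listₚ.length-take (suc q) cs) (ℕₚ.m≤n⇒m⊓n≡m p′≤)
        shuffle : z′ ∷ cs ++ x ∷ y ∷ os ↭ (x ∷ zs) ++ (y ∷ z′ ∷ restz ++ os)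
        shuffle = ↭-trans (↭ₚ.shifts (z′ ∷ cs) (x ∷ y ∷ [])) (prep x (↭-trans (↭-reflexive
          (cong (λ l → y ∷ z′ ∷ l) (trans (cong (_++ os) (sym (Listₚ.take++drop≡id (suc q) cs))) (Listₚ.++-assoc zs restz os))))
          (↭ₚ.shifts (y ∷ z′ ∷ []) zs)))
        len-rest : length (restz ++ os) ≡ q
        len-rest = ℕₚ.+-cancelˡ-≡ (4 ℕ.+ q) _ _ (trans (trans (lem₁ q (length (restz ++ os))) (trans (cong (λ n → suc n ℕ.+ (2 ℕ.+ length (restz ++ os))) (sym len-zs))
          (trans (sym (Listₚ.length-++ (x ∷ zs))) (trans (sym (↭ₚ.↭-length (↭-trans xs↭ shuffle))) len)))) (lem₂ q))
          where
          lem₁ : ∀ q l → 4 ℕ.+ q ℕ.+ l ≡ suc (suc q) ℕ.+ (2 ℕ.+ l)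
          lem₁ = ℕSolver.solve-∀
          lem₂ : ∀ q → 2 ℕ.+ q ℕ.+ (2 ℕ.+ q) ≡ 4 ℕ.+ q ℕ.+ q
          lem₂ = ℕSolver.solve-∀

  -- For odd `P` both blocks have even length and split into consecutive pairs, and `large-class`
  -- tolerates the missing number because every divisor above 1 is at least 3. For even `P` both
  -- arguments break down, and the two parity classes are treated instead.
  dispersed : μ < p → Reach P (twice p) xs 0ℤ
  dispersed μ<p with 2 ∣? P
  ... | yes (divides e P≡e2) with Any.any? (λ x → p ℕ.≤? #class 2 x xs) xs
  ...   | no none = contradiction (pigeonhole 2 p′ xs λ x∈ → ℕₚ.<⇒≤pred (ℕₚ.≰⇒> λ big → none (lose x∈ big)))
            (ℕₚ.<⇒≱ (ℕₚ.<-≤-trans (ℕₚ.<-≤-trans (ℕₚ.n<1+n _) (ℕₚ.n≤1+n _)) (ℕₚ.≤-reflexive (sym (trans len (lem p′))))))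
    where
    lem : ∀ p → suc p ℕ.+ suc p ≡ suc (suc (2 ℕ.* p))
    lem = ℕSolver.solve-∀
  ...   | yes some with x , x∈ , p≤ ← find some = even-halves p xs 2e≡P 2≤e len sparse x∈ (ℕₚ.≤-antisym ≤p p≤) (ℕₚ.≤-<-trans (max x∈) μ<p)
    where
    2e≡P : 2 ℕ.* e ≡ P
    2e≡P = trans (ℕₚ.*-comm 2 e) (sym P≡e2)
    -- A parity class with more than `p` members reaches the threshold `2e = P` of sparsity, so it
    -- would be constant modulo `P` and exceed `μ`.
    ≤p : #class 2 x xs ≤ p
    ≤p = ℕₚ.≮⇒≥ λ p< → ℕₚ.<⇒≱ μ<p (ℕₚ.<⇒≤ (ℕₚ.<-≤-trans p< (ℕₚ.≤-trans
      (filter-length-∈ (λ y → y ≡? x mod 2) (λ y → y ≡? x mod P) xs (λ y∈ → sparse 2 ℕₚ.≤-refl e 2e≡P x∈ y∈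
        (ℕₚ.≤-trans (ℕₚ.≤-reflexive (trans (cong (e ℕ.+_) (sym (ℕₚ.+-identityʳ e))) 2e≡P)) p<))) (max x∈))))
    2≤p : 2 ≤ p
    2≤p = ℕₚ.≤-trans (s≤s (Listₚ.filter-some (λ y → y ≡? z mod P) (lose z∈ mod-refl))) μ<p
    2≤e : 2 ≤ e
    2≤e = ℕₚ.*-cancelˡ-< 2 1 e (ℕₚ.≤-trans (s≤s 2≤p) (ℕₚ.≤-reflexive (sym 2e≡P)))
  dispersed μ<p | no 2∤P with even-or-odd p
  ... | inj₂ (k , p≡) = contradiction (divides (suc k) (trans (cong suc p≡) (lem k))) 2∤P
    where
    lem : ∀ k → suc (suc (k ℕ.+ k)) ≡ suc k ℕ.* 2
    lem = ℕSolver.solve-∀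
  ... | inj₁ (k , p≡) with as , len-as , run≡₁ ← run-steps 1ℤ k | bs , len-bs , run≡₂ ← run-steps (1ℤ + + P) k =
    subst (λ ws → Reach P ws xs 0ℤ) ws≡ (reach-toggles p z xs (as ++ bs) len len-steps (λ x∈ → ℕₚ.≤-trans (max x∈) (ℕₚ.<⇒≤ μ<p))
      (outlier-unit xs sparse z∈ λ he≡P 2≤h → ℕₚ.m≤n⇒m≤1+n (large he≡P 2≤h)) small 0ℤ)
    where
    ws≡ : steps (as ++ bs) ≡ twice p
    ws≡ = trans (steps-++ as bs) (trans (cong₂ _++_ (sym run≡₁) (sym run≡₂)) (cong (λ n → run 1ℤ n ++ run (1ℤ + + P) n) (sym p≡)))
    len-steps : length (as ++ bs) ≡ p
    len-steps = trans (Listₚ.length-++ as) (trans (cong₂ ℕ._+_ len-as len-bs) (sym p≡))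
    large : ∀ {h e} → h ℕ.* e ≡ P → 2 ≤ h → e ℕ.+ e ≤ μ
    large {h} {e} he≡P 2≤h = large-class xs (sparse h 2≤h) max (begin-strict
      P ℕ.+ P           ≡⟨ lem p ⟩
      p ℕ.+ p ℕ.+ 2     <⟨ ℕₚ.+-monoʳ-< (p ℕ.+ p) (ℕₚ.≤∧≢⇒< 2≤h λ { refl → 2∤P (divides e (trans (sym he≡P) (ℕₚ.*-comm 2 e))) }) ⟩
      p ℕ.+ p ℕ.+ h     ≡⟨ cong (ℕ._+ h) len ⟨
      length xs ℕ.+ h   ∎) 2≤h he≡P
      where
      open ℕₚ.≤-Reasoning
      lem : ∀ p → suc p ℕ.+ suc p ≡ p ℕ.+ p ℕ.+ 2
      lem = ℕSolver.solve-∀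
    small : ∀ {h} → h ∣ P → h < P → h ≤ suc μ
    small {h} (divides e P≡eh) h<P = ℕₚ.m≤n⇒m≤1+n (ℕₚ.≤-trans (ℕₚ.m≤m+n h h)
      (large (sym P≡eh) (factor-≥2 (trans (ℕₚ.*-comm h e) (sym P≡eh)) h<P)))

twice-reach : ∀ p xs → length xs ≡ p ℕ.+ p → Reach (suc p) (twice p) xs 0ℤ ⊎ SingleOutlier (suc p) xs
twice-reach zero    [] len = inj₁ reach-[]
twice-reach (suc p′) xs len = result (full-or-balanced P (twice p) xs (s≤s z≤n) (trans (length-twice p) (sym len)) (sum-twice≡0 p) (twice-run p))
  where
  p = suc p′
  P = suc p
  crowded : Full P xs → ∀ h → 2 ≤ h → h < P → (∀ h′ → h < h′ → Sparse P xs h′) → Crowded P xs h → Reach P (twice p) xs 0ℤ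
  crowded full h 2≤h h<P sparse c with os , ws↭ ← twice-split p {h} {Crowded.e c} (Crowded.he≡P c) 2≤h (factor-≥2 (Crowded.he≡P c) h<P) =
    reach-↭ (↭-sym ws↭) ↭-refl (crowded-reach 1ℤ (1ℤ + + P) os xs 2≤h len-parts (universal h (ℕₚ.<⇒≤ 2≤h)) (universal e (ℕₚ.<⇒≤ 2≤e))
      full sparse he≡P 2≤e u∈ v∈ big v≡u v≢u 0ℤ)
    where
    open Crowded c
    2≤e : 2 ≤ e
    2≤e = factor-≥2 he≡P h<P
    len-parts : length xs ≡ odd e ℕ.+ (odd h ℕ.+ length os)
    len-parts = trans len (trans (sym (length-twice p)) (trans (↭ₚ.↭-length ws↭) (trans (Listₚ.length-++ (run 1ℤ (odd e)))
      (cong₂ ℕ._+_ (length-run 1ℤ (odd e)) (trans (Listₚ.length-++ (run (1ℤ + + P) (odd h))) (cong (ℕ._+ length os) (length-run _ (odd h))))))))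
  result : Full P xs ⊎ Reach P (twice p) xs 0ℤ → Reach P (twice p) xs 0ℤ ⊎ SingleOutlier P xs
  result (inj₂ r)    = inj₁ r
  result (inj₁ full) with all-sparse-or-reach P (twice p) xs 0ℤ (s≤s z≤n) (crowded full)
  ... | inj₂ r      = inj₁ r
  ... | inj₁ sparse with z , z∈ , max ← most-frequent′ P xs (subst (1 ≤_) (sym len) (s≤s z≤n)) with p ℕ.≤? #class P z xs
  ...   | yes p≤ = concentrated p′ xs len full sparse z∈ max p≤
  ...   | no p≰  = inj₁ (dispersed p′ xs len full sparse z∈ max (ℕₚ.≰⇒> p≰))

-- Even length with both parities present

-- A value correct modulo `Q` misses the target by an even or an odd multiple of `Q`; in the odd
-- case the exchange supplies one more `Q`.
toggle : ∀ Q {w w′ x y s T vs rs} → (w′ - w) * (x - y) ≡ + Q mod Q ℕ.* 2 → Reach 0 vs rs s →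
         w * x + (w′ * y + s) ≡ T mod Q → Reach (Q ℕ.* 2) (w ∷ w′ ∷ vs) (x ∷ y ∷ rs) T
toggle Q {w} {w′} {x} {y} {s} {T} half r (q because eq) with mod-two q
... | inj₁ (e because q≡) = reach-mod (e because trans eq (trans (cong (λ q → T + q * + Q) q≡) (trans (lem T e (+ Q)) (cong (λ n → T + e * n) (sym (ℤₚ.pos-* Q 2))))))
        (reach-∷ w x (reach-∷ w′ y (reach-reduce r)))
  where
  lem : ∀ T e Q → T + (0ℤ + e * + 2) * Q ≡ T + e * (Q * + 2)
  lem = solve-∀
... | inj₂ (e because q≡) = reach-↭ ↭-refl (swap y x ↭-refl) (reach-mod
        (mod-trans (≡⇒mod (lem₁ w w′ x y s)) (mod-trans (mod-+ˡ (w * x + (w′ * y + s)) half)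
          (1ℤ + e because trans (cong (_+ + Q) (trans eq (cong (λ q → T + q * + Q) q≡))) (trans (lem₂ T e (+ Q)) (cong (λ n → T + (1ℤ + e) * n) (sym (ℤₚ.pos-* Q 2)))))))
        (reach-∷ w y (reach-∷ w′ x (reach-reduce r))))
  where
  lem₁ : ∀ w w′ x y s → w * y + (w′ * x + s) ≡ w * x + (w′ * y + s) + (w′ - w) * (x - y)
  lem₁ = solve-∀
  lem₂ : ∀ T e Q → T + (1ℤ + e * + 2) * Q + Q ≡ T + (1ℤ + e) * (Q * + 2)
  lem₂ = solve-∀

odd-difference : ∀ {x y} → ¬ x ≡ y mod 2 → x - y ≡ 1ℤ mod 2
odd-difference {x} {y} x≢y with mod-two (x - y)
... | inj₁ e = contradiction (mod-cancel-- e) x≢y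
... | inj₂ e = e

mod⇒∣ : ∀ {h a} → + a ≡ 0ℤ mod h → h ∣ a
mod⇒∣ (q because e) = Signed.∣⇒∣ᵤ (Signed.divides q (trans e (ℤₚ.+-identityˡ _)))

half-period : ∀ Q w {x y} → ¬ x ≡ y mod 2 → ((w + + Q) - w) * (x - y) ≡ + Q mod Q ℕ.* 2
half-period Q w {x} {y} x≢y = mod-trans (≡⇒mod (lem₁ w (+ Q) (x - y)))
  (mod-trans (mod-scale {h = Q} (odd-difference x≢y)) (≡⇒mod (ℤₚ.*-identityʳ (+ Q))))
  where
  lem₁ : ∀ w Q d → ((w + Q) - w) * d ≡ Q * d
  lem₁ = solve-∀

period₁ period₂ : ℕ → ℤ
period₁ p = + suc p
period₂ p = period₁ p + + suc p

all-weights : ∀ p → run 1ℤ (suc p ℕ.+ suc p) ↭ period₁ p ∷ period₂ p ∷ twice p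
all-weights p = ↭-trans (↭-reflexive (run-++ 1ℤ (suc p) (suc p))) (↭-trans (↭ₚ.++⁺ (last 1ℤ) (last (1ℤ + + suc p)))
  (prep (period₁ p) (↭-trans (↭-reflexive (cong (λ b → run 1ℤ p ++ b ∷ run (1ℤ + + suc p) p) (lem (+ p))))
    (↭ₚ.shift (period₂ p) (run 1ℤ p) (run (1ℤ + + suc p) p)))))
  where
  last : ∀ a → run a (suc p) ↭ a + + p ∷ run a p
  last a = ↭-trans (↭-reflexive (trans (cong (run a) (ℕₚ.+-comm 1 p)) (run-++ a p 1))) (↭ₚ.++-comm (run a p) _)
  lem : ∀ p → 1ℤ + (1ℤ + p) + p ≡ 1ℤ + p + (1ℤ + p)
  lem = solve-∀

period≡0 : ∀ p → period₁ p ≡ 0ℤ mod suc p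
period≡0 p = 1ℤ because lem (+ suc p)
  where
  lem : ∀ P → P ≡ 0ℤ + 1ℤ * P
  lem = solve-∀

period₂≡0 : ∀ p → period₂ p ≡ 0ℤ mod suc p
period₂≡0 p = mod-trans (mod-+ (period≡0 p) (period≡0 p)) mod-refl

mixed-reach : ∀ p {x y xs rs T} → xs ↭ x ∷ y ∷ rs → ¬ x ≡ y mod 2 → Reach (suc p) (twice p) rs 0ℤ →
              T ≡ 0ℤ mod suc p → Reach (suc p ℕ.* 2) (run 1ℤ (suc p ℕ.+ suc p)) xs T
mixed-reach p {x} {y} xs↭ x≢y r T≡0 with s , r′ , s≡0 ← reach-exact r =
  reach-↭ (↭-sym (all-weights p)) (↭-sym xs↭) (toggle (suc p) {w = period₁ p} {x = x} {y = y} (half-period (suc p) (period₁ p) x≢y) r′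
    (mod-trans (mod-+ (mod-* (period≡0 p) (mod-refl {a = x})) (mod-+ (mod-* (period₂≡0 p) (mod-refl {a = y})) s≡0)) (mod-sym T≡0)))

twice-constant : ∀ p {z} zs → length zs ≡ p ℕ.+ p → All (λ x → x ≡ z mod suc p) zs → Reach (suc p) (twice p) zs 0ℤ
twice-constant p {z} zs len zs≡z = reach-mod (mod-trans (mod-*ˡ z (sum-twice≡0 p)) (≡⇒mod (ℤₚ.*-zeroʳ z)))
  (reach-constant (twice p) zs (trans (length-twice p) (sym len)) zs≡z)

mod-double : ∀ {Q a b} → a ≡ b mod Q → a ≡ b mod Q ℕ.* 2 ⊎ a ≡ b + + Q mod Q ℕ.* 2
mod-double {Q} {a} {b} (q because eq) with mod-two q
... | inj₁ (e because q≡) = inj₁ (e because trans eq (trans (cong (λ q → b + q * + Q) q≡)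
        (trans (lem b e (+ Q)) (cong (λ n → b + e * n) (sym (ℤₚ.pos-* Q 2))))))
  where
  lem : ∀ b e Q → b + (0ℤ + e * + 2) * Q ≡ b + e * (Q * + 2)
  lem = solve-∀
... | inj₂ (e because q≡) = inj₂ (e because trans eq (trans (cong (λ q → b + q * + Q) q≡)
        (trans (lem b e (+ Q)) (cong (λ n → b + + Q + e * n) (sym (ℤₚ.pos-* Q 2))))))
  where
  lem : ∀ b e Q → b + (1ℤ + e * + 2) * Q ≡ b + Q + e * (Q * + 2)
  lem = solve-∀

period≡period : ∀ {Q} → + Q ≡ - + Q mod Q ℕ.* 2
period≡period {Q} = 1ℤ because trans (lem (+ Q)) (cong (λ n → - + Q + 1ℤ * n) (sym (ℤₚ.pos-* Q 2)))
  where
  lem : ∀ Q → Q ≡ - Q + 1ℤ * (Q * + 2)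
  lem = solve-∀

even-* : ∀ {Q a} → a ≡ 0ℤ mod 2 → + Q * a ≡ 0ℤ mod Q ℕ.* 2
even-* {Q} e = mod-trans (mod-scale {h = Q} e) (≡⇒mod (ℤₚ.*-zeroʳ (+ Q)))

opposite-parity : ∀ {a b} → ¬ a ≡ b mod 2 → a ≡ 1ℤ mod 2 → b ≡ 0ℤ mod 2
opposite-parity {a} {b} a≢b a≡1 with mod-two b
... | inj₁ b≡0 = b≡0
... | inj₂ b≡1 = contradiction (mod-trans a≡1 (mod-sym b≡1)) a≢b

opposite-parity′ : ∀ {a b} → ¬ a ≡ b mod 2 → a ≡ 0ℤ mod 2 → b ≡ 1ℤ mod 2
opposite-parity′ {a} {b} a≢b a≡0 with mod-two b
... | inj₁ b≡0 = contradiction (mod-trans a≡0 (mod-sym b≡0)) a≢b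
... | inj₂ b≡1 = b≡1

-- A fibre is a pair of weights with the same nonzero residue modulo `P`, one from each block. They
-- differ by `P`, as a parity exchange requires.
fibre-pick : ∀ p i → i < p → ∃ λ us → ∃ λ vs → run 1ℤ p ↭ 1ℤ + + i ∷ us × run (1ℤ + + suc p) p ↭ 1ℤ + + i + + suc p ∷ vs
fibre-pick p i i<p with us , us↭ ← run-pick 1ℤ p i i<p | vs , vs↭ ← run-pick (1ℤ + + suc p) p i i<p =
  us , vs , us↭ , ↭-trans vs↭ (↭-reflexive (cong (_∷ vs) (lem (+ suc p) (+ i))))
  where
  lem : ∀ P i → 1ℤ + P + i ≡ 1ℤ + i + P
  lem = solve-∀

fibre-weights : ∀ p {i us vs} → run 1ℤ p ↭ 1ℤ + + i ∷ us → run (1ℤ + + suc p) p ↭ 1ℤ + + i + + suc p ∷ vs →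
                run 1ℤ (suc p ℕ.+ suc p) ↭ 1ℤ + + i ∷ 1ℤ + + i + + suc p ∷ us ++ period₁ p ∷ period₂ p ∷ vs
fibre-weights p {i} {us} {vs} us↭ vs↭ = ↭-trans (all-weights p) (↭-trans
  (prep (period₁ p) (prep (period₂ p) (↭-trans (↭ₚ.++⁺ us↭ vs↭) (prep u (↭ₚ.shift u′ us vs)))))
  (↭-trans (↭ₚ.shifts (period₁ p ∷ period₂ p ∷ []) (u ∷ u′ ∷ us)) ↭-refl))
  where
  u = 1ℤ + + i
  u′ = u + + suc p

-- The multiset {a, ..., a, a + b, a - b} of the theorem, with a = z, a + b = w and a - b = y.
record Exceptional (m : ℕ) (xs : List ℤ) : Set where
  field
    {z w y} : ℤ
    {zs}    : List ℤ
    xs↭     : xs ↭ w ∷ y ∷ zs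
    zs≡z    : All (λ x → x ≡ z mod m) zs
    even    : z ≡ 0ℤ mod 2
    unit    : Unit m (w - z)
    w+y≡2z  : w + y ≡ z + z mod m

all-constant : ∀ n {z} → (zs : List ℤ) → All (λ x → x ≡ z mod n) zs → ∀ ws → length ws ≡ length zs →
               ∃ λ s → Reach 0 ws zs s × s ≡ z * sum ws mod n
all-constant n zs zs≡z ws len = reach-exact (reach-constant ws zs len zs≡z)

-- Two outliers whose parity is opposite to that of all other numbers.

module _ (p : ℕ) {xs : List ℤ} {c w y : ℤ} {zs : List ℤ} (xs↭ : xs ↭ w ∷ y ∷ c ∷ zs)
         (len : length xs ≡ suc p ℕ.+ suc p)
         (zs≡c : All (λ x → x ≡ c mod suc p) zs) (parity : All (λ x → x ≡ c mod 2) zs)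
         (w≢₂c : ¬ w ≡ c mod 2) (y≢₂c : ¬ y ≡ c mod 2)
         (w≢c : ¬ w ≡ c mod suc p) (y≢c : ¬ y ≡ c mod suc p) where

  private
    P = suc p
    N = P ℕ.* 2
    W = run 1ℤ (P ℕ.+ P)
    d = w - c
    f = y - c

  len-zs : suc (length zs) ≡ p ℕ.+ p
  len-zs = ℕₚ.suc-injective (ℕₚ.suc-injective (trans (sym (↭ₚ.↭-length xs↭)) (trans len (cong suc (ℕₚ.+-suc p p)))))

  W-sum : sum W ≡ period₁ p + (period₂ p + sum (twice p))
  W-sum = sum-↭ (all-weights p)

  W-sum≡0 : sum W ≡ 0ℤ mod P
  W-sum≡0 = mod-trans (≡⇒mod W-sum) (mod-+ (period≡0 p) (mod-+ (period₂≡0 p) (sum-twice≡0 p)))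

  len-W : ∀ {u v a ws} → W ↭ u ∷ v ∷ a ∷ ws → length ws ≡ length zs
  len-W W↭ = ℕₚ.suc-injective (ℕₚ.suc-injective (ℕₚ.suc-injective (trans (sym (↭ₚ.↭-length W↭))
    (trans (length-run 1ℤ (P ℕ.+ P)) (trans (sym len) (↭ₚ.↭-length xs↭))))))

  -- w and c exchange weights that differ by P.
  separate-fibres : ∀ {u v ws} → W ↭ u ∷ u + + P ∷ v ∷ ws → u * d + v * f ≡ 0ℤ mod P → Reach N W xs 0ℤ
  separate-fibres {u} {v} {ws} W↭ solves with s , r , s≡ ← all-constant P zs zs≡c ws (len-W W↭) =
    reach-↭ (↭-sym W↭) (↭-sym (↭-trans xs↭ (prep w (swap y c ↭-refl)))) (toggle P {w = u} {x = w} {y = c}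
      (half-period P u w≢₂c) (reach-∷ v y r) total≡0)
    where
    total≡0 : u * w + ((u + + P) * c + (v * y + s)) ≡ 0ℤ mod P
    total≡0 = mod-trans (mod-+ˡ (u * w) (mod-+ˡ ((u + + P) * c) (mod-+ˡ (v * y) s≡)))
      (mod-trans (≡⇒mod (trans (lem₁ u v w y c (+ P) (sum ws)) (cong (λ t → u * d + v * f + c * t) (sym (sum-↭ W↭)))))
        (mod-trans (mod-+ solves (mod-*ˡ c W-sum≡0)) (≡⇒mod (lem₂ c))))
      where
      lem₁ : ∀ u v w y c P t → u * w + ((u + P) * c + (v * y + c * t)) ≡
             u * (w - c) + v * (y - c) + c * (u + (u + P + (v + t)))
      lem₁ = solve-∀
      lem₂ : ∀ c → 0ℤ + c * 0ℤ ≡ 0ℤ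
      lem₂ = solve-∀

  -- The weights `u ≡ f` for `w` and `v ≡ - d` for `y` solve `u * d + v * f ≡ 0`. As `d + f` is
  -- nonzero they lie in different fibres, so the partner of `u` is free for `c`.
  distinct-fibres : ¬ d + f ≡ 0ℤ mod P → Reach N W xs 0ℤ
  distinct-fibres d+f≢0 = by-residue (f ℤ.%ℕ P) refl (ℤ.n%ℕd<d f P)
    where
    by-residue : ∀ r → f ℤ.%ℕ P ≡ r → r < P → Reach N W xs 0ℤ
    by-residue zero    f% _         = contradiction (mod-cancel-- (mod-trans (mod-%ℕ f P) (≡⇒mod (cong +_ f%)))) y≢c
    by-residue (suc i) f% (s≤s i<p) = by-fibre (fibre-pick p i i<p)
      where
      f≡ : f ≡ 1ℤ + + i mod P
      f≡ = mod-trans (mod-%ℕ f P) (≡⇒mod (cong +_ f%))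
      -d≢0 : ¬ - d ≡ 0ℤ mod P
      -d≢0 e = w≢c (mod-cancel-- (mod-trans (≡⇒mod (sym (ℤₚ.neg-involutive d))) (mod-neg e)))
      by-fibre : (∃ λ us → ∃ λ vs → run 1ℤ p ↭ 1ℤ + + i ∷ us × run (1ℤ + + suc p) p ↭ 1ℤ + + i + + suc p ∷ vs) → Reach N W xs 0ℤ
      by-fibre (us , vs , us↭ , vs↭) = by-second (residue-pick p 1ℤ (- d) -d≢0 mod-refl)
        where
        by-second : (∃₂ λ v ws → run 1ℤ p ↭ v ∷ ws × v ≡ - d mod P) → Reach N W xs 0ℤ
        by-second (v , ws , v↭ , v≡) with ↭ₚ.∈-resp-↭ us↭ (↭ₚ.∈-resp-↭ (↭-sym v↭) (here refl))
        ... | here refl = contradiction (mod-trans (mod-+ˡ d (mod-trans f≡ v≡)) (≡⇒mod (ℤₚ.+-inverseʳ d))) d+f≢0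
        ... | there v∈us with us′ , us↭′ ← ∈⇒↭ v∈us =
          separate-fibres (↭-trans (fibre-weights p us↭ vs↭) (prep _ (prep _ (↭ₚ.++⁺ʳ _ us↭′))))
            (mod-trans (mod-+ (mod-*ʳ d (mod-sym f≡)) (mod-*ʳ f v≡)) (≡⇒mod (lem d f)))
          where
          lem : ∀ d f → f * d + - d * f ≡ 0ℤ
          lem = solve-∀

  -- With `P = e * g`, the weight `e` annihilates `d` modulo `P`, and `y` goes to the weight `P`.
  non-unit : ∀ {g} → 2 ≤ g → g ∣ P → d ≡ 0ℤ mod g → Reach N W xs 0ℤ
  non-unit {g} 2≤g (divides zero    ()) d≡0
  non-unit {g} 2≤g (divides (suc i) P≡eg) (q because d≡) = by-fibre (fibre-pick p i i<p)
    where
    i<p : i < p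
    i<p = ℕₚ.≤-pred (ℕₚ.<-≤-trans (ℕₚ.m<m*n (suc i) g 2≤g) (ℕₚ.≤-reflexive (sym P≡eg)))
    by-fibre : (∃ λ us → ∃ λ vs → run 1ℤ p ↭ 1ℤ + + i ∷ us × run (1ℤ + + suc p) p ↭ 1ℤ + + i + + suc p ∷ vs) → Reach N W xs 0ℤ
    by-fibre (us , vs , us↭ , vs↭) = separate-fibres
      (↭-trans (fibre-weights p us↭ vs↭) (prep _ (prep _ (↭ₚ.shift (period₁ p) us (period₂ p ∷ vs)))))
      (mod-trans (mod-+ {a = + suc i * d} {b = 0ℤ} ed≡0 (mod-*ʳ f (period≡0 p))) (≡⇒mod (lem f)))
      where
      lem : ∀ f → 0ℤ + 0ℤ * f ≡ 0ℤ
      lem = solve-∀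
      ed≡0 : + suc i * d ≡ 0ℤ mod P
      ed≡0 = q because trans (cong (+ suc i *_) d≡) (trans (lem′ (+ suc i) q (+ g))
        (cong (λ n → 0ℤ + q * n) (trans (sym (ℤₚ.pos-* (suc i) g)) (cong +_ (sym P≡eg)))))
        where
        lem′ : ∀ e q g → e * (0ℤ + q * g) ≡ 0ℤ + q * (e * g)
        lem′ = solve-∀

  twice-periods : sum (twice p) ≡ 0ℤ mod N
  twice-periods = + p because trans (sum-twice p) (trans (lem (+ p) (+ P)) (cong (λ n → 0ℤ + + p * n) (sym (ℤₚ.pos-* P 2))))
    where
    lem : ∀ p P → (p + p) * P ≡ 0ℤ + p * (P * + 2)
    lem = solve-∀

  period₂-even : period₂ p ≡ 0ℤ mod N
  period₂-even = 1ℤ because trans (lem (+ P)) (cong (λ n → 0ℤ + 1ℤ * n) (sym (ℤₚ.pos-* P 2)))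
    where
    lem : ∀ P → P + P ≡ 0ℤ + 1ℤ * (P * + 2)
    lem = solve-∀

  -- `w` goes to `P` and `y` to `2P`: for even `w` the product `P * w` vanishes modulo `2P`.
  equal-even : All (λ x → x ≡ c mod N) zs → w ≡ 0ℤ mod 2 → Reach N W xs 0ℤ
  equal-even zs≡ w≡0 = reach-↭ (↭-sym (all-weights p)) (↭-sym xs↭) (reach-mod total≡0
    (reach-∷ (period₁ p) w (reach-∷ (period₂ p) y (reach-constant (twice p) (c ∷ zs) (trans (length-twice p) (sym len-zs)) (mod-refl ∷ zs≡)))))
    where
    total≡0 : period₁ p * w + (period₂ p * y + c * sum (twice p)) ≡ 0ℤ mod N
    total≡0 = mod-trans (mod-+ (even-* {P} w≡0) (mod-+ (mod-*ʳ y period₂-even) (mod-*ˡ c twice-periods))) (≡⇒mod (lem y c))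
      where
      lem : ∀ y c → 0ℤ + (0ℤ * y + c * 0ℤ) ≡ 0ℤ
      lem = solve-∀

  -- With `w` at 1 and `y` at `1 + P`, the sum is `d + f + P * y` up to multiples of `2P`; both
  -- `d + f` and `P * y` are congruent to `P`.
  equal-shifted : 1 ≤ p → All (λ x → x ≡ c mod N) zs → y ≡ 1ℤ mod 2 → d + f ≡ + P mod N → Reach N W xs 0ℤ
  equal-shifted 1≤p zs≡ y≡1 d+f≡P with us , vs , us↭ , vs↭ ← fibre-pick p 0 1≤p =
    reach-↭ (↭-sym W↭) (↭-sym xs↭) (reach-mod total≡0
      (reach-∷ u w (reach-∷ (u + + P) y (reach-constant ws (c ∷ zs) len-ws (mod-refl ∷ zs≡)))))
    where
    u = 1ℤ + 0ℤ
    ws = us ++ period₁ p ∷ period₂ p ∷ vs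
    W↭ : W ↭ u ∷ u + + P ∷ ws
    W↭ = fibre-weights p us↭ vs↭
    len-ws : length ws ≡ suc (length zs)
    len-ws = ℕₚ.suc-injective (ℕₚ.suc-injective (trans (sym (↭ₚ.↭-length W↭)) (trans (length-run 1ℤ (P ℕ.+ P)) (trans (sym len) (↭ₚ.↭-length xs↭)))))
    sums : sum ws ≡ sum (twice p) + + 3 * + P - u - (u + + P)
    sums = trans (lem₁ u (+ P) (sum ws)) (trans (cong (λ s → s - u - (u + + P)) (trans (sym (sum-↭ W↭)) W-sum)) (lem₂ (+ P) (sum (twice p)) u))
      where
      lem₁ : ∀ u P s → s ≡ (u + (u + P + s)) - u - (u + P)
      lem₁ = solve-∀
      lem₂ : ∀ P t u → (P + (P + P + t)) - u - (u + P) ≡ t + + 3 * P - u - (u + P)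
      lem₂ = solve-∀
    total≡0 : u * w + ((u + + P) * y + c * sum ws) ≡ 0ℤ mod N
    total≡0 = mod-trans (≡⇒mod (trans (cong (λ s → u * w + ((u + + P) * y + c * s)) sums) (lem₁ w y c (+ P) (sum (twice p)))))
      (mod-trans (mod-+ (mod-+ (mod-+ d+f≡P (mod-trans (mod-scale {h = P} y≡1) (≡⇒mod (ℤₚ.*-identityʳ (+ P))))) (mod-*ˡ c twice-periods)) (mod-*ˡ c period₂-even))
        (mod-trans (mod-+ʳ (c * 0ℤ) (mod-+ʳ (c * 0ℤ) period₂-even)) (≡⇒mod (lem₂ c))))
      where
      lem₁ : ∀ w y c P t → (1ℤ + 0ℤ) * w + ((1ℤ + 0ℤ + P) * y + c * (t + + 3 * P - (1ℤ + 0ℤ) - (1ℤ + 0ℤ + P))) ≡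
             (w - c) + (y - c) + P * y + c * t + c * (P + P)
      lem₁ = solve-∀
      lem₂ : ∀ c → 0ℤ + c * 0ℤ + c * 0ℤ ≡ 0ℤ
      lem₂ = solve-∀

  -- Since `j * d ≡ 1` modulo `P`, a common divisor of `d` and `2P` divides 2, while `d` is odd.
  unit-double : Generates P d 1 → Unit N d
  unit-double (j , jd≡1) {h} h∣N 1<h d≡0 =
    w≢₂c (mod-cancel-- (subst (λ n → d ≡ 0ℤ mod n) (ℕₚ.≤-antisym (∣⇒≤ (mod⇒∣ 2≡0)) 1<h) d≡0))
    where
    2≡0 : + 2 ≡ 0ℤ mod h
    2≡0 = mod-trans (mod-∣ (subst (h ∣_) (ℕₚ.*-comm P 2) h∣N) (mod-sym (mod-scale {h = 2} jd≡1)))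
      (mod-trans (mod-*ˡ (+ 2) (mod-*ˡ j d≡0)) (≡⇒mod (lem j)))
      where
      lem : ∀ j → + 2 * (j * 0ℤ) ≡ 0ℤ
      lem = solve-∀

  -- After the two explicit placements there remains `c` even, `w` and `y` odd, and `d + f` zero
  -- modulo `2P`: the exceptional multiset with `b = d`.
  all-equal : 1 ≤ p → d + f ≡ 0ℤ mod P → Generates P d 1 → All (λ x → x ≡ c mod N) zs →
              Reach N W xs 0ℤ ⊎ Exceptional N xs
  all-equal 1≤p d+f≡0 gen zs≡ with mod-two w
  ... | inj₁ w≡0 = inj₁ (equal-even zs≡ w≡0)
  ... | inj₂ w≡1 with opposite-parity w≢₂c w≡1 | mod-double d+f≡0
  ...   | c≡0 | inj₂ d+f≡P = inj₁ (equal-shifted 1≤p zs≡ (opposite-parity′ (λ e → y≢₂c (mod-sym e)) c≡0) (mod-trans d+f≡P (≡⇒mod (ℤₚ.+-identityˡ (+ P)))))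
  ...   | c≡0 | inj₁ d+f≡0′ = inj₂ record
    { xs↭ = xs↭ ; zs≡z = mod-refl ∷ zs≡ ; even = c≡0 ; unit = unit-double gen
    ; w+y≡2z = mod-trans (≡⇒mod (lem w y c)) (mod-trans (mod-+ˡ (c + c) d+f≡0′) (≡⇒mod (ℤₚ.+-identityʳ (c + c)))) }
    where
    lem : ∀ w y c → w + y ≡ c + c + (w - c + (y - c))
    lem = solve-∀

  -- `z₁` is `c + P` modulo `2P`, so exchanging it with `c` at the weights 1 and 2 shifts the sum by
  -- `P`, and the outliers can go to `P` and `2P`. The weight 2 must differ from `P`, hence `p ≥ 2`.
  unequal : ∀ {q z₁} → p ≡ 2 ℕ.+ q → z₁ ∈ zs → ¬ z₁ ≡ c mod N → d + f ≡ 0ℤ mod P → Reach N W xs 0ℤ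
  unequal {q} {z₁} p≡ z₁∈ z₁≢c d+f≡0 with mod-double (All.lookup zs≡c z₁∈)
  ... | inj₁ e = contradiction e z₁≢c
  ... | inj₂ z₁≡c+P = by-removal (∈⇒↭ z₁∈)
    where
    rest = run (1ℤ + 1ℤ + 1ℤ) q ++ run (1ℤ + + suc p) p
    twice≡ : twice p ≡ 1ℤ ∷ 1ℤ + 1ℤ ∷ rest
    twice≡ = cong (λ n → run 1ℤ n ++ run (1ℤ + + suc p) p) p≡
    W↭ : W ↭ 1ℤ ∷ 1ℤ + 1ℤ ∷ period₁ p ∷ period₂ p ∷ rest
    W↭ = ↭-trans (all-weights p) (↭-trans (↭-reflexive (cong (λ l → period₁ p ∷ period₂ p ∷ l) twice≡))
      (↭ₚ.shifts (period₁ p ∷ period₂ p ∷ []) (1ℤ ∷ 1ℤ + 1ℤ ∷ [])))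
    half : ((1ℤ + 1ℤ) - 1ℤ) * (c - z₁) ≡ + P mod N
    half = mod-trans (≡⇒mod (ℤₚ.*-identityˡ (c - z₁))) (mod-trans (mod-- (mod-refl {a = c}) z₁≡c+P)
      (mod-trans (≡⇒mod (lem c (+ P))) (mod-sym period≡period)))
      where
      lem : ∀ c P → c - (c + P) ≡ - P
      lem = solve-∀
    by-removal : (∃ λ zs′ → zs ↭ z₁ ∷ zs′) → Reach N W xs 0ℤ
    by-removal (zs′ , zs↭) with z₁≡c ∷ zs′≡c ← ↭ₚ.All-resp-↭ zs↭ zs≡c = by-rest (all-constant P zs′ zs′≡c rest len-rest)
      where
      xs↭′ : xs ↭ c ∷ z₁ ∷ w ∷ y ∷ zs′
      xs↭′ = ↭-trans xs↭ (↭-trans (↭ₚ.shifts (w ∷ y ∷ []) (c ∷ [])) (prep c (↭-trans (prep w (prep y zs↭)) (↭ₚ.shifts (w ∷ y ∷ []) (z₁ ∷ [])))))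
      len-rest : length rest ≡ length zs′
      len-rest = ℕₚ.suc-injective (trans (len-W W↭) (↭ₚ.↭-length zs↭))
      by-rest : (∃ λ s → Reach 0 rest zs′ s × s ≡ c * sum rest mod P) → Reach N W xs 0ℤ
      by-rest (s , r , s≡) = reach-↭ (↭-sym W↭) (↭-sym xs↭′) (toggle P {w = 1ℤ} {w′ = 1ℤ + 1ℤ} {x = c} {y = z₁} half
        (reach-∷ (period₁ p) w (reach-∷ (period₂ p) y r)) total≡0)
        where
        total≡0 : 1ℤ * c + ((1ℤ + 1ℤ) * z₁ + (period₁ p * w + (period₂ p * y + s))) ≡ 0ℤ mod P
        total≡0 = mod-trans (mod-+ˡ (1ℤ * c) (mod-+ (mod-*ˡ (1ℤ + 1ℤ) z₁≡c)
            (mod-+ (mod-*ʳ w (period≡0 p)) (mod-+ (mod-*ʳ y (period₂≡0 p)) s≡))))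
          (mod-trans (≡⇒mod (trans (lem₁ c w y (sum rest)) (cong (λ l → c * sum l) (sym twice≡))))
            (mod-trans (mod-*ˡ c (sum-twice≡0 p)) (≡⇒mod (ℤₚ.*-zeroʳ c))))
          where
          lem₁ : ∀ c w y s → 1ℤ * c + ((1ℤ + 1ℤ) * c + (0ℤ * w + (0ℤ * y + c * s))) ≡ c * (1ℤ + (1ℤ + 1ℤ + s))
          lem₁ = solve-∀

-- The modulus 4, where the weight 2 is itself the half period.

module _ {w y c z₁ : ℤ} (w≢₂c : ¬ w ≡ c mod 2) (y≢₂c : ¬ y ≡ c mod 2) (z₁≡ : z₁ ≡ c + + 2 mod 4) where

  four-odd : w ≡ 1ℤ mod 2 → Reach 4 (run 1ℤ 4) (w ∷ y ∷ c ∷ z₁ ∷ []) 0ℤ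
  four-odd w≡1 = reach-↭ (↭-trans (↭ₚ.shifts (+ 2 ∷ + 4 ∷ []) (+ 1 ∷ [])) (prep (+ 1) (prep (+ 2) (swap (+ 4) (+ 3) ↭-refl)))) ↭-refl (reach-mod total≡0
    (reach-∷ (+ 2) w (reach-∷ (+ 4) y (reach-∷ (+ 1) c (reach-∷ (+ 3) z₁ reach-[])))))
    where
    total≡0 : + 2 * w + (+ 4 * y + (+ 1 * c + (+ 3 * z₁ + 0ℤ))) ≡ 0ℤ mod 4
    total≡0 = mod-trans (mod-+ (mod-scale {h = 2} w≡1) (mod-+ˡ (+ 4 * y) (mod-+ˡ (+ 1 * c) (mod-+ʳ 0ℤ (mod-*ˡ (+ 3) z₁≡)))))
      (y + c + + 2 because lem y c)
      where
      lem : ∀ y c → + 2 * 1ℤ + (+ 4 * y + (+ 1 * c + (+ 3 * (c + + 2) + 0ℤ))) ≡ 0ℤ + (y + c + + 2) * + 4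
      lem = solve-∀

  four-even : w ≡ y + + 2 mod 4 → c ≡ 1ℤ mod 2 → Reach 4 (run 1ℤ 4) (w ∷ y ∷ c ∷ z₁ ∷ []) 0ℤ
  four-even w≡y+2 c≡1 = reach-↭ (prep (+ 1) (swap (+ 3) (+ 2) ↭-refl)) ↭-refl (reach-mod total≡0
    (reach-∷ (+ 1) w (reach-∷ (+ 3) y (reach-∷ (+ 2) c (reach-∷ (+ 4) z₁ reach-[])))))
    where
    total≡0 : + 1 * w + (+ 3 * y + (+ 2 * c + (+ 4 * z₁ + 0ℤ))) ≡ 0ℤ mod 4
    total≡0 = mod-trans (mod-+ (mod-*ˡ (+ 1) w≡y+2) (mod-+ˡ (+ 3 * y) (mod-+ʳ (+ 4 * z₁ + 0ℤ) (mod-scale {h = 2} c≡1))))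
      (y + 1ℤ + z₁ because lem y z₁)
      where
      lem : ∀ y z → + 1 * (y + + 2) + (+ 3 * y + (+ 2 * 1ℤ + (+ 4 * z + 0ℤ))) ≡ 0ℤ + (y + 1ℤ + z) * + 4
      lem = solve-∀

  -- The roles are reversed: the even value `w`, present twice, is the repeated one, and `c` and
  -- `c + 2` are `w + b` and `w - b` with `b` odd.
  four-exceptional : w ≡ y mod 4 → w ≡ 0ℤ mod 2 → c ≡ 1ℤ mod 2 → Exceptional 4 (w ∷ y ∷ c ∷ z₁ ∷ [])
  four-exceptional w≡y w≡0 c≡1 = record
    { z = w ; w = c ; y = z₁ ; zs = w ∷ y ∷ [] ; xs↭ = ↭ₚ.shifts (w ∷ y ∷ []) (c ∷ z₁ ∷ [])
    ; zs≡z = mod-refl ∷ mod-sym w≡y ∷ [] ; even = w≡0 ; unit = unit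
    ; w+y≡2z = mod-trans (mod-+ˡ c z₁≡) (mod-trans (≡⇒mod (lem₁ c)) (mod-trans (mod-+ʳ (+ 2) (mod-scale {h = 2} c≡1))
        (mod-trans (1ℤ because refl) (mod-trans (mod-scale {h = 2} (mod-sym w≡0)) (≡⇒mod (lem₂ w)))))) }
    where
    lem₁ : ∀ c → c + (c + + 2) ≡ + 2 * c + + 2
    lem₁ = solve-∀
    lem₂ : ∀ w → + 2 * w ≡ w + w
    lem₂ = solve-∀
    odd-unit : ¬ c - w ≡ 0ℤ mod 2
    odd-unit e = w≢₂c (mod-sym (mod-cancel-- e))
    unit : Unit 4 (c - w)
    unit {1} _ (s≤s ()) _
    unit {2} _ _ e = odd-unit e
    unit {3} 3∣4 _ _ = contradiction 3∣4 (toWitnessFalse {a? = 3 ∣? 4} _)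
    unit {4} _ _ e = odd-unit (mod-∣ (divides 2 refl) e)
    unit {suc (suc (suc (suc (suc h))))} h∣4 _ _ = contradiction (∣⇒≤ h∣4) λ { (s≤s (s≤s (s≤s (s≤s ())))) }

  four : Reach 4 (run 1ℤ 4) (w ∷ y ∷ c ∷ z₁ ∷ []) 0ℤ ⊎ Exceptional 4 (w ∷ y ∷ c ∷ z₁ ∷ [])
  four with mod-two w
  ... | inj₂ w≡1 = inj₁ (four-odd w≡1)
  ... | inj₁ w≡0 = by-parity (opposite-parity′ w≢₂c w≡0)
    where
    by-parity : c ≡ 1ℤ mod 2 → Reach 4 (run 1ℤ 4) (w ∷ y ∷ c ∷ z₁ ∷ []) 0ℤ ⊎ Exceptional 4 (w ∷ y ∷ c ∷ z₁ ∷ [])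
    by-parity c≡1 with mod-double {2} (mod-trans w≡0 (mod-sym (opposite-parity (λ e → y≢₂c (mod-sym e)) c≡1)))
    ... | inj₁ w≡y   = inj₂ (four-exceptional w≡y w≡0 c≡1)
    ... | inj₂ w≡y+2 = inj₁ (four-even w≡y+2 c≡1)

exceptional-↭ : ∀ {n xs ys} → xs ↭ ys → Exceptional n ys → Exceptional n xs
exceptional-↭ p e = record { xs↭ = ↭-trans p xs↭ ; zs≡z = zs≡z ; even = even ; unit = unit ; w+y≡2z = w+y≡2z }
  where open Exceptional e

four-numbers : ∀ {xs c w y z₁ zs} → xs ↭ w ∷ y ∷ c ∷ zs → suc (length zs) ≡ 2 → All (λ x → x ≡ c mod 2) zs →
               z₁ ∈ zs → ¬ z₁ ≡ c mod 4 → ¬ w ≡ c mod 2 → ¬ y ≡ c mod 2 →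
               Reach 4 (run 1ℤ 4) xs 0ℤ ⊎ Exceptional 4 xs
four-numbers {y = y} {zs = z ∷ []} xs↭ _ (z≡c ∷ []) (here refl) z≢c w≢₂c y≢₂c with mod-double {2} z≡c
... | inj₁ e  = contradiction e z≢c
... | inj₂ z≡ with four {y = y} w≢₂c y≢₂c z≡
...   | inj₁ r = inj₁ (reach-↭ ↭-refl (↭-sym xs↭) r)
...   | inj₂ e = inj₂ (exceptional-↭ xs↭ e)

unequal-numbers : ∀ p {xs c w y zs z₁} → xs ↭ w ∷ y ∷ c ∷ zs → length xs ≡ suc p ℕ.+ suc p →
                  All (λ x → x ≡ c mod suc p) zs → All (λ x → x ≡ c mod 2) zs →
                  ¬ w ≡ c mod 2 → ¬ y ≡ c mod 2 → ¬ w ≡ c mod suc p → ¬ y ≡ c mod suc p →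
                  z₁ ∈ zs → ¬ z₁ ≡ c mod suc p ℕ.* 2 → w - c + (y - c) ≡ 0ℤ mod suc p →
                  Reach (suc p ℕ.* 2) (run 1ℤ (suc p ℕ.+ suc p)) xs 0ℤ ⊎ Exceptional (suc p ℕ.* 2) xs
unequal-numbers zero          xs↭ len zs≡c parity w≢₂c y≢₂c w≢c y≢c z₁∈ z₁≢c d+f≡0 =
  contradiction (len-zs zero xs↭ len zs≡c parity w≢₂c y≢₂c w≢c y≢c) λ ()
unequal-numbers (suc zero)    xs↭ len zs≡c parity w≢₂c y≢₂c w≢c y≢c z₁∈ z₁≢c d+f≡0 =
  four-numbers xs↭ (len-zs 1 xs↭ len zs≡c parity w≢₂c y≢₂c w≢c y≢c) zs≡c z₁∈ z₁≢c w≢₂c y≢₂c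
unequal-numbers (suc (suc q)) xs↭ len zs≡c parity w≢₂c y≢₂c w≢c y≢c z₁∈ z₁≢c d+f≡0 =
  inj₁ (unequal (2 ℕ.+ q) xs↭ len zs≡c parity w≢₂c y≢₂c w≢c y≢c refl z₁∈ z₁≢c d+f≡0)

two-odd-outliers : ∀ p {xs c w y zs} → xs ↭ w ∷ y ∷ c ∷ zs → length xs ≡ suc p ℕ.+ suc p →
                   All (λ x → x ≡ c mod suc p) zs → All (λ x → x ≡ c mod 2) zs →
                   ¬ w ≡ c mod 2 → ¬ y ≡ c mod 2 → ¬ w ≡ c mod suc p → ¬ y ≡ c mod suc p →
                   Reach (suc p ℕ.* 2) (run 1ℤ (suc p ℕ.+ suc p)) xs 0ℤ ⊎ Exceptional (suc p ℕ.* 2) xs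
two-odd-outliers p {xs} {c} {w} {y} {zs} xs↭ len zs≡c parity w≢₂c y≢₂c w≢c y≢c with ((w - c) + (y - c)) ≡? 0ℤ mod suc p
... | no d+f≢0 = inj₁ (distinct-fibres p xs↭ len zs≡c parity w≢₂c y≢₂c w≢c y≢c d+f≢0)
... | yes d+f≡0 with bézout (w - c) (suc p)
...   | zero , 0∣P , _ = contradiction (0∣⇒≡0 0∣P) λ ()
...   | suc (suc g) , g∣P , d≡0 , _ = inj₁ (non-unit p xs↭ len zs≡c parity w≢₂c y≢₂c w≢c y≢c (s≤s (s≤s z≤n)) g∣P d≡0)
...   | 1 , _ , _ , gen with All.all? (λ x → x ≡? c mod (suc p ℕ.* 2)) zs
...     | yes zs≡ = all-equal p xs↭ len zs≡c parity w≢₂c y≢₂c w≢c y≢c 1≤p d+f≡0 gen zs≡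
  where
  1≤p : 1 ≤ p
  1≤p = ℕₚ.n≢0⇒n>0 λ p≡0 → contradiction (trans (len-zs p xs↭ len zs≡c parity w≢₂c y≢₂c w≢c y≢c) (cong (λ n → n ℕ.+ n) p≡0)) λ ()
...     | no ¬zs≡ with z₁ , z₁∈ , z₁≢c ← find (Allₚ.¬All⇒Any¬ (λ x → x ≡? c mod (suc p ℕ.* 2)) zs ¬zs≡) =
  unequal-numbers p xs↭ len zs≡c parity w≢₂c y≢₂c w≢c y≢c z₁∈ z₁≢c d+f≡0

-- A mixed pair whose removal leaves two outliers or none succeeds. If none is found, `y` and `w`
-- are the only numbers of their parity.
one-outside : ∀ p {xs x y w zs} → xs ↭ x ∷ y ∷ w ∷ zs → length xs ≡ suc p ℕ.+ suc p → ¬ x ≡ y mod 2 →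
              All (λ v → v ≡ x mod suc p) zs → ¬ y ≡ x mod suc p → ¬ w ≡ x mod suc p →
              Reach (suc p ℕ.* 2) (run 1ℤ (suc p ℕ.+ suc p)) xs 0ℤ ⊎ Exceptional (suc p ℕ.* 2) xs
one-outside p {xs} {x} {y} {w} {zs} xs↭ len x≢₂y zs≡x y≢x w≢x with All.all? (λ v → v ≡? x mod 2) zs
... | no ¬all with z , z∈ , z≢₂x ← find (Allₚ.¬All⇒Any¬ (λ v → v ≡? x mod 2) zs ¬all) with zs′ , zs↭ ← ∈⇒↭ z∈ =
  inj₁ (mixed-reach p xs↭′ (λ e → z≢₂x (mod-sym e)) (two-outliers p zs′ len′ (All.tail (↭ₚ.All-resp-↭ zs↭ zs≡x)) y≢x w≢x) mod-refl)
  where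
  xs↭′ : xs ↭ x ∷ z ∷ y ∷ w ∷ zs′
  xs↭′ = ↭-trans xs↭ (prep x (↭-trans (prep y (prep w zs↭)) (↭ₚ.shifts (y ∷ w ∷ []) (z ∷ []))))
  len′ : length (y ∷ w ∷ zs′) ≡ p ℕ.+ p
  len′ = ℕₚ.suc-injective (ℕₚ.suc-injective (trans (sym (↭ₚ.↭-length xs↭′)) (trans len (cong suc (ℕₚ.+-suc p p)))))
... | yes all with w ≡? x mod 2
...   | yes w≡₂x = inj₁ (mixed-reach p xs↭′ (λ e → x≢₂y (mod-trans (mod-sym w≡₂x) e)) (twice-constant p (x ∷ zs) len′ (mod-refl ∷ zs≡x)) mod-refl)
  where
  xs↭′ : xs ↭ w ∷ y ∷ x ∷ zs
  xs↭′ = ↭-trans xs↭ (↭-trans (↭ₚ.shifts (x ∷ y ∷ []) (w ∷ [])) (prep w (swap x y ↭-refl)))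
  len′ : length (x ∷ zs) ≡ p ℕ.+ p
  len′ = ℕₚ.suc-injective (ℕₚ.suc-injective (trans (sym (↭ₚ.↭-length xs↭′)) (trans len (cong suc (ℕₚ.+-suc p p)))))
...   | no w≢₂x = two-odd-outliers p (↭-trans xs↭ (↭-trans (↭ₚ.shifts (x ∷ y ∷ []) (w ∷ [])) (prep w (swap x y ↭-refl)))) len
                    zs≡x all w≢₂x (λ e → x≢₂y (mod-sym e)) w≢x y≢x

-- A single outlier among the remaining numbers obstructs only this choice of the mixed pair, so the
-- pair is chosen again to leave two outliers or none.
mixed-parity : ∀ p {xs x y rs} → xs ↭ x ∷ y ∷ rs → length xs ≡ suc p ℕ.+ suc p → ¬ x ≡ y mod 2 →
               Reach (suc p ℕ.* 2) (run 1ℤ (suc p ℕ.+ suc p)) xs 0ℤ ⊎ Exceptional (suc p ℕ.* 2) xs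
mixed-parity p {xs} {x} {y} {rs} xs↭ len x≢₂y with twice-reach p rs len-rs
  where
  len-rs : length rs ≡ p ℕ.+ p
  len-rs = ℕₚ.suc-injective (ℕₚ.suc-injective (trans (sym (↭ₚ.↭-length xs↭)) (trans len (cong suc (ℕₚ.+-suc p p)))))
... | inj₁ r = inj₁ (mixed-reach p xs↭ x≢₂y r mod-refl)
... | inj₂ (single {z} {w} {zs} rs↭ zs≡z w≢z) = by-position (x ≡? z mod suc p) (y ≡? z mod suc p)
  where
  P = suc p
  Goal = Reach (P ℕ.* 2) (run 1ℤ (P ℕ.+ P)) xs 0ℤ ⊎ Exceptional (P ℕ.* 2) xs
  xs↭′ : xs ↭ x ∷ y ∷ w ∷ zs
  xs↭′ = ↭-trans xs↭ (prep x (prep y rs↭))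
  short : ∀ {a b vs} → xs ↭ a ∷ b ∷ vs → length vs ≡ p ℕ.+ p
  short q = ℕₚ.suc-injective (ℕₚ.suc-injective (trans (sym (↭ₚ.↭-length q)) (trans len (cong suc (ℕₚ.+-suc p p)))))
  relative : ∀ {a} → a ≡ z mod P → All (λ v → v ≡ a mod P) zs
  relative a≡z = All.map (λ v≡z → mod-trans v≡z (mod-sym a≡z)) zs≡z
  -- `w` differs in parity from `x` or from `y`; removing it with that one leaves only copies of `z`
  -- modulo `P`.
  none-outside : x ≡ z mod P → y ≡ z mod P → Goal
  none-outside x≡z y≡z with w ≡? x mod 2
  ... | no w≢₂x = inj₁ (mixed-reach p p₁ w≢₂x (twice-constant p (y ∷ zs) (short p₁) (y≡z ∷ zs≡z)) mod-refl)
    where p₁ = ↭-trans xs↭′ (↭-trans (↭ₚ.shifts (x ∷ y ∷ []) (w ∷ [])) ↭-refl)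
  ... | yes w≡₂x = inj₁ (mixed-reach p p₂ (λ e → x≢₂y (mod-trans (mod-sym w≡₂x) e)) (twice-constant p (x ∷ zs) (short p₂) (x≡z ∷ zs≡z)) mod-refl)
    where p₂ = ↭-trans xs↭′ (↭-trans (↭ₚ.shifts (x ∷ y ∷ []) (w ∷ [])) (prep w (swap x y ↭-refl)))
  -- A member `v` of the main class differs in parity from `x` or from `y`; removing it with that
  -- one leaves exactly two outliers.
  both-outside : ¬ x ≡ z mod P → ¬ y ≡ z mod P → ∀ us → us ≡ zs → Goal
  both-outside x≢z y≢z [] refl = contradiction (trans (short xs↭′) refl) (1≢p+p p)
    where
    1≢p+p : ∀ p → ¬ 1 ≡ p ℕ.+ p
    1≢p+p (suc p) e = contradiction (trans e (cong suc (ℕₚ.+-suc p p))) λ ()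
  both-outside x≢z y≢z (v ∷ us) refl with v ≡? x mod 2
  ... | no v≢₂x = inj₁ (mixed-reach p q₁ v≢₂x (two-outliers p us (short q₁) (All.tail zs≡z) y≢z w≢z) mod-refl)
    where q₁ = ↭-trans xs↭′ (↭-trans (↭ₚ.shifts (x ∷ y ∷ w ∷ []) (v ∷ [])) ↭-refl)
  ... | yes v≡₂x = inj₁ (mixed-reach p q₂ (λ e → x≢₂y (mod-trans (mod-sym v≡₂x) e)) (two-outliers p us (short q₂) (All.tail zs≡z) x≢z w≢z) mod-refl)
    where q₂ = ↭-trans xs↭′ (↭-trans (↭ₚ.shifts (x ∷ y ∷ w ∷ []) (v ∷ [])) (prep v (swap x y ↭-refl)))
  by-position : Dec (x ≡ z mod P) → Dec (y ≡ z mod P) → Goal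
  by-position (yes x≡z) (yes y≡z) = none-outside x≡z y≡z
  by-position (no x≢z)  (no y≢z)  = both-outside x≢z y≢z zs refl
  by-position (yes x≡z) (no y≢z)  = one-outside p xs↭′ len x≢₂y (relative x≡z)
    (λ e → y≢z (mod-trans e x≡z)) (λ e → w≢z (mod-trans e x≡z))
  by-position (no x≢z)  (yes y≡z) = one-outside p (↭-trans xs↭′ (swap x y ↭-refl)) len (λ e → x≢₂y (mod-sym e)) (relative y≡z)
    (λ e → x≢z (mod-trans e y≡z)) (λ e → w≢z (mod-trans e y≡z))

-- Reduction by powers of two

sum-weights : ∀ P → sum (run 1ℤ (P ℕ.+ P)) ≡ + P * (1ℤ + (+ P + + P))
sum-weights P = ℤₚ.*-cancelˡ-≡ (+ 2) _ _ (trans (sum-run (P ℕ.+ P)) (lem (+ P)))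
  where
  lem : ∀ P → (P + P) * (1ℤ + (P + P)) ≡ + 2 * (P * (1ℤ + (P + P)))
  lem = solve-∀

sum-weights≡0 : ∀ {Q P} → Q ∣ P → sum (run 1ℤ (P ℕ.+ P)) ≡ 0ℤ mod Q
sum-weights≡0 {Q} {P} (divides q P≡qQ) = + q * (1ℤ + (+ P + + P)) because trans (sum-weights P)
  (trans (cong (_* (1ℤ + (+ P + + P))) (trans (cong +_ P≡qQ) (ℤₚ.pos-* q Q))) (lem (+ q) (+ Q) (1ℤ + (+ P + + P))))
  where
  lem : ∀ q Q c → q * Q * c ≡ 0ℤ + q * c * Q
  lem = solve-∀

odd-mono : ∀ {h e} → 1 ≤ h → 1 ≤ e → ∃ λ r → odd (h ℕ.* e) ≡ odd e ℕ.+ r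
odd-mono {suc h} {suc e} (s≤s z≤n) (s≤s z≤n) = h ℕ.* suc e ℕ.+ h ℕ.* suc e , lem h e
  where
  lem : ∀ h e → (1 ℕ.+ h) ℕ.* (1 ℕ.+ e) ℕ.+ (e ℕ.+ h ℕ.* (1 ℕ.+ e)) ≡ (1 ℕ.+ e) ℕ.+ e ℕ.+ (h ℕ.* (1 ℕ.+ e) ℕ.+ h ℕ.* (1 ℕ.+ e))
  lem = ℕSolver.solve-∀

-- The target 0 needs no fullness, because a common residue is killed by the sum of the weights.
long-run-reach : ∀ Q os us → 1 ≤ Q → length (run 1ℤ (odd Q) ++ os) ≡ length us →
                 sum (run 1ℤ (odd Q) ++ os) ≡ 0ℤ mod Q → Reach Q (run 1ℤ (odd Q) ++ os) us 0ℤ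
long-run-reach Q os us 1≤Q len sum≡0 = finish (full-or-balanced Q ws us 1≤Q len sum≡0 runs)
  where
  ws = run 1ℤ (odd Q) ++ os
  finish : Full Q us ⊎ Reach Q ws us 0ℤ → Reach Q ws us 0ℤ
  finish (inj₁ full) = universal Q 1≤Q 1ℤ os us
    (trans (sym len) (trans (Listₚ.length-++ (run 1ℤ (odd Q))) (cong (ℕ._+ length os) (length-run 1ℤ (odd Q))))) full 0ℤ
  finish (inj₂ r)    = r
  runs : ∀ {h e} → h ℕ.* e ≡ Q → 2 ≤ h → 1 ≤ e → ∃₂ λ a os′ → ws ↭ run a (odd e) ++ os′
  runs {h} {e} he≡Q 2≤h 1≤e with r , eq ← odd-mono {h} {e} (ℕₚ.<⇒≤ 2≤h) 1≤e = 1ℤ , _ , ↭-reflexive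
    (trans (cong (_++ os) (trans (cong (run 1ℤ) (trans (cong odd (sym he≡Q)) eq)) (run-++ 1ℤ (odd e) r)))
      (Listₚ.++-assoc (run 1ℤ (odd e)) _ os))

Solved : ℕ → List ℤ → Set
Solved m xs = Reach m (run 1ℤ m) xs 0ℤ ⊎ Exceptional m xs

-- The weights `2Q` and `3Q` carry the parity exchange: they vanish modulo `Q`, differ by `Q`, and
-- lie beyond the run `1, ..., 2Q - 1` that the other numbers use.
spread-reach : ∀ q t {us x y rs T} → let Q = suc q in us ↭ x ∷ y ∷ rs → ¬ x ≡ y mod 2 →
               length us ≡ 3 ℕ.* Q ℕ.+ t → sum (run 1ℤ (3 ℕ.* Q ℕ.+ t)) ≡ 0ℤ mod Q →
               T ≡ 0ℤ mod Q → Reach (Q ℕ.* 2) (run 1ℤ (3 ℕ.* Q ℕ.+ t)) us T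
spread-reach q t {us} {x} {y} {rs} {T} us↭ x≢y len sum≡0 T≡0 = by-exact (reach-exact (long-run-reach Q os rs (s≤s z≤n) len-ws sum-ws))
  where
  Q = suc q
  W = run 1ℤ (3 ℕ.* Q ℕ.+ t)
  u = 1ℤ + + odd Q
  os = run (u + 1ℤ) q ++ run (u + + Q + 1ℤ) t
  ws = run 1ℤ (odd Q) ++ os
  len≡ : 3 ℕ.* Q ℕ.+ t ≡ odd Q ℕ.+ (Q ℕ.+ suc t)
  len≡ = lem q t
    where
    lem : ∀ q t → 3 ℕ.* (1 ℕ.+ q) ℕ.+ t ≡ (1 ℕ.+ q) ℕ.+ q ℕ.+ ((1 ℕ.+ q) ℕ.+ (1 ℕ.+ t))
    lem = ℕSolver.solve-∀
  W↭ : W ↭ u ∷ u + + Q ∷ ws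
  W↭ = ↭-trans (↭-reflexive (trans (cong (run 1ℤ) len≡) (trans (run-++ 1ℤ (odd Q) (Q ℕ.+ suc t)) (cong (run 1ℤ (odd Q) ++_) (run-++ u Q (suc t))))))
    (↭-trans (↭ₚ.++⁺ˡ (run 1ℤ (odd Q)) (prep u (↭ₚ.shift (u + + Q) (run (u + 1ℤ) q) _))) (↭ₚ.shifts (run 1ℤ (odd Q)) (u ∷ u + + Q ∷ [])))
  u≡ : u ≡ 0ℤ + + 2 * + Q
  u≡ = lem (+ q)
    where
    lem : ∀ q → 1ℤ + (1ℤ + q + q) ≡ 0ℤ + + 2 * (1ℤ + q)
    lem = solve-∀
  u≡0 : u ≡ 0ℤ mod Q
  u≡0 = + 2 because u≡
  u+Q≡0 : u + + Q ≡ 0ℤ mod Q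
  u+Q≡0 = mod-trans (mod-+ u≡0 (period≡0 q)) mod-refl
  sum-ws : sum ws ≡ 0ℤ mod Q
  sum-ws = mod-trans (≡⇒mod (trans (lem u (u + + Q) (sum ws)) (cong (λ s → s - u - (u + + Q)) (sym (sum-↭ W↭)))))
    (mod-trans (mod-- (mod-- sum≡0 u≡0) u+Q≡0) mod-refl)
    where
    lem : ∀ a b s → s ≡ a + (b + s) - a - b
    lem = solve-∀
  len-ws : length ws ≡ length rs
  len-ws = ℕₚ.suc-injective (ℕₚ.suc-injective (trans (sym (↭ₚ.↭-length W↭)) (trans (length-run 1ℤ (3 ℕ.* Q ℕ.+ t)) (trans (sym len) (↭ₚ.↭-length us↭)))))
  by-exact : (∃ λ s → Reach 0 ws rs s × s ≡ 0ℤ mod Q) → Reach (Q ℕ.* 2) W us T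
  by-exact (s , r , s≡0) = reach-↭ (↭-sym W↭) (↭-sym us↭) (toggle Q {w = u} {x = x} {y = y} (half-period Q u x≢y) r
    (mod-trans (mod-+ (mod-*ʳ x u≡0) (mod-+ (mod-*ʳ y u+Q≡0) s≡0)) (mod-sym T≡0)))

dyadic : ∀ k xs → (∃ λ r → All (λ x → x ≡ r mod 2 ^ k) xs) ⊎
         ∃₂ λ j l → k ≡ suc j ℕ.+ l × (∃ λ r → All (λ x → x ≡ r mod 2 ^ j) xs) × ¬ ∃ λ r → All (λ x → x ≡ r mod 2 ^ suc j) xs
dyadic zero    xs = inj₁ (0ℤ , All.universal mod-one xs)
dyadic (suc k) xs with constant? (2 ^ suc k) xs
... | yes c = inj₁ c
... | no ¬c with dyadic k xs
...   | inj₁ c = inj₂ (k , 0 , cong suc (sym (ℕₚ.+-identityʳ k)) , c , ¬c)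
...   | inj₂ (j , l , refl , c , ¬c′) = inj₂ (j , suc l , cong suc (sym (ℕₚ.+-suc j l)) , c , ¬c′)

distinct-pair : ∀ n xs → ¬ (∃ λ r → All (λ x → x ≡ r mod n) xs) → ∃₂ λ x y → ∃ λ rs → xs ↭ x ∷ y ∷ rs × ¬ x ≡ y mod n
distinct-pair n []       ¬c = contradiction (0ℤ , []) ¬c
distinct-pair n (x ∷ xs) ¬c with All.all? (λ y → y ≡? x mod n) xs
... | yes all = contradiction (x , mod-refl ∷ all) ¬c
... | no ¬all with y , y∈ , y≢x ← find (Allₚ.¬All⇒Any¬ (λ y → y ≡? x mod n) xs ¬all) with rs , xs↭ ← ∈⇒↭ y∈ =
  x , y , rs , prep x xs↭ , λ e → y≢x (mod-sym e)

solve-mixed : ∀ Q xs → 1 ≤ Q → length xs ≡ Q ℕ.* 2 → ¬ (∃ λ r → All (λ x → x ≡ r mod 2) xs) → Solved (Q ℕ.* 2) xs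
solve-mixed (suc p) xs _ len ¬c with x , y , rs , xs↭ , x≢y ← distinct-pair 2 xs ¬c =
  subst (λ m → Reach (suc p ℕ.* 2) (run 1ℤ m) xs 0ℤ ⊎ Exceptional (suc p ℕ.* 2) xs) (sym 2P≡)
    (mixed-parity p xs↭ (trans len 2P≡) x≢y)
  where
  2P≡ : suc p ℕ.* 2 ≡ suc p ℕ.+ suc p
  2P≡ = trans (ℕₚ.*-comm (suc p) 2) (cong (suc p ℕ.+_) (ℕₚ.+-identityʳ (suc p)))

-- The common factor is even, so there are at least `4Q` weights. Both `2Q` and `3Q` are then
-- available besides a full run, and no exception arises.
solve-divided : ∀ h′ Q xs {r us} → let m = (2 ℕ.* suc h′) ℕ.* (Q ℕ.* 2) in 1 ≤ Q → length xs ≡ m →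
                xs ≡ map (λ u → r + + (2 ℕ.* suc h′) * u) us → ¬ (∃ λ r → All (λ x → x ≡ r mod 2) us) →
                Reach m (run 1ℤ m) xs 0ℤ
solve-divided h′ Q@(suc q) xs {r} {us} _ len xs≡ ¬c with x , y , rs , us↭ , x≢y ← distinct-pair 2 us ¬c =
  reach-mod (≡⇒mod total≡0) (reach-scale {h = h} r
    (subst (λ l → Reach (Q ℕ.* 2) (run 1ℤ l) us T) (sym m≡)
      (spread-reach q t us↭ x≢y (trans len-us m≡) (subst (λ l → sum (run 1ℤ l) ≡ 0ℤ mod Q) (trans (sym m≡P+P) m≡) (sum-weights≡0 (n∣m*n h))) T≡0)) xs≡)
  where
  h = 2 ℕ.* suc h′
  P = h ℕ.* Q
  m = h ℕ.* (Q ℕ.* 2)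
  t = Q ℕ.+ 4 ℕ.* (h′ ℕ.* Q)
  -- The common residue contributes `r * P * (2P + 1) = h * Q * c`; `T` is the multiple of `Q` that
  -- cancels it exactly after scaling by `h`.
  c = r * (1ℤ + (+ P + + P))
  T = - (+ Q * c)
  m≡ : m ≡ 3 ℕ.* Q ℕ.+ t
  m≡ = lem h′ q
    where
    lem : ∀ h q → (2 ℕ.* (1 ℕ.+ h)) ℕ.* ((1 ℕ.+ q) ℕ.* 2) ≡ 3 ℕ.* (1 ℕ.+ q) ℕ.+ ((1 ℕ.+ q) ℕ.+ 4 ℕ.* (h ℕ.* (1 ℕ.+ q)))
    lem = ℕSolver.solve-∀
  m≡P+P : m ≡ P ℕ.+ P
  m≡P+P = lem h Q
    where
    lem : ∀ h Q → h ℕ.* (Q ℕ.* 2) ≡ h ℕ.* Q ℕ.+ h ℕ.* Q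
    lem = ℕSolver.solve-∀
  len-us : length us ≡ m
  len-us = trans (sym (Listₚ.length-map _ us)) (trans (cong length (sym xs≡)) len)
  T≡0 : T ≡ 0ℤ mod Q
  T≡0 = - c because lem (+ Q) c
    where
    lem : ∀ Q c → - (Q * c) ≡ 0ℤ + - c * Q
    lem = solve-∀
  total≡0 : r * sum (run 1ℤ m) + + h * T ≡ 0ℤ
  total≡0 = trans (cong (λ s → r * s + + h * T) (trans (cong (λ l → sum (run 1ℤ l)) m≡P+P) (trans (sum-weights P) (cong (_* (1ℤ + (+ P + + P))) (ℤₚ.pos-* h Q)))))
    (lem r (+ h) (+ Q) (1ℤ + (+ P + + P)))
    where
    lem : ∀ r h Q e → r * (h * Q * e) + h * - (Q * (r * e)) ≡ 0ℤ
    lem = solve-∀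

-- The cases follow the highest power of 2 up to `2 ^ k` modulo which the numbers agree: all of
-- `2 ^ k`, where the common residue has to be even; 1, which is mixed parity; or an even power in
-- between, which is divided out.
solve-list : ∀ k n xs → 1 ≤ k → 1 ≤ n → length xs ≡ 2 ^ k ℕ.* n →
             ¬ (∃ λ r → r ≡ 1ℤ mod 2 × All (λ x → x ≡ r mod 2 ^ k) xs) → Solved (2 ^ k ℕ.* n) xs
solve-list k@(suc k′) n xs _ 1≤n len ¬odd with dyadic k xs
... | inj₁ (r , all) = inj₁ (by-scaling (unscale (2 ^ k) r xs all) (mod-two r))
  where
  m = 2 ^ k ℕ.* n
  P = 2 ^ k′ ℕ.* n
  m≡P+P : m ≡ P ℕ.+ P
  m≡P+P = trans (ℕₚ.*-assoc 2 (2 ^ k′) n) (cong (P ℕ.+_) (ℕₚ.+-identityʳ P))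
  sum≡ : sum (run 1ℤ m) ≡ + P * (1ℤ + (+ P + + P))
  sum≡ = trans (cong (λ l → sum (run 1ℤ l)) m≡P+P) (sum-weights P)
  n≤P : n ≤ P
  n≤P = ℕₚ.m≤n*m n (2 ^ k′) {{ℕₚ.m^n≢0 2 k′}}
  len≡ : ∃ λ t → m ≡ odd n ℕ.+ t
  len≡ with t , eq ← ℕₚ.m≤n⇒∃[o]m+o≡n {odd n} {m} (ℕₚ.≤-trans (ℕₚ.+-monoʳ-≤ n ℕₚ.pred[n]≤n) (ℕₚ.≤-trans
         (ℕₚ.+-mono-≤ n≤P n≤P) (ℕₚ.≤-reflexive (sym m≡P+P)))) = t , sym eq
  by-scaling : (∃ λ us → xs ≡ map (λ u → r + + (2 ^ k) * u) us) → r ≡ 0ℤ mod 2 ⊎ r ≡ 1ℤ mod 2 → Reach m (run 1ℤ m) xs 0ℤ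
  by-scaling _ (inj₂ r≡1) = contradiction (r , r≡1 , all) ¬odd
  by-scaling (us , xs≡) (inj₁ (q because r≡)) with t , m≡ ← len≡ = reach-mod total≡0 (reach-scale {h = 2 ^ k} r
    (subst (λ ws → Reach n ws us 0ℤ) (sym ws≡) (long-run-reach n (run (1ℤ + + odd n) t) us 1≤n
      (trans (cong length (sym ws≡)) (trans (length-run 1ℤ m) (trans (sym len) (trans (cong length xs≡) (Listₚ.length-map _ us)))))
      (subst (λ ws → sum ws ≡ 0ℤ mod n) (trans (cong (run 1ℤ) (sym m≡P+P)) ws≡) (sum-weights≡0 (n∣m*n (2 ^ k′)))))) xs≡)
    where
    ws≡ : run 1ℤ m ≡ run 1ℤ (odd n) ++ run (1ℤ + + odd n) t
    ws≡ = trans (cong (run 1ℤ) m≡) (run-++ 1ℤ (odd n) t)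
    -- The even residue `r` supplies the factor 2 that `P (2P + 1)` lacks.
    total≡0 : r * sum (run 1ℤ m) + + (2 ^ k) * 0ℤ ≡ 0ℤ mod m
    total≡0 = q * (1ℤ + (+ P + + P)) because trans (cong₂ (λ r s → r * s + + (2 ^ k) * 0ℤ) r≡ sum≡)
      (trans (lem q (+ P) (+ (2 ^ k))) (cong (λ n → 0ℤ + q * (1ℤ + (+ P + + P)) * + n) (sym m≡P+P)))
      where
      lem : ∀ q P h → (0ℤ + q * + 2) * (P * (1ℤ + (P + P))) + h * 0ℤ ≡ 0ℤ + q * (1ℤ + (P + P)) * (P + P)
      lem = solve-∀
... | inj₂ (zero , l , refl , _ , ¬c) = subst (λ m → Solved m xs) Q*2≡m
  (solve-mixed Q xs (1≤2^* l) (trans len (sym Q*2≡m)) ¬c)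
  where
  Q = 2 ^ l ℕ.* n
  1≤2^* : ∀ l → 1 ≤ 2 ^ l ℕ.* n
  1≤2^* l = ℕₚ.≤-trans 1≤n (ℕₚ.m≤n*m n (2 ^ l) {{ℕₚ.m^n≢0 2 l}})
  Q*2≡m : Q ℕ.* 2 ≡ 2 ^ suc l ℕ.* n
  Q*2≡m = trans (ℕₚ.*-comm Q 2) (sym (ℕₚ.*-assoc 2 (2 ^ l) n))
... | inj₂ (suc j′ , l , refl , (r , all) , ¬c) = inj₁ (by-scaling (2 ^ j′) refl (unscale (2 ^ suc j′) r xs all))
  where
  Q = 2 ^ l ℕ.* n
  m = 2 ^ (suc (suc j′) ℕ.+ l) ℕ.* n
  by-scaling : ∀ h → h ≡ 2 ^ j′ → (∃ λ us → xs ≡ map (λ u → r + + (2 ^ suc j′) * u) us) → Reach m (run 1ℤ m) xs 0ℤ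
  by-scaling zero     h≡ _          = contradiction (sym h≡) (ℕ.≢-nonZero⁻¹ (2 ^ j′) {{ℕₚ.m^n≢0 2 j′}})
  by-scaling (suc h′) h≡ (us , xs≡) = subst (λ m → Reach m (run 1ℤ m) xs 0ℤ) (sym m≡)
    (solve-divided h′ Q xs {r} {us} (ℕₚ.≤-trans 1≤n (ℕₚ.m≤n*m n (2 ^ l) {{ℕₚ.m^n≢0 2 l}})) (trans len m≡)
      (trans xs≡ (cong (λ h → map (λ u → r + + (2 ℕ.* h) * u) us) (sym h≡)))
      λ { (r′ , us≡r′) → ¬c (r + + (2 ^ suc j′) * r′ , subst (All _) (sym xs≡) (Allₚ.map⁺ (All.map (λ {u} u≡r′ →
        mod-+ˡ r (subst (λ n → + (2 ^ suc j′) * u ≡ + (2 ^ suc j′) * r′ mod n) (ℕₚ.*-comm (2 ^ suc j′) 2) (mod-scale {h = 2 ^ suc j′} u≡r′))) us≡r′))) })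
    where
    m≡ : m ≡ 2 ℕ.* suc h′ ℕ.* (Q ℕ.* 2)
    m≡ = trans (cong (ℕ._* n) (ℕₚ.^-distribˡ-+-* 2 (suc (suc j′)) l)) (trans (lem (2 ^ j′) (2 ^ l) n) (cong (λ h → 2 ℕ.* h ℕ.* (Q ℕ.* 2)) (sym h≡)))
      where
      lem : ∀ a b n → (2 ℕ.* (2 ℕ.* a)) ℕ.* b ℕ.* n ≡ 2 ℕ.* a ℕ.* (b ℕ.* n ℕ.* 2)
      lem = ℕSolver.solve-∀

-- From lists to permutations of Fin m

-- The bijection of positions underlying the list permutation becomes the permutation of `Fin m`.
permute-tabulate : ∀ {A : Set} {m} (f : Fin m → A) {ys} → ys ↭ tabulate f → length ys ≡ m →
                   ∃ λ (σ : Permutation′ m) → ys ≡ tabulate (λ i → f (σ ⟨$⟩ʳ i))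
permute-tabulate {A} f {ys} p refl = σ ,
  trans (sym (Listₚ.tabulate-lookup ys)) (Listₚ.tabulate-cong λ i → trans (Setoidₚ.onIndices-lookup (setoid A) (↭⇒↭ₛ p) i) (at (index i)))
  where
  lt = Listₚ.length-tabulate f
  τ = Homogeneous.onIndices (↭⇒↭ₛ p)
  index = τ ⟨$⟩ʳ_
  σ = τ ∘ₚ cast-id lt
  at : ∀ k → lookup (tabulate f) k ≡ f (Fin.cast lt k)
  at k = trans (cong (lookup (tabulate f)) (sym (Finₚ.cast-involutive (sym lt) lt k))) (Listₚ.lookup-tabulate f (Fin.cast lt k))

dot-sumFin : ∀ m (v g : Fin m → ℕ) zs → map proj₁ zs ≡ tabulate (λ i → + v i) → map proj₂ zs ≡ tabulate (λ i → + g i) →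
             dot zs ≡ + sumFin m (λ i → v i ℕ.* g i)
dot-sumFin zero    v g []             _ _ = refl
dot-sumFin (suc m) v g ((w , x) ∷ zs) p q with refl , p′ ← Listₚ.∷-injective p | refl , q′ ← Listₚ.∷-injective q =
  cong₂ _+_ (sym (ℤₚ.pos-* (v Fin.zero) (g Fin.zero))) (dot-sumFin m (v ∘ Fin.suc) (g ∘ Fin.suc) zs p′ q′)

run-tabulate : ∀ c m → run (+ suc c) m ≡ tabulate {n = m} (λ i → + (c ℕ.+ suc (toℕ i)))
run-tabulate c zero    = refl
run-tabulate c (suc m) = cong₂ _∷_ (cong +_ (ℕₚ.+-comm 1 c)) (trans (cong (λ b → run b m) (cong +_ (ℕₚ.+-comm (suc c) 1)))
  (trans (run-tabulate (suc c) m) (Listₚ.tabulate-cong λ i → cong +_ (sym (ℕₚ.+-suc c (suc (toℕ i)))))))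

mod⇒% : ∀ {n a b} .{{_ : NonZero n}} → + a ≡ + b mod n → a ℕ.% n ≡ b ℕ.% n
mod⇒% {n} {a} {b} (q because e) = by-sign q e
  where
  above : ∀ a b q → + a ≡ + b + + q * + n → a ℕ.% n ≡ b ℕ.% n
  above a b q e = trans (cong (ℕ._% n) (ℤₚ.+-injective (trans e (cong (_+_ (+ b)) (sym (ℤₚ.pos-* q n))))))
    (DivMod.[m+kn]%n≡m%n b q n)
  by-sign : ∀ q → + a ≡ + b + q * + n → a ℕ.% n ≡ b ℕ.% n
  by-sign (+ q)        e = above a b q e
  by-sign ℤ.-[1+ q ] e = sym (above b a (suc q) (trans (lem (+ b) ℤ.-[1+ q ] (+ n)) (cong (_+ + suc q * + n) (sym e))))
    where
    lem : ∀ b k n → b ≡ (b + k * n) + - k * n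
    lem = solve-∀

module _ {m : ℕ} (a : Fin m → Fin m) where

  values : List ℤ
  values = tabulate (λ i → + toℕ (a i))

  length-values : length values ≡ m
  length-values = Listₚ.length-tabulate (λ i → + toℕ (a i))

  reach⇒permutable : .{{_ : NonZero m}} → Reach m (run 1ℤ m) values 0ℤ → ZeroSumPermutable m a
  reach⇒permutable (reach zs p q e)
    with zs′ , ws≡ , zs↭ ← ↭ₚ.↭-map-inv proj₁ p
    with σ , xs≡ ← permute-tabulate (λ i → + toℕ (a i)) (↭-trans (↭ₚ.map⁺ proj₂ (↭-sym zs↭)) q)
                     (trans (Listₚ.length-map proj₂ zs′) (trans (sym (Listₚ.length-map proj₁ zs′)) (trans (cong length (sym ws≡)) (length-run 1ℤ m)))) =
    σ , trans (mod⇒% {b = 0} (mod-trans (≡⇒mod (trans (sym (dot-sumFin m (λ i → suc (toℕ i)) (λ i → toℕ (a (σ ⟨$⟩ʳ i))) zs′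
      (trans (sym ws≡) (run-tabulate 0 m)) xs≡)) (sum-↭ (↭ₚ.map⁺ (uncurry _*_) (↭-sym zs↭))))) e)) (DivMod.m*n%n≡0 0 m)

tabulate-snoc₂ : ∀ {A : Set} m′ (g : Fin (suc (suc m′)) → A) zs {w y} → tabulate g ≡ zs ++ w ∷ y ∷ [] →
                 (∀ j → g (inject₁ (inject₁ j)) ∈ zs) × g (inject₁ (fromℕ m′)) ≡ w × g (fromℕ (suc m′)) ≡ y
tabulate-snoc₂ zero     g []                refl = (λ ()) , refl , refl
tabulate-snoc₂ zero     g (z ∷ [])          ()
tabulate-snoc₂ zero     g (z ∷ z′ ∷ [])     ()
tabulate-snoc₂ zero     g (z ∷ z′ ∷ _ ∷ _)  ()
tabulate-snoc₂ (suc m′) g []                ()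
tabulate-snoc₂ (suc m′) g (z ∷ zs)          e with refl , e′ ← Listₚ.∷-injective e
  with inside , w≡ , y≡ ← tabulate-snoc₂ m′ (g ∘ Fin.suc) zs e′ =
  (λ { Fin.zero → here refl ; (Fin.suc j) → there (inside j) }) , w≡ , y≡

exceptional⇒special : ∀ m′ (a : Fin (suc (suc m′)) → Fin (suc (suc m′))) → 2 ∣ suc (suc m′) →
                      Exceptional (suc (suc m′)) (values a) → SpecialForm m′ a
exceptional⇒special m′ a 2∣m exc = by-order (permute-tabulate (λ i → + toℕ (a i)) ys↭ len)
  where
  open Exceptional exc
  m = suc (suc m′)
  x = z ℤ.%ℕ m
  b = (w - z) ℤ.%ℕ m
  ys = zs ++ w ∷ y ∷ []
  ys↭ : ys ↭ values a
  ys↭ = ↭-trans (↭ₚ.++-comm zs (w ∷ y ∷ [])) (↭-sym xs↭)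
  len : length ys ≡ m
  len = trans (↭ₚ.↭-length ys↭) (length-values a)
  z≡x : z ≡ + x mod m
  z≡x = mod-%ℕ z m
  b≡ : w - z ≡ + b mod m
  b≡ = mod-%ℕ (w - z) m
  x-even : Even x
  -- Reduction modulo `m` keeps the parity of `z` because `m` is even.
  x-even = mod⇒% {b = 0} (mod-trans (mod-sym (mod-∣ 2∣m z≡x)) even)
  coprime : gcd b m ≡ 1
  coprime with gcd b m in eq | gcd[m,n]∣m b m | gcd[m,n]∣n b m
  ... | zero        | _ | 0∣m = contradiction (0∣⇒≡0 0∣m) λ ()
  ... | suc zero    | _ | _   = refl
  ... | suc (suc g) | divides q b≡qg | g∣m = contradiction (mod-trans (mod-∣ g∣m b≡) b≡0) (unit g∣m (s≤s (s≤s z≤n)))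
    where
    b≡0 : + b ≡ 0ℤ mod suc (suc g)
    b≡0 = + q because trans (cong +_ b≡qg) (trans (ℤₚ.pos-* q _) (sym (ℤₚ.+-identityˡ _)))
  residue : ∀ {i n} → + toℕ (a i) ≡ + n mod m → toℕ (a i) ≡ n ℕ.% m
  residue {i} e = trans (sym (DivMod.m<n⇒m%n≡m (Finₚ.toℕ<n (a i)))) (mod⇒% e)
  w≡ : w ≡ + (x ℕ.+ b) mod m
  w≡ = mod-trans (≡⇒mod (lem w z)) (mod-+ z≡x b≡)
    where
    lem : ∀ w z → w ≡ z + (w - z)
    lem = solve-∀
  y≡ : y ≡ + (x ℕ.+ (m ℕ.∸ b ℕ.% m)) mod m
  y≡ = mod-trans (≡⇒mod (lem₁ w y z)) (mod-trans (mod-- (mod-- (mod-trans w+y≡2z (mod-+ z≡x z≡x)) z≡x) b≡)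
    -- `- b` is represented by the natural number `m - b`, whence the quotient -1.
    (mod-trans (- 1ℤ because trans (lem₂ (+ x) (+ b) (+ m)) (cong (λ c → + x + c + - 1ℤ * + m) m-b≡)) mod-refl))
    where
    b%m≡b : b ℕ.% m ≡ b
    b%m≡b = DivMod.m<n⇒m%n≡m (ℤ.n%ℕd<d (w - z) m)
    m-b≡ : + m - + b ≡ + (m ℕ.∸ b ℕ.% m)
    m-b≡ = trans (ℤₚ.m-n≡m⊖n m b) (trans (ℤₚ.⊖-≥ (ℕₚ.<⇒≤ (ℤ.n%ℕd<d (w - z) m))) (cong (λ c → + (m ℕ.∸ c)) (sym b%m≡b)))
    lem₁ : ∀ w y z → y ≡ w + y - z - (w - z)
    lem₁ = solve-∀
    lem₂ : ∀ x b m → x + x - x - b ≡ x + (m - b) + - 1ℤ * m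
    lem₂ = solve-∀
  by-order : (∃ λ (σ : Permutation′ m) → ys ≡ tabulate (λ i → + toℕ (a (σ ⟨$⟩ʳ i)))) → SpecialForm m′ a
  by-order (σ , ys≡) with inside , at-w , at-y ← tabulate-snoc₂ m′ (λ i → + toℕ (a (σ ⟨$⟩ʳ i))) zs (sym ys≡) =
    x , b , σ , x-even , coprime ,
    (λ j → residue (mod-trans (All.lookup zs≡z (inside j)) z≡x)) ,
    residue (mod-trans (≡⇒mod at-w) w≡) , residue (mod-trans (≡⇒mod at-y) y≡)

-- The residue is read off the first entry. It inherits the parity of `r`, since the modulus
-- `2 ^ suc k′` is even.
same-odd-residue : ∀ k′ {m} (a : Fin (suc m) → Fin (suc m)) {r} → r ≡ 1ℤ mod 2 →
                   All (λ x → x ≡ r mod 2 ^ suc k′) (values a) → AllSameOddResidue (suc m) (suc k′) a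
same-odd-residue k′ a {r} r-odd all = toℕ (a Fin.zero) % M , odd-residue , λ i → mod⇒% (mod-trans (at i) (mod-sym (at Fin.zero)))
  where
  M = 2 ^ suc k′
  instance
    M≢0 : NonZero M
    M≢0 = ℕₚ.m^n≢0 2 (suc k′)
  at : ∀ i → + toℕ (a i) ≡ r mod M
  at i = All.lookup all (∈-tabulate⁺ {f = λ i → + toℕ (a i)} i)
  odd-residue : Odd (toℕ (a Fin.zero) % M)
  odd-residue = mod⇒% {a = toℕ (a Fin.zero) % M} {b = 1} (mod-trans (mod-∣ (divides (2 ^ k′) (ℕₚ.*-comm 2 (2 ^ k′)))
    (mod-trans (mod-sym (mod-%ℕ (+ toℕ (a Fin.zero)) M)) (at Fin.zero))) r-odd)

theorem1p5 : (k n m' : ℕ) → 1 ≤ k → Odd n → suc (suc m') ≡ 2 ^ k ℕ.* n →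
             (a : Fin (suc (suc m')) → Fin (suc (suc m'))) →
             ¬ AllSameOddResidue (suc (suc m')) k a →
             ¬ SpecialForm m' a →
             ZeroSumPermutable (suc (suc m')) a
theorem1p5 k@(suc k′) n m' 1≤k n-odd m≡ a ¬same ¬special = finish (subst (λ m → Solved m (values a)) (sym m≡)
  (solve-list k n (values a) 1≤k 1≤n (trans (length-values a) m≡) λ { (r , r-odd , all) → ¬same (same-odd-residue k′ a r-odd all) }))
  where
  1≤n : 1 ≤ n
  1≤n = ℕₚ.n≢0⇒n>0 λ { refl → contradiction n-odd λ () }
  finish : Solved (suc (suc m')) (values a) → ZeroSumPermutable (suc (suc m')) a
  finish (inj₁ r)   = reach⇒permutable a r
  finish (inj₂ exc) = contradiction (exceptional⇒special m' a
    (divides (2 ^ k′ ℕ.* n) (trans m≡ (trans (ℕₚ.*-assoc 2 (2 ^ k′) n) (ℕₚ.*-comm 2 (2 ^ k′ ℕ.* n))))) exc) ¬special
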